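{- There is a quantile estimation algorithm that, when finding the $k$-th largest element, uses $O(\log k)$ words of memory and incurs an $O(\sqrt{k})$ error in expectation over the randomness in both the algorithm and the order of the stream. (The constants hidden in $O(\cdot)$ are absolute and do not depend on $n$.)
   Context: Quantile estimation: Let $x_1 > \cdots > x_n$ be distinct numbers unknown to the algorithm. The algorithm takes $n$ and $k$ ($1\le k\le n$) as inputs, reads a uniformly random permutation of the $n$ numbers one by one, and outputs some $x^*\in\{x_1,\dots,x_n\}$. Its error is $|\mathrm{Rank}(x^*) - k|$, where $\mathrm{Rank}(x^*) = |\{j : x_j\ge x^*\}|$. Memory model: word RAM, where each word can store either an integer of magnitude $\mathrm{poly}(n)$ or one element of the stream. Memory usage is the number of words used. -}

module Defs where

open import Level using (0ℓ)
open import Data.Bool.Base using (Bool; true; false; if_then_else_)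
open import Data.Empty using (⊥)
open import Data.Fin.Base as Fin using (Fin; toℕ; fromℕ<)
open import Data.Integer.Base as ℤ using (ℤ; +_; -[1+_]; +[1+_]; +0; ∣_∣)
import Data.Integer.Properties as ℤₚ
open import Data.List.Base as List using (List; []; _∷_; length; insertAt; filter; allFin)
open import Data.Nat.Base as ℕ using (ℕ; zero; suc; ∣_-_∣)
open import Data.Nat.Properties using (_≤?_; _<?_)
open import Data.Rational.Base as ℚ using (ℚ; 0ℚ)
open import Data.Rational.Properties using (+-0-commutativeMonoid)
open import Data.Vec.Base as Vec using (Vec; lookup; replicate; _[_]≔_)
open import Relation.Binary.Bundles using (DecTotalOrder)
open import Relation.Nullary.Decidable.Core using (does; yes; no)
import Relation.Binary.Properties.DecTotalOrder as OrderProperties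
open import Algebra.Properties.CommutativeMonoid.Sum +-0-commutativeMonoid using (sum)

-- `draw l f` continues with `f i` for a fresh uniform i : Fin (suc l).
data Rand (X : Set) : Set where
  return : X → Rand X
  crash  : Rand X
  draw   : (l : ℕ) → (Fin (suc l) → Rand X) → Rand X

infixl 1 _>>=_

_>>=_ : {X Y : Set} → Rand X → (X → Rand Y) → Rand Y
return x >>= g = g x
crash    >>= g = crash
draw l f >>= g = draw l (λ i → f i >>= g)

-- Every branch returns, with a value satisfying Q; no branch crashes.
Always : {X : Set} → (X → Set) → Rand X → Set
Always Q (return x) = Q x
Always Q crash      = ⊥
Always Q (draw l f) = ∀ i → Always Q (f i)

-- The value at `crash` is a dummy: the expectation of v is only meaningful
-- for computations that never crash.
expectation : {X : Set} → (X → ℚ) → Rand X → ℚ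
expectation v (return x) = v x
expectation v crash      = 0ℚ
expectation v (draw l f) =
  (+ 1 ℚ./ suc l) ℚ.* sum (λ i → expectation v (f i))

-- Inserting each entry at a uniform position of a uniformly random ordering
-- of the later ones reaches each of the n! orderings of a list of length n
-- along exactly one branch, of probability 1/n!.
shuffle : {X : Set} → List X → Rand (List X)
shuffle []       = return []
shuffle (x ∷ xs) = do
  ys ← shuffle xs
  draw (length ys) (λ i → return (insertAt ys i x))

Addr : Set
Addr = ℕ

data Op : Set where
  add sub mul quo : Op

-- Operands are addresses, except for the literal in `const`.
infixr 5 _⨾_

data Program : Set where
  skip             : Program
  const            : Addr → ℤ → Program
  copy             : Addr → Addr → Program
  load             : Addr → Addr → Program          -- mem[a] := mem[mem[b]]
  store            : Addr → Addr → Program          -- mem[mem[a]] := mem[b]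
  arith            : Addr → Op → Addr → Addr → Program
  random           : Addr → Addr → Program          -- mem[a] := uniform in {0,…,mem[b]-1}
  next             : Addr → Program                 -- mem[a] := next stream element
  _⨾_              : Program → Program → Program
  if_≤_then_else_  : Addr → Addr → Program → Program → Program
  while_≤_loop_    : Addr → Addr → Program → Program

data Word (A : Set) : Set where
  int  : ℤ → Word A
  elem : A → Word A

applyOp : Op → ℤ → ℤ → Rand ℤ
applyOp add y z            = return (y ℤ.+ z)
applyOp sub y z            = return (y ℤ.- z)
applyOp mul y z            = return (y ℤ.* z)
applyOp quo y +0           = crash
applyOp quo y z@(+[1+ _ ]) = return (y ℤ./ z)
applyOp quo y z@(-[1+ _ ]) = return (y ℤ./ z)

asInt : {A : Set} → Word A → Rand ℤ
asInt (int z)  = return z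
asInt (elem _) = crash

asElem : {A : Set} → Word A → Rand A
asElem (int _)  = crash
asElem (elem y) = return y

asAddr : {A : Set} → Word A → Rand Addr
asAddr (int (+ a))    = return a
asAddr (int -[1+ _ ]) = crash
asAddr (elem _)       = crash

-- A machine with s words of memory, whose integers have magnitude at most B.
-- Stepping outside these limits crashes, so a run that does not crash
-- certifies both.  Stream elements can only be moved and compared.
module Machine (O : DecTotalOrder 0ℓ 0ℓ 0ℓ) (s B : ℕ) where

  open DecTotalOrder O using (Carrier) renaming (_≤?_ to _≤ᴼ?_)

  record State : Set where
    constructor ⟨_,_⟩
    field
      memory : Vec (Word Carrier) s
      stream : List Carrier

  open State public

  read : Addr → State → Rand (Word Carrier)
  read a σ with a <? s
  ... | yes a<s = return (lookup (memory σ) (fromℕ< a<s))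
  ... | no  _   = crash

  fits : Word Carrier → Bool
  fits (int z)  = does (∣ z ∣ ≤? B)
  fits (elem _) = true

  write : Addr → Word Carrier → State → Rand State
  write a w σ with a <? s | fits w
  ... | yes a<s | true  = return ⟨ memory σ [ fromℕ< a<s ]≔ w , stream σ ⟩
  ... | yes _   | false = crash
  ... | no  _   | _     = crash

  compare : Word Carrier → Word Carrier → Rand Bool
  compare (int y)  (int z)  = return (does (y ℤₚ.≤? z))
  compare (elem y) (elem z) = return (does (y ≤ᴼ? z))
  compare (int _)  (elem _) = crash
  compare (elem _) (int _)  = crash

  test : Addr → Addr → State → Rand Bool
  test a b σ = do
    v ← read a σ
    w ← read b σ
    compare v w

  uniformBelow : ℤ → Rand ℤ
  uniformBelow +[1+ l ]  = draw l (λ i → return (+ toℕ i))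
  uniformBelow +0        = crash
  uniformBelow -[1+ _ ]  = crash

  takeNext : Addr → State → Rand State
  takeNext a ⟨ μ , [] ⟩     = crash
  takeNext a ⟨ μ , y ∷ ys ⟩ = write a (elem y) ⟨ μ , ys ⟩

  -- The fuel bounds the iterations of loops; running out of it crashes.
  exec : (fuel : ℕ) → Program → State → Rand State
  exec t skip        σ = return σ
  exec t (const a z) σ = write a (int z) σ
  exec t (copy a b)  σ = do
    w ← read b σ
    write a w σ
  exec t (load a b)  σ = do
    p ← read b σ
    i ← asAddr p
    w ← read i σ
    write a w σ
  exec t (store a b) σ = do
    p ← read a σ
    i ← asAddr p
    w ← read b σ
    write i w σ
  exec t (arith a op b c) σ = do
    v ← read b σ
    y ← asInt v
    w ← read c σ
    z ← asInt w
    r ← applyOp op y z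
    write a (int r) σ
  exec t (random a b) σ = do
    w ← read b σ
    z ← asInt w
    r ← uniformBelow z
    write a (int r) σ
  exec t (next a)  σ = takeNext a σ
  exec t (P ⨾ Q)   σ = do
    σ′ ← exec t P σ
    exec t Q σ′
  exec t (if a ≤ b then P else Q) σ = do
    c ← test a b σ
    (if c then exec t P σ else exec t Q σ)
  exec zero    (while a ≤ b loop P) σ = crash
  exec (suc t) (while a ≤ b loop P) σ = do
    c ← test a b σ
    (if c then (exec (suc t) P σ >>= exec t (while a ≤ b loop P)) else return σ)

  -- Inputs n and k arrive in words 0 and 1 (the other words hold 0); the
  -- output is the stream element left in word 0.
  run : (fuel : ℕ) → Program → (n k : ℕ) → List Carrier → Rand Carrier
  run t P n k xs = do
    σ₀ ← write 0 (int (+ n)) ⟨ replicate s (int +0) , xs ⟩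
    σ₁ ← write 1 (int (+ k)) σ₀
    σ₂ ← exec t P σ₁
    w  ← read 0 σ₂
    asElem w

module Quantile (O : DecTotalOrder 0ℓ 0ℓ 0ℓ) where

  open DecTotalOrder O using (Carrier) renaming (_≤?_ to _≤ᴼ?_)
  open OrderProperties O using (_<_)

  StrictlyDecreasing : {n : ℕ} → (Fin n → Carrier) → Set
  StrictlyDecreasing x = ∀ {i j} → i Fin.< j → x j < x i

  rank : {n : ℕ} → (Fin n → Carrier) → Carrier → ℕ
  rank {n} x y = length (filter (λ j → y ≤ᴼ? x j) (allFin n))

  error : {n : ℕ} → (Fin n → Carrier) → ℕ → Carrier → ℚ
  error x k y = + ∣ rank x y - k ∣ ℚ./ 1

  estimate : (s B fuel : ℕ) → Program → {n : ℕ} → (k : ℕ) →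
             (Fin n → Carrier) → Rand Carrier
  estimate s B t P {n} k x = do
    xs ← shuffle (List.tabulate x)
    Machine.run O s B t P n k xs

{-# OPTIONS --safe #-}
-- Every arrival of a random order falls into each of the gaps between the
-- earlier elements with the same probability, so the rank r of a stored element
-- y evolves as a Pólya urn.  Let τ be one more than the number of elements read,
-- p = k / (n + 1), and e = r − p τ; at the end, e is r − k.  The algorithm keeps
-- five elements.  It starts from the maximum, at a time when p τ is a large
-- constant, and then alternates blocks of two kinds.  Counting the arrivals above
-- y during a fixed fraction of τ arrivals yields an estimate ê of e with variance
-- O(p τ).  If ê is not small, then the nearest element on the side of the target
-- in a window of 2 τ / |ê| arrivals replaces y: its distance from y is
-- approximately exponential with mean |ê| / 2, so that E e² becomes about
-- (e² + (ê − e)²) / 2, which outweighs the growth of e² by the urn.  Hence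
-- e² − O(p τ) does not increase in expectation from block to block, and
-- potentials for the times within a block make it a supermartingale.  At the end
-- E e² = O(p n) = O(k).
module Submission where

open import Level using (0ℓ)
open import Data.Bool.Base using (Bool; true; false)
open import Data.Nat.Base as ℕ using (ℕ; zero; suc; s≤s; z≤n)
import Data.Nat.DivMod as ℕᵈ
import Data.Nat.Properties as ℕₚ
open import Data.Product.Base using (_×_; _,_; ∃-syntax; proj₁; proj₂)
open import Data.Rational.Base using (ℚ)
open import Data.Sum.Base using (_⊎_; inj₁; inj₂)
open import Relation.Binary.PropositionalEquality
open import Relation.Nullary.Decidable.Core using (Dec; does; yes; no)
open import Relation.Nullary.Negation using (contradiction)
open import Tactic.RingSolver using (solve-∀)

-- The displacement of y at the end of a window and the drift of its rank during the window come
-- from the same arrivals and are correlated. Bounding the square of the final offset by a weighted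
-- sum of two squares, one for each, makes linearity of expectation suffice: the first is averaged
-- through closed forms for sums of rising factorials, the second by a one-step inequality. A block
-- also incurs constant costs, from rounding and from estimates ê below the threshold. They are paid
-- out of savings: the budget `γ * p * (2 * (N - τ))` releases 2 γ p per arrival, but a count block
-- spends only half of that on its variances. Since p τ₀ ≥ 64 at its beginning and its length is at
-- least τ₀ / 128, it has saved γ p len ≥ γ / 2 by its end. This is why the maximum is kept until p
-- τ ≥ 64. The stream may end in the middle of a block, so the potentials are built to dominate e² /
-- 4 at all times, not only at the boundaries.

-- Arithmetic in ℚ and certificates for inequalities

module RationalLemmas where

  open import Data.Integer.Base as ℤ using (+_)
  import Data.Integer.Properties as ℤₚ
  open import Data.Maybe.Base using (Maybe; just; nothing)
  open import Data.Rational.Base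
  open import Data.Rational.Properties
  import Data.Rational.Unnormalised.Base as ℚᵘ
  import Data.Rational.Unnormalised.Properties as ℚᵘₚ
  open import Tactic.RingSolver.Core.AlmostCommutativeRing using (AlmostCommutativeRing; fromCommutativeRing)

  ring : AlmostCommutativeRing 0ℓ 0ℓ
  ring = fromCommutativeRing +-*-commutativeRing isZero
    where
    isZero : ∀ x → Maybe (0ℚ ≡ x)
    isZero x with 0ℚ ≟ x
    ... | yes 0≡x = just 0≡x
    ... | no  _   = nothing

  ⟦_⟧ : ℕ → ℚ
  ⟦ m ⟧ = + m / 1

  private
    toℚᵘ-⟦⟧ : ∀ m → toℚᵘ ⟦ m ⟧ ℚᵘ.≃ ℚᵘ.mkℚᵘ (+ m) 0
    toℚᵘ-⟦⟧ m = toℚᵘ-fromℚᵘ (ℚᵘ.mkℚᵘ (+ m) 0)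

  ⟦⟧-+ : ∀ m n → ⟦ m ℕ.+ n ⟧ ≡ ⟦ m ⟧ + ⟦ n ⟧
  ⟦⟧-+ m n = toℚᵘ-injective (begin
    toℚᵘ ⟦ m ℕ.+ n ⟧                             ≈⟨ toℚᵘ-⟦⟧ (m ℕ.+ n) ⟩
    ℚᵘ.mkℚᵘ (+ (m ℕ.+ n)) 0                      ≈⟨ ℚᵘ.*≡*
        (cong (ℤ._* + 1) (cong₂ ℤ._+_ (ℤₚ.*-identityʳ (+ m)) (ℤₚ.*-identityʳ (+ n)))) ⟨
    ℚᵘ.mkℚᵘ (+ m) 0 ℚᵘ.+ ℚᵘ.mkℚᵘ (+ n) 0        ≈⟨ ℚᵘₚ.+-cong (toℚᵘ-⟦⟧ m) (toℚᵘ-⟦⟧ n) ⟨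
    toℚᵘ ⟦ m ⟧ ℚᵘ.+ toℚᵘ ⟦ n ⟧                   ≈⟨ toℚᵘ-homo-+ ⟦ m ⟧ ⟦ n ⟧ ⟨
    toℚᵘ (⟦ m ⟧ + ⟦ n ⟧)                         ∎)
    where open ℚᵘₚ.≃-Reasoning

  ⟦⟧-* : ∀ m n → ⟦ m ℕ.* n ⟧ ≡ ⟦ m ⟧ * ⟦ n ⟧
  ⟦⟧-* m n = toℚᵘ-injective (begin
    toℚᵘ ⟦ m ℕ.* n ⟧                             ≈⟨ toℚᵘ-⟦⟧ (m ℕ.* n) ⟩
    ℚᵘ.mkℚᵘ (+ (m ℕ.* n)) 0                      ≈⟨ ℚᵘ.*≡* (cong (ℤ._* + 1) (sym (ℤₚ.pos-* m n))) ⟨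
    ℚᵘ.mkℚᵘ (+ m) 0 ℚᵘ.* ℚᵘ.mkℚᵘ (+ n) 0        ≈⟨ ℚᵘₚ.*-cong (toℚᵘ-⟦⟧ m) (toℚᵘ-⟦⟧ n) ⟨
    toℚᵘ ⟦ m ⟧ ℚᵘ.* toℚᵘ ⟦ n ⟧                   ≈⟨ toℚᵘ-homo-* ⟦ m ⟧ ⟦ n ⟧ ⟨
    toℚᵘ (⟦ m ⟧ * ⟦ n ⟧)                         ∎)
    where open ℚᵘₚ.≃-Reasoning

  ⟦⟧-suc : ∀ m → ⟦ suc m ⟧ ≡ 1ℚ + ⟦ m ⟧
  ⟦⟧-suc m = ⟦⟧-+ 1 m

  ⟦⟧-mono : ∀ {m n} → m ℕ.≤ n → ⟦ m ⟧ ≤ ⟦ n ⟧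
  ⟦⟧-mono {m} {n} m≤n = toℚᵘ-cancel-≤ (ℚᵘₚ.≤-respˡ-≃ (ℚᵘₚ.≃-sym (toℚᵘ-⟦⟧ m)) (ℚᵘₚ.≤-respʳ-≃ (ℚᵘₚ.≃-sym (toℚᵘ-⟦⟧ n))
    (ℚᵘ.*≤* (subst₂ ℤ._≤_ (sym (ℤₚ.*-identityʳ (+ m))) (sym (ℤₚ.*-identityʳ (+ n))) (ℤ.+≤+ m≤n)))))

  ⟦⟧≥0 : ∀ m → 0ℚ ≤ ⟦ m ⟧
  ⟦⟧≥0 m = ⟦⟧-mono {0} {m} ℕ.z≤n

  infixl 6 _⊕_
  infixl 7 _⊛_

  _⊕_ : ∀ {x y} → 0ℚ ≤ x → 0ℚ ≤ y → 0ℚ ≤ x + y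
  _⊕_ = +-mono-≤

  _⊛_ : ∀ {x y} → 0ℚ ≤ x → 0ℚ ≤ y → 0ℚ ≤ x * y
  _⊛_ {x} {y} p q = subst (_≤ x * y) (*-zeroʳ x) (*-monoˡ-≤-nonNeg x {{nonNegative p}} q)

  diff≥0 : ∀ {x y} → x ≤ y → 0ℚ ≤ y - x
  diff≥0 {x} {y} p = subst (_≤ y - x) (+-inverseʳ x) (+-monoˡ-≤ (- x) p)

  -- Inequalities are proved by exhibiting the difference of the two sides as
  -- an expression that is visibly nonnegative.
  by-cert : ∀ {x y} c → y - x ≡ c → 0ℚ ≤ c → x ≤ y
  by-cert {x} {y} c eq c≥0 =
    subst₂ _≤_ (+-identityʳ x) (cancel x y) (+-monoʳ-≤ x (subst (0ℚ ≤_) (sym eq) c≥0))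
    where
    cancel : ∀ x y → x + (y - x) ≡ y
    cancel = solve-∀ ring

  sq≥0 : ∀ x → 0ℚ ≤ x * x
  sq≥0 x with ≤-total 0ℚ x
  ... | inj₁ 0≤x = 0≤x ⊛ 0≤x
  ... | inj₂ x≤0 = subst (0ℚ ≤_) (negsq x) (q ⊛ q)
    where
    q : 0ℚ ≤ - x
    q = neg-antimono-≤ x≤0
    negsq : ∀ x → (- x) * (- x) ≡ x * x
    negsq = solve-∀ ring

  *-mono-≥0 : ∀ {x y z} → 0ℚ ≤ z → x ≤ y → z * x ≤ z * y
  *-mono-≥0 {z = z} p = *-monoˡ-≤-nonNeg z {{nonNegative p}}

  *-cancel-≥1 : ∀ {x y} m → ⟦ suc m ⟧ * x ≤ ⟦ suc m ⟧ * y → x ≤ y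
  *-cancel-≥1 m = *-cancelˡ-≤-pos ⟦ suc m ⟧ {{normalize-pos (suc m) 1}}

  -- Total, so that block lengths can be inverted without carrying a proof that they are positive;
  -- the value at 0 is a default.
  inv : ℕ → ℚ
  inv zero    = 0ℚ
  inv (suc m) = + 1 / suc m

  inv-* : ∀ m → inv (suc m) * ⟦ suc m ⟧ ≡ 1ℚ
  inv-* m = toℚᵘ-injective (begin
    toℚᵘ (inv (suc m) * ⟦ suc m ⟧)                    ≈⟨ toℚᵘ-homo-* (inv (suc m)) ⟦ suc m ⟧ ⟩
    toℚᵘ (inv (suc m)) ℚᵘ.* toℚᵘ ⟦ suc m ⟧            ≈⟨ ℚᵘₚ.*-cong (toℚᵘ-fromℚᵘ (ℚᵘ.mkℚᵘ (+ 1) m)) (toℚᵘ-⟦⟧ (suc m)) ⟩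
    ℚᵘ.mkℚᵘ (+ 1) m ℚᵘ.* ℚᵘ.mkℚᵘ (+ suc m) 0         
        ≈⟨ ℚᵘ.*≡* (cong +_ (cong suc (trans (ℕₚ.*-identityʳ _)
        (trans (ℕₚ.+-identityʳ m) (sym (trans (ℕₚ.+-identityʳ _) (ℕₚ.*-identityʳ m))))))) ⟩
    ℚᵘ.1ℚᵘ                                            ∎)
    where open ℚᵘₚ.≃-Reasoning

  inv≥0 : ∀ m → 0ℚ ≤ inv m
  inv≥0 zero    = ≤-refl
  inv≥0 (suc m) = nonNegative⁻¹ (inv (suc m)) {{normalize-nonNeg 1 (suc m)}}

  -- The constants of the analysis.  They are kept behind variables because Agda
  -- would evaluate terms with large numerals.
  Scale : ℚ → ℚ → Set
  Scale C γ = ⟦ 49152 ⟧ ≤ C × ⟦ 4194304 ⟧ ≤ γ × γ ≡ (⟦ 8 ⟧ + ⟦ 64 ⟧ * C) * (⟦ 8 ⟧ + ⟦ 64 ⟧ * C) + (⟦ 8 ⟧ + ⟦ 64 ⟧ * C) + ⟦ 8 ⟧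

-- Moments of the distance to the nearest arrival on one side

module NearestArrival where

  open import Data.Rational.Base
  open import Data.Rational.Properties
  open RationalLemmas

  Σ< : ℕ → (ℕ → ℚ) → ℚ
  Σ< zero    f = 0ℚ
  Σ< (suc n) f = Σ< n f + f n

  Σ<-cong : ∀ n {f g : ℕ → ℚ} → (∀ i → i ℕ.< n → f i ≡ g i) → Σ< n f ≡ Σ< n g
  Σ<-cong zero    h = refl
  Σ<-cong (suc n) h = cong₂ _+_ (Σ<-cong n λ i i<n → h i (ℕₚ.m<n⇒m<1+n i<n)) (h n ℕₚ.≤-refl)

  Σ<-mono : ∀ n {f g : ℕ → ℚ} → (∀ i → i ℕ.< n → f i ≤ g i) → Σ< n f ≤ Σ< n g
  Σ<-mono zero    h = ≤-refl
  Σ<-mono (suc n) h = +-mono-≤ (Σ<-mono n λ i i<n → h i (ℕₚ.m<n⇒m<1+n i<n)) (h n ℕₚ.≤-refl)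

  Σ<≥0 : ∀ n {f : ℕ → ℚ} → (∀ i → i ℕ.< n → 0ℚ ≤ f i) → 0ℚ ≤ Σ< n f
  Σ<≥0 zero    h = ≤-refl
  Σ<≥0 (suc n) h = Σ<≥0 n (λ i i<n → h i (ℕₚ.m<n⇒m<1+n i<n)) ⊕ h n ℕₚ.≤-refl

  Σ<-+ : ∀ n (f g : ℕ → ℚ) → Σ< n (λ i → f i + g i) ≡ Σ< n f + Σ< n g
  Σ<-+ zero    f g = refl
  Σ<-+ (suc n) f g = trans (cong (_+ (f n + g n)) (Σ<-+ n f g)) (swap (Σ< n f) (Σ< n g) (f n) (g n))
    where
    swap : ∀ a b c d → (a + b) + (c + d) ≡ (a + c) + (b + d)
    swap = solve-∀ ring

  Σ<-* : ∀ n x (f : ℕ → ℚ) → Σ< n (λ i → x * f i) ≡ x * Σ< n f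
  Σ<-* zero    x f = sym (*-zeroʳ x)
  Σ<-* (suc n) x f = trans (cong (_+ x * f n) (Σ<-* n x f)) (sym (*-distribˡ-+ x (Σ< n f) (f n)))

  Σ<-split : ∀ m n (f : ℕ → ℚ) → Σ< (n ℕ.+ m) f ≡ Σ< m f + Σ< n (λ i → f (i ℕ.+ m))
  Σ<-split m zero    f = sym (+-identityʳ (Σ< m f))
  Σ<-split m (suc n) f = trans (cong (_+ f (n ℕ.+ m)) (Σ<-split m n f)) (+-assoc (Σ< m f) _ _)

  Σ<-const : ∀ n x → Σ< n (λ _ → x) ≡ ⟦ n ⟧ * x
  Σ<-const zero    x = sym (*-zeroˡ x)
  Σ<-const (suc n) x = trans (cong (_+ x) (Σ<-const n x)) (trans (step ⟦ n ⟧ x) (cong (_* x) (sym (⟦⟧-suc n))))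
    where
    step : ∀ a x → a * x + x ≡ (1ℚ + a) * x
    step = solve-∀ ring

  Σ<-front : ∀ n (f : ℕ → ℚ) → Σ< (suc n) f ≡ f 0 + Σ< n (λ i → f (suc i))
  Σ<-front zero    f = +-comm 0ℚ (f 0)
  Σ<-front (suc n) f = trans (cong (_+ f (suc n)) (Σ<-front n f)) (+-assoc (f 0) _ _)

  -- miss s τ j is the probability that s arrivals, the first of which falls
  -- into one of τ equally likely gaps, all avoid j given gaps.
  miss : ℕ → ℕ → ℕ → ℚ
  miss zero    τ j = 1ℚ
  miss (suc s) τ j = (⟦ τ ⟧ - ⟦ j ⟧) * (inv τ * miss s (suc τ) j)

  miss≥0 : ∀ s τ j → j ℕ.≤ τ → 0ℚ ≤ miss s τ j
  miss≥0 zero    τ j j≤τ = ⟦⟧≥0 1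
  miss≥0 (suc s) τ j j≤τ = diff≥0 (⟦⟧-mono j≤τ) ⊛ (inv≥0 τ ⊛ miss≥0 s (suc τ) j (ℕₚ.m≤n⇒m≤1+n j≤τ))

  -- The expectation of (e − d′)² + d′, where d′ is the distance from a fixed
  -- element to the nearest one of a window on one side of it, when the
  -- distance is d and s arrivals are still to come.
  gapCost : ℕ → ℕ → ℚ → ℕ → ℚ
  gapCost s τ e d = e * e + Σ< d (λ j → ⟦ 2 ⟧ * (1ℚ + ⟦ j ⟧ - e) * miss s τ j)

  -- With no arrivals left every `miss` is 1 and the sum telescopes. The summand d turns the
  -- increments 2 d + 1 - 2 e of (e - d)² into 2 (1 + d - e), the weights for which `Σ-rising₂` has
  -- a closed form.
  gapCost-end : ∀ τ e d → gapCost 0 τ e d ≡ (e - ⟦ d ⟧) * (e - ⟦ d ⟧) + ⟦ d ⟧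
  gapCost-end τ e zero    = base e
    where
    base : ∀ e → e * e + 0ℚ ≡ (e - 0ℚ) * (e - 0ℚ) + 0ℚ
    base = solve-∀ ring
  gapCost-end τ e (suc d) = begin
    e * e + (S + c)                                                              ≡⟨ +-assoc (e * e) S c ⟨
    e * e + S + c                                                                ≡⟨ cong (_+ c) (gapCost-end τ e d) ⟩
    (e - ⟦ d ⟧) * (e - ⟦ d ⟧) + ⟦ d ⟧ + c                                        ≡⟨ step e ⟦ d ⟧ ⟩
    (e - (1ℚ + ⟦ d ⟧)) * (e - (1ℚ + ⟦ d ⟧)) + (1ℚ + ⟦ d ⟧)                       
        ≡⟨ cong (λ x → (e - x) * (e - x) + x) (⟦⟧-suc d) ⟨
    (e - ⟦ suc d ⟧) * (e - ⟦ suc d ⟧) + ⟦ suc d ⟧                                ∎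
    where
    open ≡-Reasoning
    S = Σ< d (λ j → ⟦ 2 ⟧ * (1ℚ + ⟦ j ⟧ - e) * 1ℚ)
    c = ⟦ 2 ⟧ * (1ℚ + ⟦ d ⟧ - e) * 1ℚ
    step : ∀ e d → (e - d) * (e - d) + d + ⟦ 2 ⟧ * (1ℚ + d - e) * 1ℚ
                 ≡ (e - (1ℚ + d)) * (e - (1ℚ + d)) + (1ℚ + d)
    step = solve-∀ ring

  -- An arrival in one of the d gaps of the interval leaves a uniform distance.
  gapCost-step : ∀ s t e d →
    (⟦ suc t ⟧ - ⟦ d ⟧) * gapCost s (suc (suc t)) e d + Σ< d (λ i → gapCost s (suc (suc t)) e (suc i))
    ≡ ⟦ suc t ⟧ * gapCost (suc s) (suc t) e d
  gapCost-step s t e zero    = base ⟦ suc t ⟧ (e * e)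
    where
    base : ∀ x y → (x - 0ℚ) * (y + 0ℚ) + 0ℚ ≡ x * (y + 0ℚ)
    base = solve-∀ ring
  gapCost-step s t e (suc d) = begin
    (τ - ⟦ suc d ⟧) * (e * e + (S + w * p)) + (R + (e * e + (S + w * p)))
      ≡⟨ cong (λ x → (τ - x) * (e * e + (S + w * p)) + (R + (e * e + (S + w * p)))) (⟦⟧-suc d) ⟩
    (τ - (1ℚ + ⟦ d ⟧)) * (e * e + (S + w * p)) + (R + (e * e + (S + w * p)))
      ≡⟨ regroup τ ⟦ d ⟧ (e * e) S (w * p) R ⟩
    (τ - ⟦ d ⟧) * (e * e + S) + R + (τ - ⟦ d ⟧) * (w * p)
      ≡⟨ cong (_+ (τ - ⟦ d ⟧) * (w * p)) (gapCost-step s t e d) ⟩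
    τ * (e * e + S′) + (τ - ⟦ d ⟧) * (w * p)
      ≡⟨ cong (τ * (e * e + S′) +_) (trans (cong (_* ((τ - ⟦ d ⟧) * (w * p))) (inv-* t)) (*-identityˡ _)) ⟨
    τ * (e * e + S′) + (inv (suc t) * τ) * ((τ - ⟦ d ⟧) * (w * p))
      ≡⟨ collect τ ⟦ d ⟧ (e * e) S′ w p (inv (suc t)) ⟩
    τ * (e * e + (S′ + w * ((τ - ⟦ d ⟧) * (inv (suc t) * p))))
      ∎
    where
    open ≡-Reasoning
    τ = ⟦ suc t ⟧
    p = miss s (suc (suc t)) d
    w = ⟦ 2 ⟧ * (1ℚ + ⟦ d ⟧ - e)
    S = Σ< d (λ j → ⟦ 2 ⟧ * (1ℚ + ⟦ j ⟧ - e) * miss s (suc (suc t)) j)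
    S′ = Σ< d (λ j → ⟦ 2 ⟧ * (1ℚ + ⟦ j ⟧ - e) * miss (suc s) (suc t) j)
    R = Σ< d (λ i → gapCost s (suc (suc t)) e (suc i))
    regroup : ∀ τ d e² S x R → (τ - (1ℚ + d)) * (e² + (S + x)) + (R + (e² + (S + x)))
                             ≡ (τ - d) * (e² + S) + R + (τ - d) * x
    regroup = solve-∀ ring
    collect : ∀ τ d e² S′ w p ι → τ * (e² + S′) + (ι * τ) * ((τ - d) * (w * p))
                                ≡ τ * (e² + (S′ + w * ((τ - d) * (ι * p))))
    collect = solve-∀ ring

  -- The summands of `gapCost` have both signs; nonnegativity is visible only at the end of the
  -- window and is carried back through the averages of `gapCost-step`.
  gapCost≥0 : ∀ s t e d → d ℕ.≤ suc t → 0ℚ ≤ gapCost s (suc t) e d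
  gapCost≥0 zero    t e d d≤ = subst (0ℚ ≤_) (sym (gapCost-end (suc t) e d)) (sq≥0 (e - ⟦ d ⟧) ⊕ ⟦⟧≥0 d)
  gapCost≥0 (suc s) t e d d≤ = *-cancel-≥1 t (subst₂ _≤_ (sym (*-zeroʳ ⟦ suc t ⟧)) (gapCost-step s t e d)
    ((diff≥0 (⟦⟧-mono d≤) ⊛ gapCost≥0 s (suc t) e d (ℕₚ.m≤n⇒m≤1+n d≤))
     ⊕ Σ<≥0 d λ i i<d → gapCost≥0 s (suc t) e (suc i) (ℕₚ.m≤n⇒m≤1+n (ℕₚ.≤-trans i<d d≤))))

  -- The rising factorial x (x + 1) ⋯ (x + s - 1). Each arrival adds a gap, so the numerator and the
  -- denominator of `miss` are both products of this kind.
  rising : ℕ → ℚ → ℚ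
  rising zero    x = 1ℚ
  rising (suc s) x = x * rising s (1ℚ + x)

  rising≥1 : ∀ s m → 1ℚ ≤ rising s ⟦ suc m ⟧
  rising≥1 zero    m = ≤-refl
  rising≥1 (suc s) m = ≤-trans (rising≥1 s (suc m)) (subst (λ y → rising s y ≤ ⟦ suc m ⟧ * rising s (1ℚ + ⟦ suc m ⟧))
      (sym (⟦⟧-suc (suc m)))
    (by-cert (⟦ m ⟧ * rising s (1ℚ + ⟦ suc m ⟧))
       (trans (cong (λ x → x * R - R) (⟦⟧-suc m)) (eq ⟦ m ⟧ R))
       (⟦⟧≥0 m ⊛ ≤-trans (⟦⟧≥0 1) (subst (λ y → 1ℚ ≤ rising s y) (⟦⟧-suc (suc m)) (rising≥1 s (suc m))))))
    where
    R = rising s (1ℚ + ⟦ suc m ⟧)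
    eq : ∀ m r → (1ℚ + m) * r - r ≡ m * r
    eq = solve-∀ ring

  rising-last : ∀ s x → rising (suc s) x ≡ rising s x * (x + ⟦ s ⟧)
  rising-last zero    x = base x
    where
    base : ∀ x → x * 1ℚ ≡ 1ℚ * (x + 0ℚ)
    base = solve-∀ ring
  rising-last (suc s) x = trans (cong (x *_) (rising-last s (1ℚ + x)))
    (trans (assoc x (rising s (1ℚ + x)) ⟦ s ⟧) (cong (λ y → x * rising s (1ℚ + x) * (x + y)) (sym (⟦⟧-suc s))))
    where
    assoc : ∀ x r s → x * (r * ((1ℚ + x) + s)) ≡ x * r * (x + (1ℚ + s))
    assoc = solve-∀ ring

  miss-rising : ∀ s t j → rising s ⟦ suc t ⟧ * miss s (suc t) j ≡ rising s (⟦ suc t ⟧ - ⟦ j ⟧)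
  miss-rising zero    t j = refl
  miss-rising (suc s) t j = begin
    τ * R * ((τ - ⟦ j ⟧) * (inv (suc t) * p))     ≡⟨ shuffle τ ⟦ j ⟧ R (inv (suc t)) p ⟩
    inv (suc t) * τ * ((τ - ⟦ j ⟧) * (R * p))     ≡⟨ cong (_* ((τ - ⟦ j ⟧) * (R * p))) (inv-* t) ⟩
    1ℚ * ((τ - ⟦ j ⟧) * (R * p))                  ≡⟨ *-identityˡ _ ⟩
    (τ - ⟦ j ⟧) * (R * p)                         ≡⟨ cong (λ x → (τ - ⟦ j ⟧) * (rising s x * p)) (sym (⟦⟧-suc (suc t))) ⟩
    (τ - ⟦ j ⟧) * (rising s ⟦ suc (suc t) ⟧ * p)  ≡⟨ cong ((τ - ⟦ j ⟧) *_) (miss-rising s (suc t) j) ⟩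
    (τ - ⟦ j ⟧) * rising s (⟦ suc (suc t) ⟧ - ⟦ j ⟧)
      ≡⟨ cong (λ x → (τ - ⟦ j ⟧) * rising s x) (trans (cong (_- ⟦ j ⟧) (⟦⟧-suc (suc t))) (+-assoc 1ℚ τ (- ⟦ j ⟧))) ⟩
    (τ - ⟦ j ⟧) * rising s (1ℚ + (τ - ⟦ j ⟧))     ∎
    where
    open ≡-Reasoning
    τ = ⟦ suc t ⟧
    R = rising s (1ℚ + τ)
    p = miss s (suc (suc t)) j
    shuffle : ∀ τ j R ι p → τ * R * ((τ - j) * (ι * p)) ≡ ι * τ * ((τ - j) * (R * p))
    shuffle = solve-∀ ring

  -- The hockey-stick identity: splitting off j = 0 leaves the same sum for the smaller t.
  Σ-rising : ∀ s t → ⟦ suc s ⟧ * Σ< t (λ j → rising s (⟦ t ⟧ - ⟦ j ⟧)) ≡ rising (suc s) ⟦ t ⟧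
  Σ-rising s zero    = trans (*-zeroʳ ⟦ suc s ⟧) (sym (*-zeroˡ (rising s (1ℚ + 0ℚ))))
  Σ-rising s (suc t) = begin
    ⟦ suc s ⟧ * Σ< (suc t) (λ j → rising s (⟦ suc t ⟧ - ⟦ j ⟧))
      ≡⟨ cong (⟦ suc s ⟧ *_) (Σ<-front t _) ⟩
    ⟦ suc s ⟧ * (rising s (⟦ suc t ⟧ - 0ℚ) + Σ< t (λ j → rising s (⟦ suc t ⟧ - ⟦ suc j ⟧)))
      ≡⟨ cong₂ (λ x y → ⟦ suc s ⟧ * (rising s x + y)) (trans (+-identityʳ ⟦ suc t ⟧) (⟦⟧-suc t))
           (Σ<-cong t λ j _ → cong (rising s) (trans (cong₂ _-_ (⟦⟧-suc t) (⟦⟧-suc j)) (cancel ⟦ t ⟧ ⟦ j ⟧))) ⟩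
    ⟦ suc s ⟧ * (rising s (1ℚ + ⟦ t ⟧) + S)
      ≡⟨ *-distribˡ-+ ⟦ suc s ⟧ _ _ ⟩
    ⟦ suc s ⟧ * rising s (1ℚ + ⟦ t ⟧) + ⟦ suc s ⟧ * S
      ≡⟨ cong₂ (λ x y → x * rising s (1ℚ + ⟦ t ⟧) + y) (⟦⟧-suc s) (Σ-rising s t) ⟩
    (1ℚ + ⟦ s ⟧) * rising s (1ℚ + ⟦ t ⟧) + ⟦ t ⟧ * rising s (1ℚ + ⟦ t ⟧)
      ≡⟨ collect ⟦ s ⟧ ⟦ t ⟧ (rising s (1ℚ + ⟦ t ⟧)) ⟩
    rising s (1ℚ + ⟦ t ⟧) * (1ℚ + ⟦ t ⟧ + ⟦ s ⟧)
      ≡⟨ rising-last s (1ℚ + ⟦ t ⟧) ⟨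
    rising (suc s) (1ℚ + ⟦ t ⟧)
      ≡⟨ cong (rising (suc s)) (⟦⟧-suc t) ⟨
    rising (suc s) ⟦ suc t ⟧
      ∎
    where
    open ≡-Reasoning
    S = Σ< t (λ j → rising s (⟦ t ⟧ - ⟦ j ⟧))
    cancel : ∀ t j → (1ℚ + t) - (1ℚ + j) ≡ t - j
    cancel = solve-∀ ring
    collect : ∀ s t r → (1ℚ + s) * r + t * r ≡ r * (1ℚ + t + s)
    collect = solve-∀ ring

  -- The hockey stick applied twice: lowering every weight 1 + j by one splits off the unweighted
  -- sum and leaves the weighted sum for the smaller t.
  Σ-rising₂ : ∀ s t → ⟦ suc s ⟧ * (⟦ suc (suc s) ⟧ * Σ< t (λ j → (1ℚ + ⟦ j ⟧) * rising s (⟦ t ⟧ - ⟦ j ⟧))) ≡ rising (suc (suc s))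
      ⟦ t ⟧
  Σ-rising₂ s zero    = trans (cong (⟦ suc s ⟧ *_) (*-zeroʳ ⟦ suc (suc s) ⟧))
      (trans (*-zeroʳ ⟦ suc s ⟧) (sym (*-zeroˡ (rising (suc s) (1ℚ + 0ℚ)))))
  Σ-rising₂ s (suc t) = begin
    a * (b * Σ< (suc t) (λ j → (1ℚ + ⟦ j ⟧) * rising s (⟦ suc t ⟧ - ⟦ j ⟧)))
      ≡⟨ cong (λ x → a * (b * x)) (trans (Σ<-front t _) (cong ((1ℚ + 0ℚ) * rising s (⟦ suc t ⟧ - 0ℚ) +_)
           (trans (Σ<-cong t λ j _ → trans (cong₂ (λ x y → (1ℚ + x) * rising s y) (⟦⟧-suc j) (shift t j))
               (dist ⟦ j ⟧ (rising s (⟦ t ⟧ - ⟦ j ⟧))))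
                  (Σ<-+ t _ _)))) ⟩
    a * (b * ((1ℚ + 0ℚ) * rising s (⟦ suc t ⟧ - 0ℚ) + (S₁ + S₂)))
      ≡⟨ regroup a b (rising s (⟦ suc t ⟧ - 0ℚ)) S₁ S₂ ⟩
    b * (a * (rising s (⟦ suc t ⟧ - 0ℚ) + S₁)) + a * (b * S₂)
      ≡⟨ cong (λ x → b * (a * x) + a * (b * S₂))
           (trans (cong (rising s (⟦ suc t ⟧ - 0ℚ) +_) (Σ<-cong t λ j _ → cong (rising s) (sym (shift t j))))
               (sym (Σ<-front t _))) ⟩
    b * (a * Σ< (suc t) (λ j → rising s (⟦ suc t ⟧ - ⟦ j ⟧))) + a * (b * S₂)
      ≡⟨ cong₂ (λ x y → b * x + y) (Σ-rising s (suc t)) (Σ-rising₂ s t) ⟩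
    b * rising (suc s) ⟦ suc t ⟧ + ⟦ t ⟧ * rising (suc s) (1ℚ + ⟦ t ⟧)
      ≡⟨ cong₂ (λ x y → x * rising (suc s) ⟦ suc t ⟧ + ⟦ t ⟧ * rising (suc s) y) (⟦⟧-suc (suc s)) (sym (⟦⟧-suc t)) ⟩
    (1ℚ + ⟦ suc s ⟧) * rising (suc s) ⟦ suc t ⟧ + ⟦ t ⟧ * rising (suc s) ⟦ suc t ⟧
      ≡⟨ collect ⟦ suc s ⟧ ⟦ t ⟧ (rising (suc s) ⟦ suc t ⟧) ⟩
    rising (suc s) ⟦ suc t ⟧ * (1ℚ + ⟦ t ⟧ + ⟦ suc s ⟧)
      ≡⟨ cong (λ x → rising (suc s) ⟦ suc t ⟧ * (x + ⟦ suc s ⟧)) (sym (⟦⟧-suc t)) ⟩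
    rising (suc s) ⟦ suc t ⟧ * (⟦ suc t ⟧ + ⟦ suc s ⟧)
      ≡⟨ rising-last (suc s) ⟦ suc t ⟧ ⟨
    rising (suc (suc s)) ⟦ suc t ⟧
      ∎
    where
    open ≡-Reasoning
    a = ⟦ suc s ⟧
    b = ⟦ suc (suc s) ⟧
    S₁ = Σ< t (λ j → rising s (⟦ t ⟧ - ⟦ j ⟧))
    S₂ = Σ< t (λ j → (1ℚ + ⟦ j ⟧) * rising s (⟦ t ⟧ - ⟦ j ⟧))
    cancel : ∀ t j → (1ℚ + t) - (1ℚ + j) ≡ t - j
    cancel = solve-∀ ring
    shift : ∀ t j → ⟦ suc t ⟧ - ⟦ suc j ⟧ ≡ ⟦ t ⟧ - ⟦ j ⟧
    shift t j = trans (cong₂ _-_ (⟦⟧-suc t) (⟦⟧-suc j)) (cancel ⟦ t ⟧ ⟦ j ⟧)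
    dist : ∀ j r → (1ℚ + (1ℚ + j)) * r ≡ r + (1ℚ + j) * r
    dist = solve-∀ ring
    regroup : ∀ a b r x y → a * (b * ((1ℚ + 0ℚ) * r + (x + y))) ≡ b * (a * (r + x)) + a * (b * y)
    regroup = solve-∀ ring
    collect : ∀ s t r → (1ℚ + s) * r + t * r ≡ r * (1ℚ + t + s)
    collect = solve-∀ ring

  private
    rising-nonZero : ∀ s m {x y} → rising s ⟦ suc m ⟧ * x ≡ rising s ⟦ suc m ⟧ * y → x ≡ y
    rising-nonZero s m {x} {y} eq = ≤-antisym (half x y (≤-reflexive eq)) (half y x (≤-reflexive (sym eq)))
      where
      R>0 : Positive (rising s ⟦ suc m ⟧)
      R>0 = positive (<-≤-trans (positive⁻¹ 1ℚ) (rising≥1 s m))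
      half : ∀ x y → rising s ⟦ suc m ⟧ * x ≤ rising s ⟦ suc m ⟧ * y → x ≤ y
      half x y = *-cancelˡ-≤-pos (rising s ⟦ suc m ⟧) {{R>0}}

  -- As `miss s τ j` is the probability of a distance greater than j, this tail sum is the mean
  -- distance when all gaps lie on one side.
  Σ-miss : ∀ s t → ⟦ suc s ⟧ * Σ< (suc t) (miss s (suc t)) ≡ ⟦ suc t ⟧ + ⟦ s ⟧
  Σ-miss s t = rising-nonZero s t (begin
    R * (⟦ suc s ⟧ * Σ< (suc t) (miss s (suc t)))                    ≡⟨ swap R ⟦ suc s ⟧ _ ⟩
    ⟦ suc s ⟧ * (R * Σ< (suc t) (miss s (suc t)))                    ≡⟨ cong (⟦ suc s ⟧ *_) (Σ<-* (suc t) R _) ⟨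
    ⟦ suc s ⟧ * Σ< (suc t) (λ j → R * miss s (suc t) j)             
        ≡⟨ cong (⟦ suc s ⟧ *_) (Σ<-cong (suc t) λ j _ → miss-rising s t j) ⟩
    ⟦ suc s ⟧ * Σ< (suc t) (λ j → rising s (⟦ suc t ⟧ - ⟦ j ⟧))      ≡⟨ Σ-rising s (suc t) ⟩
    rising (suc s) ⟦ suc t ⟧                                         ≡⟨ rising-last s ⟦ suc t ⟧ ⟩
    R * (⟦ suc t ⟧ + ⟦ s ⟧)                                          ∎)
    where
    open ≡-Reasoning
    R = rising s ⟦ suc t ⟧
    swap : ∀ a b c → a * (b * c) ≡ b * (a * c)
    swap = solve-∀ ring

  -- Since 1 + 2 + ⋯ + d′ = d′ (d′ + 1) / 2, the weighted tail sum is half the mean of d′ (d′ + 1).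
  Σ-miss₂ : ∀ s t → ⟦ suc s ⟧ * (⟦ suc (suc s) ⟧ * Σ< (suc t) (λ j → (1ℚ + ⟦ j ⟧) * miss s (suc t) j))
                  ≡ (⟦ suc t ⟧ + ⟦ s ⟧) * (⟦ suc t ⟧ + ⟦ suc s ⟧)
  Σ-miss₂ s t = rising-nonZero s t (begin
    R * (a * (b * Σ< (suc t) (λ j → (1ℚ + ⟦ j ⟧) * miss s (suc t) j)))   ≡⟨ swap R a b _ ⟩
    a * (b * (R * Σ< (suc t) (λ j → (1ℚ + ⟦ j ⟧) * miss s (suc t) j)))   ≡⟨ cong (λ x → a * (b * x)) (Σ<-* (suc t) R _) ⟨
    a * (b * Σ< (suc t) (λ j → R * ((1ℚ + ⟦ j ⟧) * miss s (suc t) j)))   ≡⟨ cong (λ x → a * (b * x)) (Σ<-cong (suc t) λ j _ →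
                                                                              trans (swap₂ R (1ℚ + ⟦ j ⟧) (miss s (suc t) j))
                                                                                  (cong ((1ℚ + ⟦ j ⟧) *_) (miss-rising s t j))) ⟩
    a * (b * Σ< (suc t) (λ j → (1ℚ + ⟦ j ⟧) * rising s (⟦ suc t ⟧ - ⟦ j ⟧))) ≡⟨ Σ-rising₂ s (suc t) ⟩
    rising (suc (suc s)) ⟦ suc t ⟧                                       ≡⟨ rising-last (suc s) ⟦ suc t ⟧ ⟩
    rising (suc s) ⟦ suc t ⟧ * (⟦ suc t ⟧ + b′)                          ≡⟨ cong (_* (⟦ suc t ⟧ + b′)) (rising-last s ⟦ suc t ⟧) ⟩
    R * (⟦ suc t ⟧ + ⟦ s ⟧) * (⟦ suc t ⟧ + b′)                           ≡⟨ *-assoc R _ _ ⟩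
    R * ((⟦ suc t ⟧ + ⟦ s ⟧) * (⟦ suc t ⟧ + b′))                         ∎)
    where
    open ≡-Reasoning
    R = rising s ⟦ suc t ⟧
    a = ⟦ suc s ⟧
    b = ⟦ suc (suc s) ⟧
    b′ = ⟦ suc s ⟧
    swap : ∀ r a b c → r * (a * (b * c)) ≡ a * (b * (r * c))
    swap = solve-∀ ring
    swap₂ : ∀ a b c → a * (b * c) ≡ b * (a * c)
    swap₂ = solve-∀ ring

  -- m = (τ + s) / (s + 1) is the mean distance to the nearest of s arrivals when
  -- all τ gaps lie on one side; truncating the distance at d ≥ e − 1 only helps.
  gapCost-bound : ∀ s t e d m → d ℕ.≤ suc t → e ≤ 1ℚ + ⟦ d ⟧ → ⟦ suc s ⟧ * m ≡ ⟦ suc t ⟧ + ⟦ s ⟧ →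
    gapCost s (suc t) e d ≤ e * e - ⟦ 2 ⟧ * e * m + ⟦ 2 ⟧ * (m * m)
  gapCost-bound s t e d m d≤ e≤ m-eq = begin
    e * e + Σ< d w                             ≤⟨ +-monoʳ-≤ (e * e) extend ⟩
    e * e + Σ< (suc t) w                       ≡⟨ cong (e * e +_) expand ⟩
    e * e + (⟦ 2 ⟧ * X + (- (⟦ 2 ⟧ * e)) * Y)  ≡⟨ cong (λ y → e * e + (⟦ 2 ⟧ * X + (- (⟦ 2 ⟧ * e)) * y)) Y≡m ⟩
    e * e + (⟦ 2 ⟧ * X + (- (⟦ 2 ⟧ * e)) * m)  ≤⟨ by-cert (⟦ 2 ⟧ * (m * m - X)) (final e m X) (⟦⟧≥0 2 ⊛ diff≥0 X≤m²) ⟩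
    e * e - ⟦ 2 ⟧ * e * m + ⟦ 2 ⟧ * (m * m)    ∎
    where
    open ≤-Reasoning
    p = miss s (suc t)
    w = λ j → ⟦ 2 ⟧ * (1ℚ + ⟦ j ⟧ - e) * p j
    X = Σ< (suc t) (λ j → (1ℚ + ⟦ j ⟧) * p j)
    Y = Σ< (suc t) p
    extend : Σ< d w ≤ Σ< (suc t) w
    extend = subst (λ n → Σ< d w ≤ Σ< n w) (ℕₚ.m∸n+n≡m d≤) (subst (Σ< d w ≤_) (sym (Σ<-split d (suc t ℕ.∸ d) w))
      (subst (_≤ Σ< d w + rest) (+-identityʳ (Σ< d w)) (+-monoʳ-≤ (Σ< d w) (Σ<≥0 (suc t ℕ.∸ d) λ i i< →
        ⟦⟧≥0 2 ⊛ diff≥0 (≤-trans e≤ (+-monoʳ-≤ 1ℚ (⟦⟧-mono (ℕₚ.m≤n+m d i))))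
        ⊛ miss≥0 s (suc t) (i ℕ.+ d) (subst (i ℕ.+ d ℕ.≤_) (ℕₚ.m∸n+n≡m d≤) (ℕₚ.+-monoˡ-≤ d (ℕₚ.<⇒≤ i<))))))) 
      where
      rest = Σ< (suc t ℕ.∸ d) (λ i → w (i ℕ.+ d))
    expand : Σ< (suc t) w ≡ ⟦ 2 ⟧ * X + (- (⟦ 2 ⟧ * e)) * Y
    expand = trans (Σ<-cong (suc t) λ j _ → dist ⟦ j ⟧ e (p j))
      (trans (Σ<-+ (suc t) _ _) (cong₂ _+_ (Σ<-* (suc t) ⟦ 2 ⟧ _) (Σ<-* (suc t) (- (⟦ 2 ⟧ * e)) p)))
      where
      dist : ∀ j e p → ⟦ 2 ⟧ * (1ℚ + j - e) * p ≡ ⟦ 2 ⟧ * ((1ℚ + j) * p) + (- (⟦ 2 ⟧ * e)) * p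
      dist = solve-∀ ring
    Y≡m : Y ≡ m
    Y≡m = ≤-antisym (*-cancel-≥1 s (≤-reflexive eq)) (*-cancel-≥1 s (≤-reflexive (sym eq)))
      where
      eq : ⟦ suc s ⟧ * Y ≡ ⟦ suc s ⟧ * m
      eq = trans (Σ-miss s t) (sym m-eq)
    1≤m : 1ℚ ≤ m
    1≤m = *-cancel-≥1 s (subst₂ _≤_ (trans (sym (⟦⟧-suc s)) (sym (*-identityʳ ⟦ suc s ⟧))) (sym m-eq)
        (+-monoˡ-≤ ⟦ s ⟧ (⟦⟧-mono {1} {suc t} (ℕ.s≤s ℕ.z≤n))))
    -- Put a = s + 1 and y = τ + s, so that a m = y. Then a (a + 1) m² = (y + m) y, whereas a (a +
    -- 1) X = y (y + 1), and m ≥ 1 decides.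
    X≤m² : X ≤ m * m
    X≤m² = *-cancel-≥1 (suc s) (*-cancel-≥1 s (by-cert ((⟦ suc t ⟧ + ⟦ s ⟧) * (m - 1ℚ)) cert
      ((⟦⟧≥0 (suc t) ⊕ ⟦⟧≥0 s) ⊛ diff≥0 1≤m)))
      where
      a = ⟦ suc s ⟧
      τ = ⟦ suc t ⟧
      step₁ : ∀ a m x → a * ((1ℚ + a) * (m * m)) - x ≡ (a * m + m) * (a * m) - x
      step₁ = solve-∀ ring
      step₂ : ∀ y m → (y + m) * y - y * (y + 1ℚ) ≡ y * (m - 1ℚ)
      step₂ = solve-∀ ring
      cert : a * (⟦ suc (suc s) ⟧ * (m * m)) - a * (⟦ suc (suc s) ⟧ * X) ≡ (τ + ⟦ s ⟧) * (m - 1ℚ)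
      cert = trans (cong (λ x → a * (⟦ suc (suc s) ⟧ * (m * m)) - x)
          (trans (Σ-miss₂ s t) (cong ((τ + ⟦ s ⟧) *_)
          (trans (cong (τ +_) (trans (⟦⟧-suc s) (+-comm 1ℚ ⟦ s ⟧))) (sym (+-assoc τ ⟦ s ⟧ 1ℚ))))))
        (trans (cong (λ x → a * (x * (m * m)) - (τ + ⟦ s ⟧) * (τ + ⟦ s ⟧ + 1ℚ)) (⟦⟧-suc (suc s)))
        (trans (step₁ a m _) (trans (cong (λ x → (x + m) * x - (τ + ⟦ s ⟧) * (τ + ⟦ s ⟧ + 1ℚ)) m-eq) (step₂ (τ + ⟦ s ⟧) m))))
    final : ∀ e m x → (e * e - ⟦ 2 ⟧ * e * m + ⟦ 2 ⟧ * (m * m)) - (e * e + (⟦ 2 ⟧ * x + (- (⟦ 2 ⟧ * e)) * m)) ≡ ⟦ 2 ⟧ *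
        (m * m - x)
    final = solve-∀ ring

-- Polynomial identities behind the certificates

module Identities where

  open import Data.Rational.Base
  open import Data.Rational.Solver using (module +-*-Solver)
  open RationalLemmas
  open +-*-Solver using (solve; _:=_; _:+_; _:*_; _:-_; :-_; con)

  variance-slack : ∀ p τ r → p * τ * (1ℚ - p) + ⟦ 2 ⟧ * p * r ≡ r + p * τ - (r * ((1ℚ - p) * (1ℚ - p)) + (τ - r) * (p * p))
  variance-slack = solve-∀ ring

  weighted-square : ∀ t r a b x → r * ((x + a) * (x + a)) + (t - r) * ((x + b) * (x + b))
    ≡ t * (x * x) + ⟦ 2 ⟧ * x * (r * a + (t - r) * b) + (r * (a * a) + (t - r) * (b * b))
  weighted-square = solve 5 (λ t r a b x →
      r :* ((x :+ a) :* (x :+ a)) :+ (t :- r) :* ((x :+ b) :* (x :+ b))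
      := t :* (x :* x) :+ con ⟦ 2 ⟧ :* x :* (r :* a :+ (t :- r) :* b) :+ (r :* (a :* a) :+ (t :- r) :* (b :* b))) refl

  offset-mean : ∀ τ r p → r * (1ℚ - p) + (τ - r) * - p ≡ r - p * τ
  offset-mean = solve-∀ ring

  offset-spread : ∀ τ r p → r * ((1ℚ - p) * (1ℚ - p)) + (τ - r) * (- p * - p) ≡ r * ((1ℚ - p) * (1ℚ - p)) + (τ - r) * (p * p)
  offset-spread = solve-∀ ring

  plus-minus : ∀ τ₀ i → (τ₀ + i) - τ₀ ≡ i
  plus-minus = solve-∀ ring

  rate-shift : ∀ l τ₀ i → (l * τ₀ - ⟦ 64 ⟧) + l * i ≡ l * (τ₀ + i) - ⟦ 64 ⟧
  rate-shift = solve-∀ ring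

  noise-combine : ∀ C l t r W → (C - ⟦ 49152 ⟧) * r + ⟦ 3 ⟧ * ((⟦ 128 ⟧ - l * t) * (⟦ 128 ⟧ + l * t)) * r + l * l *
      (⟦ 3 ⟧ * r * (t * t) - W)
          ≡ C * r - l * l * W
  noise-combine = solve 5 (λ C l t r W →
      (C :- con ⟦ 49152 ⟧) :* r :+ con ⟦ 3 ⟧ :* ((con ⟦ 128 ⟧ :- l :* t) :* (con ⟦ 128 ⟧ :+ l :* t)) :* r :+ l :* l :*
          (con ⟦ 3 ⟧ :* r :* (t :* t) :- W)
            := C :* r :- l :* l :* W) refl

  noise-slack : ∀ t i r₀ c → ⟦ 2 ⟧ * (r₀ + c) * (t * t) + ⟦ 2 ⟧ * t * r₀ * c + (t - i) * (r₀ * r₀)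
        ≡ ⟦ 3 ⟧ * (r₀ + c) * (t * t) - ((r₀ + c) * ((t - r₀) * (t - r₀)) + ((t + i) - (r₀ + c)) * (r₀ * r₀))
  noise-slack = solve 4 (λ t i r₀ c →
      con ⟦ 2 ⟧ :* (r₀ :+ c) :* (t :* t) :+ con ⟦ 2 ⟧ :* t :* r₀ :* c :+ (t :- i) :* (r₀ :* r₀)
          := con ⟦ 3 ⟧ :* (r₀ :+ c) :* (t :* t) :- ((r₀ :+ c) :* ((t :- r₀) :* (t :- r₀)) :+ ((t :+ i) :- (r₀ :+ c)) :*
              (r₀ :* r₀))) refl

  count-tail : ∀ C x e →
    let k = ⟦ 8 ⟧ + ⟦ 64 ⟧ * C in
    ⟦ 4 ⟧ * (k * k) * (x - 1ℚ) + ⟦ 3 ⟧ * (k * k) + ⟦ 188 ⟧ * (e * e) + (k - ⟦ 2 ⟧ * e) * (k - ⟦ 2 ⟧ * e)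
    ≡ ⟦ 4 ⟧ * ((k * k + k + ⟦ 8 ⟧ - ⟦ 16 ⟧ - ⟦ 64 ⟧ * C) * x - k * e + ⟦ 48 ⟧ * (e * e))
  count-tail = solve 3 (λ C x e →
      let k = con ⟦ 8 ⟧ :+ con ⟦ 64 ⟧ :* C in
      con ⟦ 4 ⟧ :* (k :* k) :* (x :- con 1ℚ) :+ con ⟦ 3 ⟧ :* (k :* k) :+ con ⟦ 188 ⟧ :* (e :* e) :+ (k :- con ⟦ 2 ⟧ :* e) :*
          (k :- con ⟦ 2 ⟧ :* e)
      := con ⟦ 4 ⟧ :* ((k :* k :+ k :+ con ⟦ 8 ⟧ :- con ⟦ 16 ⟧ :- con ⟦ 64 ⟧ :* C) :* x :- k :* e :+ con ⟦ 48 ⟧ :* (e :* e))) refl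

  estimate-mean : ∀ ƛ τ₀ i r₀ c → (r₀ + c) * (ƛ * (τ₀ - r₀)) + ((τ₀ + i) - (r₀ + c)) * - (ƛ * r₀) ≡ ƛ * (c * τ₀ - i * r₀)
  estimate-mean = solve-∀ ring

  estimate-spread : ∀ ƛ τ r τ₀ r₀ → r * ((ƛ * (τ₀ - r₀)) * (ƛ * (τ₀ - r₀))) + (τ - r) * (- (ƛ * r₀) * - (ƛ * r₀))
         ≡ ƛ * ƛ * (r * ((τ₀ - r₀) * (τ₀ - r₀)) + (τ - r) * (r₀ * r₀))
  estimate-spread = solve-∀ ring

  offset-arrival : ∀ r b c p t i → r + (b + c) - p * (t + (1ℚ + i)) ≡ r + c - p * (t + i) + (b - p)
  offset-arrival = solve-∀ ring

  estimate-arrival : ∀ l b c t i r → l * ((b + c) * t - (1ℚ + i) * r) ≡ l * (c * t - i * r) + l * (b * t - r)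
  estimate-arrival = solve-∀ ring

  count-budget : ∀ a x i → a * (x - (1ℚ + i)) ≡ a * (x - i) - a
  count-budget = solve-∀ ring

  estimate-below : ∀ l t r → l * (0ℚ * t - r) ≡ - (l * r)
  estimate-below = solve-∀ ring

  count-collect : ∀ r t A B L x₁ x₀ y₁ y₀ → r * (A * x₁ + B * y₁ + L) + (t - r) * (A * x₀ + B * y₀ + L)
          ≡ A * (r * x₁ + (t - r) * x₀) + B * (r * y₁ + (t - r) * y₀) + t * L
  count-collect = solve 9 (λ r t A B L x₁ x₀ y₁ y₀ →
      r :* (A :* x₁ :+ B :* y₁ :+ L) :+ (t :- r) :* (A :* x₀ :+ B :* y₀ :+ L)
            := A :* (r :* x₁ :+ (t :- r) :* x₀) :+ B :* (r :* y₁ :+ (t :- r) :* y₀) :+ t :* L) refl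

  split-off : ∀ r x → r ≡ x + (r - x)
  split-off = solve-∀ ring

  count-drift : ∀ τ i ƛ e δ V W p γ C L →
    let u = (1ℚ + i) * ƛ
        r = p * τ + e in
    τ * ((⟦ 8 ⟧ - i * ƛ) * (e * e) + ⟦ 32 ⟧ * (⟦ 2 ⟧ - i * ƛ) * (δ * δ) + L)
    - ((⟦ 8 ⟧ - u) * (τ * (e * e) + ⟦ 2 ⟧ * e * e + V) + ⟦ 32 ⟧ * (⟦ 2 ⟧ - u) * (τ * (δ * δ) + ⟦ 2 ⟧ * δ * δ + W) + τ *
        (L - γ * p))
    ≡ (ƛ * τ - ⟦ 64 ⟧ + ⟦ 2 ⟧ * u) * (e * e) + ⟦ 32 ⟧ * (ƛ * τ - ⟦ 64 ⟧ + ⟦ 60 ⟧ + ⟦ 2 ⟧ * u) * (δ * δ)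
      + ⟦ 8 ⟧ * (r + p * τ - V) + u * V + ⟦ 32 ⟧ * (⟦ 2 ⟧ * (C * r - W) + u * W)
      + ((γ - ⟦ 16 ⟧ - ⟦ 64 ⟧ * C) * (p * τ) - (⟦ 8 ⟧ + ⟦ 64 ⟧ * C) * e + ⟦ 48 ⟧ * (e * e))
  count-drift = solve 11 (λ τ i ƛ e δ V W p γ C L →
      let u = (con 1ℚ :+ i) :* ƛ
          r = p :* τ :+ e in
      τ :* ((con ⟦ 8 ⟧ :- i :* ƛ) :* (e :* e) :+ con ⟦ 32 ⟧ :* (con ⟦ 2 ⟧ :- i :* ƛ) :* (δ :* δ) :+ L)
      :- ((con ⟦ 8 ⟧ :- u) :* (τ :* (e :* e) :+ con ⟦ 2 ⟧ :* e :* e :+ V) :+ con ⟦ 32 ⟧ :* (con ⟦ 2 ⟧ :- u) :*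
          (τ :* (δ :* δ) :+ con ⟦ 2 ⟧ :* δ :* δ :+ W) :+ τ :* (L :- γ :* p))
      := (ƛ :* τ :- con ⟦ 64 ⟧ :+ con ⟦ 2 ⟧ :* u) :* (e :* e) :+ con ⟦ 32 ⟧ :*
          (ƛ :* τ :- con ⟦ 64 ⟧ :+ con ⟦ 60 ⟧ :+ con ⟦ 2 ⟧ :* u) :* (δ :* δ)
        :+ con ⟦ 8 ⟧ :* (r :+ p :* τ :- V) :+ u :* V :+ con ⟦ 32 ⟧ :* (con ⟦ 2 ⟧ :* (C :* r :- W) :+ u :* W)
        :+ ((γ :- con ⟦ 16 ⟧ :- con ⟦ 64 ⟧ :* C) :* (p :* τ) :- (con ⟦ 8 ⟧ :+ con ⟦ 64 ⟧ :* C) :* e :+ con ⟦ 48 ⟧ :* (e :* e)))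
            refl

  offset-split : ∀ p r₁ c τ₁ i → r₁ + c - p * (τ₁ + i) ≡ (r₁ - p * τ₁) + (c - p * i)
  offset-split = solve-∀ ring

  scale-shift : ∀ γ → ⟦ 8 ⟧ * (γ - ⟦ 4194304 ⟧) + ⟦ 33553344 ⟧ ≡ ⟦ 8 ⟧ * γ - ⟦ 1088 ⟧
  scale-shift = solve-∀ ring

  window-tail : ∀ x d e γ → ⟦ 90 ⟧ * ((⟦ 2 ⟧ * d - 1ℚ) * (⟦ 2 ⟧ * d - 1ℚ)) + (⟦ 12 ⟧ * e - ⟦ 15 ⟧) * (⟦ 12 ⟧ * e - ⟦ 15 ⟧)
             + ⟦ 315 ⟧ * (x - 1ℚ) + (⟦ 8 ⟧ * γ - ⟦ 1088 ⟧) * x + ⟦ 53 ⟧ * x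
             ≡ ⟦ 4 ⟧ * (⟦ 90 ⟧ * (d * d) + ⟦ 36 ⟧ * (e * e) - ⟦ 90 ⟧ * (⟦ 2 ⟧ * x + e + d) + ⟦ 2 ⟧ * γ * x)
  window-tail = solve 4 (λ x d e γ →
      con ⟦ 90 ⟧ :* ((con ⟦ 2 ⟧ :* d :- con 1ℚ) :* (con ⟦ 2 ⟧ :* d :- con 1ℚ)) :+ (con ⟦ 12 ⟧ :* e :- con ⟦ 15 ⟧) :*
          (con ⟦ 12 ⟧ :* e :- con ⟦ 15 ⟧)
               :+ con ⟦ 315 ⟧ :* (x :- con 1ℚ) :+ (con ⟦ 8 ⟧ :* γ :- con ⟦ 1088 ⟧) :* x :+ con ⟦ 53 ⟧ :* x
               := con ⟦ 4 ⟧ :* (con ⟦ 90 ⟧ :* (d :* d) :+ con ⟦ 36 ⟧ :* (e :* e) :- con ⟦ 90 ⟧ :* (con ⟦ 2 ⟧ :* x :+ e :+ d) :+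
                   con ⟦ 2 ⟧ :* γ :* x)) refl

  window-budget : ∀ a N t i → a * (⟦ 2 ⟧ * (N - (t + (1ℚ + i)))) ≡ a * (⟦ 2 ⟧ * (N - (t + i))) - ⟦ 2 ⟧ * a
  window-budget = solve-∀ ring

  drift-above : ∀ c p i → (1ℚ + c) - p * (1ℚ + i) ≡ c - p * i + (1ℚ - p)
  drift-above = solve-∀ ring

  drift-below : ∀ c p i → c - p * (1ℚ + i) ≡ c - p * i + - p
  drift-below = solve-∀ ring

  window-collect : ∀ r t v E L x y →
    r * (⟦ 72 ⟧ * ((1ℚ + ⟦ 5 ⟧ * v) * x + ⟦ 3 ⟧ * v * E) + ½ * E + L) + (t - r) *
        (⟦ 72 ⟧ * ((1ℚ + ⟦ 5 ⟧ * v) * y + ⟦ 3 ⟧ * v * E) + ½ * E + L)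
    ≡ ⟦ 72 ⟧ * (1ℚ + ⟦ 5 ⟧ * v) * (r * x + (t - r) * y) + t * (⟦ 216 ⟧ * v * E + ½ * E + L)
  window-collect = solve 7 (λ r t v E L x y →
      r :* (con ⟦ 72 ⟧ :* ((con 1ℚ :+ con ⟦ 5 ⟧ :* v) :* x :+ con ⟦ 3 ⟧ :* v :* E) :+ con ½ :* E :+ L) :+ (t :- r) :*
          (con ⟦ 72 ⟧ :* ((con 1ℚ :+ con ⟦ 5 ⟧ :* v) :* y :+ con ⟦ 3 ⟧ :* v :* E) :+ con ½ :* E :+ L)
      := con ⟦ 72 ⟧ :* (con 1ℚ :+ con ⟦ 5 ⟧ :* v) :* (r :* x :+ (t :- r) :* y) :+ t :* (con ⟦ 216 ⟧ :* v :* E :+ con ½ :* E :+ L))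
          refl

  window-drift : ∀ τ κ v d e₁ V p γ L →
    let e = e₁ + d
        r = p * τ + e in
    τ * (⟦ 72 ⟧ * ((1ℚ + ⟦ 5 ⟧ * (κ + v)) * (d * d) + ⟦ 3 ⟧ * (κ + v) * (e₁ * e₁)) + ½ * (e₁ * e₁) + L)
    - (⟦ 72 ⟧ * (1ℚ + ⟦ 5 ⟧ * v) * (τ * (d * d) + ⟦ 2 ⟧ * d * e + V) + τ *
        (⟦ 216 ⟧ * v * (e₁ * e₁) + ½ * (e₁ * e₁) + (L - ⟦ 2 ⟧ * (γ * p))))
    ≡ ⟦ 72 ⟧ * (κ * τ - 1ℚ) * (⟦ 5 ⟧ * (d * d) + ⟦ 3 ⟧ * (e₁ * e₁))
      + ⟦ 18 ⟧ * (1ℚ - ⟦ 20 ⟧ * v) * (d * d + e * e + V)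
      + ⟦ 72 ⟧ * (1ℚ + ⟦ 5 ⟧ * v) * ((d - e) * (d - e))
      + ⟦ 90 ⟧ * ((d - e₁) * (d - e₁))
      + ⟦ 90 ⟧ * (r + p * τ - V)
      + (⟦ 90 ⟧ * (d * d) + ⟦ 36 ⟧ * (e₁ * e₁) - ⟦ 90 ⟧ * (⟦ 2 ⟧ * (p * τ) + e₁ + d) + ⟦ 2 ⟧ * γ * (p * τ))
  window-drift = solve 9 (λ τ κ v d e₁ V p γ L →
      let e = e₁ :+ d
          r = p :* τ :+ e in
      τ :* (con ⟦ 72 ⟧ :* ((con 1ℚ :+ con ⟦ 5 ⟧ :* (κ :+ v)) :* (d :* d) :+ con ⟦ 3 ⟧ :* (κ :+ v) :* (e₁ :* e₁)) :+ con ½ :*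
          (e₁ :* e₁) :+ L)
      :- (con ⟦ 72 ⟧ :* (con 1ℚ :+ con ⟦ 5 ⟧ :* v) :* (τ :* (d :* d) :+ con ⟦ 2 ⟧ :* d :* e :+ V) :+ τ :*
          (con ⟦ 216 ⟧ :* v :* (e₁ :* e₁) :+ con ½ :* (e₁ :* e₁) :+ (L :- con ⟦ 2 ⟧ :* (γ :* p))))
      := con ⟦ 72 ⟧ :* (κ :* τ :- con 1ℚ) :* (con ⟦ 5 ⟧ :* (d :* d) :+ con ⟦ 3 ⟧ :* (e₁ :* e₁))
        :+ con ⟦ 18 ⟧ :* (con 1ℚ :- con ⟦ 20 ⟧ :* v) :* (d :* d :+ e :* e :+ V)
        :+ con ⟦ 72 ⟧ :* (con 1ℚ :+ con ⟦ 5 ⟧ :* v) :* ((d :- e) :* (d :- e))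
        :+ con ⟦ 90 ⟧ :* ((d :- e₁) :* (d :- e₁))
        :+ con ⟦ 90 ⟧ :* (r :+ p :* τ :- V)
        :+ (con ⟦ 90 ⟧ :* (d :* d) :+ con ⟦ 36 ⟧ :* (e₁ :* e₁) :- con ⟦ 90 ⟧ :* (con ⟦ 2 ⟧ :* (p :* τ) :+ e₁ :+ d) :+ con ⟦ 2 ⟧ :*
            γ :* (p :* τ))) refl

  window-end-identity : ∀ e₁ d x f L →
    (⟦ 9 ⟧ * f + (⟦ 72 ⟧ * ((1ℚ + ⟦ 5 ⟧ * 0ℚ) * (d * d) + ⟦ 3 ⟧ * 0ℚ * (e₁ * e₁)) + ½ * (e₁ * e₁) + L))
    - (⟦ 8 ⟧ * ((x + d) * (x + d)) + L)
    ≡ ⟦ 9 ⟧ * (f - x * x) + (x - ⟦ 8 ⟧ * d) * (x - ⟦ 8 ⟧ * d) + ½ * (e₁ * e₁)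
  window-end-identity = solve 5 (λ e₁ d x f L →
      (con ⟦ 9 ⟧ :* f :+ (con ⟦ 72 ⟧ :* ((con 1ℚ :+ con ⟦ 5 ⟧ :* con 0ℚ) :* (d :* d) :+ con ⟦ 3 ⟧ :* con 0ℚ :* (e₁ :* e₁)) :+ con
          ½ :* (e₁ :* e₁) :+ L))
      :- (con ⟦ 8 ⟧ :* ((x :+ d) :* (x :+ d)) :+ L)
      := con ⟦ 9 ⟧ :* (f :- x :* x) :+ (x :- con ⟦ 8 ⟧ :* d) :* (x :- con ⟦ 8 ⟧ :* d) :+ con ½ :* (e₁ :* e₁)) refl

  window-final-identity : ∀ v e₁ d f L →
    ⟦ 4 ⟧ * (⟦ 9 ⟧ * f + (⟦ 72 ⟧ * ((1ℚ + ⟦ 5 ⟧ * v) * (d * d) + ⟦ 3 ⟧ * v * (e₁ * e₁)) + ½ * (e₁ * e₁) + L))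
    - (e₁ + d) * (e₁ + d)
    ≡ ⟦ 36 ⟧ * f + ⟦ 4 ⟧ * L + ⟦ 1440 ⟧ * v * (d * d) + ⟦ 864 ⟧ * v * (e₁ * e₁)
      + ⟦ 286 ⟧ * (d * d) + (e₁ - d) * (e₁ - d)
  window-final-identity = solve 5 (λ v e₁ d f L →
      con ⟦ 4 ⟧ :* (con ⟦ 9 ⟧ :* f :+ (con ⟦ 72 ⟧ :* ((con 1ℚ :+ con ⟦ 5 ⟧ :* v) :* (d :* d) :+ con ⟦ 3 ⟧ :* v :* (e₁ :* e₁)) :+
          con ½ :* (e₁ :* e₁) :+ L))
      :- (e₁ :+ d) :* (e₁ :+ d)
      := con ⟦ 36 ⟧ :* f :+ con ⟦ 4 ⟧ :* L :+ con ⟦ 1440 ⟧ :* v :* (d :* d) :+ con ⟦ 864 ⟧ :* v :* (e₁ :* e₁)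
        :+ con ⟦ 286 ⟧ :* (d :* d) :+ (e₁ :- d) :* (e₁ :- d)) refl

  count-final-identity : ∀ u e δ g N t i →
    ⟦ 4 ⟧ * ((⟦ 8 ⟧ - u) * (e * e) + ⟦ 32 ⟧ * (⟦ 2 ⟧ - u) * (δ * δ) + g * (⟦ 2 ⟧ * (N - t) - i)) - e * e
    ≡ (⟦ 27 ⟧ + ⟦ 4 ⟧ * (1ℚ - u)) * (e * e) + ⟦ 128 ⟧ * (1ℚ + (1ℚ - u)) * (δ * δ)
      + ⟦ 4 ⟧ * (g * (⟦ 2 ⟧ * (N - (t + i)) + i))
  count-final-identity = solve 7 (λ u e δ g N t i →
      con ⟦ 4 ⟧ :* ((con ⟦ 8 ⟧ :- u) :* (e :* e) :+ con ⟦ 32 ⟧ :* (con ⟦ 2 ⟧ :- u) :* (δ :* δ) :+ g :*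
          (con ⟦ 2 ⟧ :* (N :- t) :- i)) :- e :* e
      := (con ⟦ 27 ⟧ :+ con ⟦ 4 ⟧ :* (con 1ℚ :- u)) :* (e :* e) :+ con ⟦ 128 ⟧ :* (con 1ℚ :+ (con 1ℚ :- u)) :* (δ :* δ)
        :+ con ⟦ 4 ⟧ :* (g :* (con ⟦ 2 ⟧ :* (N :- (t :+ i)) :+ i))) refl

  count-start-identity : ∀ ƛ p N τ r γ →
    let e = r + 0ℚ - p * (τ + 0ℚ)
        δ = ƛ * (0ℚ * τ - 0ℚ * r) in
    (⟦ 8 ⟧ - 0ℚ * ƛ) * (e * e) + ⟦ 32 ⟧ * (⟦ 2 ⟧ - 0ℚ * ƛ) * (δ * δ) + γ * p * (⟦ 2 ⟧ * (N - τ) - 0ℚ)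
    ≡ ⟦ 8 ⟧ * ((r - p * τ) * (r - p * τ)) + γ * p * (⟦ 2 ⟧ * (N - τ))
  count-start-identity = solve 6 (λ ƛ p N τ r γ →
      let e = r :+ con 0ℚ :- p :* (τ :+ con 0ℚ)
          δ = ƛ :* (con 0ℚ :* τ :- con 0ℚ :* r) in
      (con ⟦ 8 ⟧ :- con 0ℚ :* ƛ) :* (e :* e) :+ con ⟦ 32 ⟧ :* (con ⟦ 2 ⟧ :- con 0ℚ :* ƛ) :* (δ :* δ) :+ γ :* p :*
          (con ⟦ 2 ⟧ :* (N :- τ) :- con 0ℚ)
      := con ⟦ 8 ⟧ :* ((r :- p :* τ) :* (r :- p :* τ)) :+ γ :* p :* (con ⟦ 2 ⟧ :* (N :- τ))) refl

  count-stay-identity : ∀ e δ p i N τ₀ γ →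
    (⟦ 8 ⟧ - 1ℚ) * (e * e) + ⟦ 32 ⟧ * (⟦ 2 ⟧ - 1ℚ) * (δ * δ) + γ * p * (⟦ 2 ⟧ * (N - τ₀) - i)
    - (⟦ 8 ⟧ * (e * e) + γ * p * (⟦ 2 ⟧ * (N - (τ₀ + i))))
    ≡ ⟦ 30 ⟧ * (δ * δ) + (e + ⟦ 2 ⟧ * δ) * (e + ⟦ 2 ⟧ * δ) + ⟦ 2 ⟧ * (⟦ 1048576 ⟧ - (e + δ) * (e + δ))
      + ½ * γ * (⟦ 2 ⟧ * (p * i) - 1ℚ) + ½ * (γ - ⟦ 4194304 ⟧)
  count-stay-identity = solve 7 (λ e δ p i N τ₀ γ →
      (con ⟦ 8 ⟧ :- con 1ℚ) :* (e :* e) :+ con ⟦ 32 ⟧ :* (con ⟦ 2 ⟧ :- con 1ℚ) :* (δ :* δ) :+ γ :* p :*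
          (con ⟦ 2 ⟧ :* (N :- τ₀) :- i)
      :- (con ⟦ 8 ⟧ :* (e :* e) :+ γ :* p :* (con ⟦ 2 ⟧ :* (N :- (τ₀ :+ i))))
      := con ⟦ 30 ⟧ :* (δ :* δ) :+ (e :+ con ⟦ 2 ⟧ :* δ) :* (e :+ con ⟦ 2 ⟧ :* δ) :+ con ⟦ 2 ⟧ :*
          (con ⟦ 1048576 ⟧ :- (e :+ δ) :* (e :+ δ))
        :+ con ½ :* γ :* (con ⟦ 2 ⟧ :* (p :* i) :- con 1ℚ) :+ con ½ :* (γ :- con ⟦ 4194304 ⟧)) refl

  half-aim-identity : ∀ e δ m →
    ⟦ 6 ⟧ * (e * e) + ⟦ 32 ⟧ * (δ * δ) + ⟦ 36 ⟧ - ⟦ 9 ⟧ * (e * e - ⟦ 2 ⟧ * e * m + ⟦ 2 ⟧ * (m * m))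
    ≡ ½ * ½ * (e * e) + ⟦ 18 ⟧ * (δ * δ) + (½ * e - ⟦ 2 ⟧ * δ) * (½ * e - ⟦ 2 ⟧ * δ)
      + ⟦ 9 ⟧ * ½ * ((e + δ - ⟦ 2 ⟧ * m + δ) * (e + δ - ⟦ 2 ⟧ * m + δ))
      + ⟦ 12 ⟧ * (e + δ + ⟦ 2 ⟧ - ⟦ 2 ⟧ * m) * (⟦ 3 ⟧ * m - (e + δ))
      + (⟦ 2 ⟧ * (e + δ) - ⟦ 6 ⟧ * m + ⟦ 6 ⟧) * (⟦ 2 ⟧ * (e + δ) - ⟦ 6 ⟧ * m + ⟦ 6 ⟧)
  half-aim-identity = solve 3 (λ e δ m →
      con ⟦ 6 ⟧ :* (e :* e) :+ con ⟦ 32 ⟧ :* (δ :* δ) :+ con ⟦ 36 ⟧ :- con ⟦ 9 ⟧ :*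
          (e :* e :- con ⟦ 2 ⟧ :* e :* m :+ con ⟦ 2 ⟧ :* (m :* m))
      := con ½ :* con ½ :* (e :* e) :+ con ⟦ 18 ⟧ :* (δ :* δ) :+ (con ½ :* e :- con ⟦ 2 ⟧ :* δ) :* (con ½ :* e :- con ⟦ 2 ⟧ :* δ)
        :+ con ⟦ 9 ⟧ :* con ½ :* ((e :+ δ :- con ⟦ 2 ⟧ :* m :+ δ) :* (e :+ δ :- con ⟦ 2 ⟧ :* m :+ δ))
        :+ con ⟦ 12 ⟧ :* (e :+ δ :+ con ⟦ 2 ⟧ :- con ⟦ 2 ⟧ :* m) :* (con ⟦ 3 ⟧ :* m :- (e :+ δ))
        :+ (con ⟦ 2 ⟧ :* (e :+ δ) :- con ⟦ 6 ⟧ :* m :+ con ⟦ 6 ⟧) :* (con ⟦ 2 ⟧ :* (e :+ δ) :- con ⟦ 6 ⟧ :* m :+ con ⟦ 6 ⟧)) refl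

  count-move-rest : ∀ γ p i N t → γ * p * (⟦ 2 ⟧ * (N - t) - i) ≡ γ * p * (⟦ 2 ⟧ * (N - (t + i + 0ℚ))) + γ * (p * i)
  count-move-rest = solve-∀ ring

  count-move-zero-drift : ∀ p → 0ℚ - p * 0ℚ ≡ 0ℚ
  count-move-zero-drift = solve-∀ ring

  count-move-identity : ∀ e δ x L γ f v →
    (⟦ 8 ⟧ - 1ℚ) * (e * e) + ⟦ 32 ⟧ * (⟦ 2 ⟧ - 1ℚ) * (δ * δ) + (L + γ * x)
    - (⟦ 9 ⟧ * f + (⟦ 72 ⟧ * ((1ℚ + ⟦ 5 ⟧ * v) * (0ℚ * 0ℚ) + ⟦ 3 ⟧ * v * (e * e)) + ½ * (e * e) + L))
    ≡ ½ * (1ℚ - ⟦ 432 ⟧ * v) * (e * e) + ½ * γ * (⟦ 2 ⟧ * x - 1ℚ) + (½ * (γ - ⟦ 4194304 ⟧) + ⟦ 2097116 ⟧)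
      + (⟦ 6 ⟧ * (e * e) + ⟦ 32 ⟧ * (δ * δ) + ⟦ 36 ⟧ - ⟦ 9 ⟧ * f)
  count-move-identity = solve 7 (λ e δ x L γ f v →
      (con ⟦ 8 ⟧ :- con 1ℚ) :* (e :* e) :+ con ⟦ 32 ⟧ :* (con ⟦ 2 ⟧ :- con 1ℚ) :* (δ :* δ) :+ (L :+ γ :* x)
      :- (con ⟦ 9 ⟧ :* f :+ (con ⟦ 72 ⟧ :* ((con 1ℚ :+ con ⟦ 5 ⟧ :* v) :* (con 0ℚ :* con 0ℚ) :+ con ⟦ 3 ⟧ :* v :* (e :* e)) :+ con
          ½ :* (e :* e) :+ L))
      := con ½ :* (con 1ℚ :- con ⟦ 432 ⟧ :* v) :* (e :* e) :+ con ½ :* γ :* (con ⟦ 2 ⟧ :* x :- con 1ℚ) :+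
          (con ½ :* (γ :- con ⟦ 4194304 ⟧) :+ con ⟦ 2097116 ⟧)
        :+ (con ⟦ 6 ⟧ :* (e :* e) :+ con ⟦ 32 ⟧ :* (δ :* δ) :+ con ⟦ 36 ⟧ :- con ⟦ 9 ⟧ :* f)) refl

  start-block-identity : ∀ p N τ γ →
    ⟦ 34848 ⟧ + γ * p * (⟦ 2 ⟧ * (N - τ)) - (⟦ 8 ⟧ * ((1ℚ - p * τ) * (1ℚ - p * τ)) + γ * p * (⟦ 2 ⟧ * (N - τ)))
    ≡ ⟦ 8 ⟧ * ((⟦ 65 ⟧ + p * τ) * (⟦ 67 ⟧ - p * τ))
  start-block-identity = solve-∀ ring

  budget-step-identity : ∀ p N τ τ′ γ →
    ⟦ 34848 ⟧ + γ * p * (⟦ 2 ⟧ * (N - τ)) - (⟦ 34848 ⟧ + γ * p * (⟦ 2 ⟧ * (N - τ′))) ≡ γ * p * (⟦ 2 ⟧ * (τ′ - τ))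
  budget-step-identity = solve-∀ ring

  block-final-identity : ∀ p N τ r γ →
    ⟦ 4 ⟧ * (⟦ 8 ⟧ * ((r - p * τ) * (r - p * τ)) + γ * p * (⟦ 2 ⟧ * (N - τ))) - (r - p * τ) * (r - p * τ)
    ≡ ⟦ 31 ⟧ * ((r - p * τ) * (r - p * τ)) + ⟦ 4 ⟧ * (γ * p * (⟦ 2 ⟧ * (N - τ)))
  block-final-identity = solve-∀ ring

  swap-20 : ∀ a b → a * (⟦ 20 ⟧ * b) ≡ ⟦ 20 ⟧ * (a * b)
  swap-20 = solve-∀ ring

  distribute-suc : ∀ κ s → κ + κ * s ≡ κ * (1ℚ + s)
  distribute-suc = solve-∀ ring

  distribute-9 : ∀ t g d → ⟦ 9 ⟧ * (t * g) + t * d ≡ t * (⟦ 9 ⟧ * g + d)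
  distribute-9 = solve-∀ ring

  swap-2 : ∀ a b c → a * (⟦ 2 ⟧ * (b * c)) ≡ ⟦ 2 ⟧ * (a * b * c)
  swap-2 = solve-∀ ring

  estimate-expand : ∀ N l ƛ p r c t → N * l * ((r + c - p * (t + l)) + ƛ * (c * t - l * r))
         ≡ N * l * (r + c) - p * N * l * (t + l) + N * (l * ƛ) * (c * t - l * r)
  estimate-expand = solve-∀ ring

  estimate-contract : ∀ N l k r c t → N * l * (r + c) - k * l * (t + l) + N * 1ℚ * (c * t - l * r) ≡ (t + l) * (c * N - k * l)
  estimate-contract = solve-∀ ring

  swap-432 : ∀ a b → a * (⟦ 432 ⟧ * b) ≡ ⟦ 432 ⟧ * (a * b)
  swap-432 = solve-∀ ring

  offset-below : ∀ y z → 1ℚ + y - (1ℚ + y - z) ≡ z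
  offset-below = solve-∀ ring

  neg-scale : ∀ a e δ → a * (- e + - δ) ≡ - (a * (e + δ))
  neg-scale = solve-∀ ring

  neg-difference : ∀ t a b → - (t * (a - b)) ≡ t * (b - a)
  neg-difference = solve-∀ ring

  square-neg : ∀ z → (- z) * (- z) ≡ z * z
  square-neg = solve-∀ ring

  offset-complement : ∀ d y z → 1ℚ + d - - (y - z) ≡ (1ℚ + d + y) - z
  offset-complement = solve-∀ ring

  factor-complement : ∀ t p → t - p * t ≡ (1ℚ - p) * t
  factor-complement = solve-∀ ring

  square-neg-sum : ∀ e δ → (e + δ) * (e + δ) ≡ (- e + - δ) * (- e + - δ)
  square-neg-sum = solve-∀ ring

  sum-minus : ∀ x d → x + d - x ≡ d
  sum-minus = solve-∀ ring

  sum-minus-left : ∀ d a → a ≡ d + a - d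
  sum-minus-left = solve-∀ ring

  rising-offset : ∀ r c d p t i → r + c - d - p * (t + i) ≡ (r - p * t - d) + (c - p * i)
  rising-offset = solve-∀ ring

  square-neg-difference : ∀ e d → (- e - d) * (- e - d) ≡ (e + d) * (e + d)
  square-neg-difference = solve-∀ ring

  falling-offset : ∀ r c d p t i → d + (r + c) - p * (t + i) ≡ (r - p * t + d) + (c - p * i)
  falling-offset = solve-∀ ring

  swap-factor : ∀ a b c → a * (b * c) ≡ b * (a * c)
  swap-factor = solve-∀ ring

  startPot-identity : ∀ γ p N → ⟦ 34848 ⟧ + ⟦ 2 ⟧ * (γ * (p * N)) - (⟦ 34848 ⟧ + γ * p * (⟦ 2 ⟧ * (N - ⟦ 2 ⟧))) ≡ ⟦ 4 ⟧ * (γ * p)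
  startPot-identity = solve-∀ ring

-- Inequalities for the potentials, at one arrival and at block boundaries

module Potentials (C γ : ℚ) (scale : RationalLemmas.Scale C γ) where

  open import Data.Rational.Base
  open import Data.Rational.Properties
  open RationalLemmas
  open Identities

  C≥ : ⟦ 49152 ⟧ ≤ C
  C≥ = proj₁ scale

  γ≥ : ⟦ 4194304 ⟧ ≤ γ
  γ≥ = proj₁ (proj₂ scale)

  γ≡ : γ ≡ (⟦ 8 ⟧ + ⟦ 64 ⟧ * C) * (⟦ 8 ⟧ + ⟦ 64 ⟧ * C) + (⟦ 8 ⟧ + ⟦ 64 ⟧ * C) + ⟦ 8 ⟧
  γ≡ = proj₂ (proj₂ scale)

  γ≥0 : 0ℚ ≤ γ
  γ≥0 = ≤-trans (⟦⟧≥0 4194304) γ≥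

  budget : (p N τ : ℚ) → ℚ
  budget p N τ = γ * p * (⟦ 2 ⟧ * (N - τ))

  budget≥0 : ∀ {p N τ} → 0ℚ ≤ p → τ ≤ N → 0ℚ ≤ budget p N τ
  budget≥0 0≤p τ≤N = γ≥0 ⊛ 0≤p ⊛ (⟦⟧≥0 2 ⊛ diff≥0 τ≤N)

  blockPot : (p N τ r : ℚ) → ℚ
  blockPot p N τ r = ⟦ 8 ⟧ * ((r - p * τ) * (r - p * τ)) + budget p N τ

  -- Potential after i of the 1/ƛ arrivals of a count block that began with τ₀
  -- gaps and the tracked element at rank r₀, when c of the arrivals were above it.
  -- Here δ is the error of the estimate that the count yields for the offset e.
  countPot : (ƛ p N i τ₀ r₀ c : ℚ) → ℚ
  countPot ƛ p N i τ₀ r₀ c =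
    (⟦ 8 ⟧ - i * ƛ) * (e * e) + ⟦ 32 ⟧ * (⟦ 2 ⟧ - i * ƛ) * (δ * δ) + γ * p * (⟦ 2 ⟧ * (N - τ₀) - i)
    where
    e δ : ℚ
    e = r₀ + c - p * (τ₀ + i)
    δ = ƛ * (c * τ₀ - i * r₀)

  -- τ times the second moment of the increment of e, which is 1 - p with probability r / τ and -p
  -- otherwise.
  variance : (p τ r : ℚ) → ℚ
  variance p τ r = r * ((1ℚ - p) * (1ℚ - p)) + (τ - r) * (p * p)

  variance≥0 : ∀ p {τ r} → 0ℚ ≤ r → r ≤ τ → 0ℚ ≤ variance p τ r
  variance≥0 p 0≤r r≤τ = 0≤r ⊛ sq≥0 (1ℚ - p) ⊕ diff≥0 r≤τ ⊛ sq≥0 p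

  variance≤ : ∀ {p τ r} → 0ℚ ≤ p → p ≤ 1ℚ → 0ℚ ≤ r → 0ℚ ≤ τ → 0ℚ ≤ r + p * τ - variance p τ r
  variance≤ {p} {τ} {r} 0≤p p≤1 0≤r 0≤τ =
    subst (0ℚ ≤_) (variance-slack p τ r) (0≤p ⊛ 0≤τ ⊛ diff≥0 p≤1 ⊕ ⟦⟧≥0 2 ⊛ 0≤p ⊛ 0≤r)

  offset-square : ∀ τ r p x → r * ((x + (1ℚ - p)) * (x + (1ℚ - p))) + (τ - r) * ((x + - p) * (x + - p))
    ≡ τ * (x * x) + ⟦ 2 ⟧ * x * (r - p * τ) + variance p τ r
  offset-square τ r p x = trans (weighted-square τ r (1ℚ - p) (- p) x)
      (cong₂ (λ a b → τ * (x * x) + ⟦ 2 ⟧ * x * a + b) (offset-mean τ r p) (offset-spread τ r p))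

  -- The averages are multiplied by τ. Both e and δ grow in the mean by the factor 1 + 1 / τ;
  -- lowering the coefficients of their squares by multiples of ƛ ≥ 64 / τ₀ outweighs this. The
  -- variances, at most r + p τ for e and C r for δ, are paid by γ p τ.
  count-step : ∀ ƛ p N i τ₀ r₀ c → 0ℚ ≤ ƛ → 0ℚ ≤ p → p ≤ 1ℚ → 0ℚ ≤ i → i ≤ τ₀ →
    0ℚ ≤ r₀ → 0ℚ ≤ c → r₀ ≤ τ₀ → r₀ + c ≤ τ₀ + i → ⟦ 64 ⟧ ≤ ƛ * τ₀ → ƛ * τ₀ ≤ ⟦ 128 ⟧ → 1ℚ ≤ p * τ₀ →
    (r₀ + c) * countPot ƛ p N (1ℚ + i) τ₀ r₀ (1ℚ + c) + ((τ₀ + i) - (r₀ + c)) * countPot ƛ p N (1ℚ + i) τ₀ r₀ c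
    ≤ (τ₀ + i) * countPot ƛ p N i τ₀ r₀ c
  count-step ƛ p N i τ₀ r₀ c 0≤ƛ 0≤p p≤1 0≤i i≤τ₀ 0≤r₀ 0≤c r₀≤τ₀ r≤τ lo hi 1≤pτ₀ =
    by-cert _ (trans (cong (λ z → τ * countPot ƛ p N i τ₀ r₀ c - z) expanded)
      (trans (cong (λ l → τ * countPot ƛ p N i τ₀ r₀ c -
          ((⟦ 8 ⟧ - u) * (τ * (e * e) + ⟦ 2 ⟧ * e * e + variance p τ r) + ⟦ 32 ⟧ * (⟦ 2 ⟧ - u) *
          (τ * (δ * δ) + ⟦ 2 ⟧ * δ * δ + ƛ * ƛ * noise) + τ * l)) L₁≡)
        (identity τ i ƛ e δ (variance p τ r) (ƛ * ƛ * noise) p γ C L r (split-off r (p * τ)))))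
      ( (x≥0 ⊕ ⟦⟧≥0 2 ⊛ u≥0) ⊛ sq≥0 e
      ⊕ ⟦⟧≥0 32 ⊛ (x≥0 ⊕ ⟦⟧≥0 60 ⊕ ⟦⟧≥0 2 ⊛ u≥0) ⊛ sq≥0 δ
      ⊕ ⟦⟧≥0 8 ⊛ variance≤ 0≤p p≤1 0≤r 0≤τ
      ⊕ u≥0 ⊛ variance≥0 p 0≤r r≤τ
      ⊕ ⟦⟧≥0 32 ⊛ (⟦⟧≥0 2 ⊛ noise≤ ⊕ u≥0 ⊛ (0≤ƛ ⊛ 0≤ƛ ⊛ noise≥0))
      ⊕ tail≥0 (p * τ) e (≤-trans 1≤pτ₀ (*-mono-≥0 0≤p (by-cert i (plus-minus τ₀ i) 0≤i))))
    where
    τ r e δ u noise : ℚ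
    τ = τ₀ + i
    r = r₀ + c
    e = r - p * τ
    δ = ƛ * (c * τ₀ - i * r₀)
    u = (1ℚ + i) * ƛ
    noise = r * ((τ₀ - r₀) * (τ₀ - r₀)) + (τ - r) * (r₀ * r₀)
    0≤τ₀ : 0ℚ ≤ τ₀
    0≤τ₀ = ≤-trans 0≤i i≤τ₀
    0≤τ : 0ℚ ≤ τ
    0≤τ = 0≤τ₀ ⊕ 0≤i
    0≤r : 0ℚ ≤ r
    0≤r = 0≤r₀ ⊕ 0≤c
    u≥0 : 0ℚ ≤ u
    u≥0 = (⟦⟧≥0 1 ⊕ 0≤i) ⊛ 0≤ƛ
    x≥0 : 0ℚ ≤ ƛ * τ - ⟦ 64 ⟧
    x≥0 = subst (0ℚ ≤_) (rate-shift ƛ τ₀ i) (diff≥0 lo ⊕ 0≤ƛ ⊛ 0≤i)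
    noise≥0 : 0ℚ ≤ noise
    noise≥0 = 0≤r ⊛ sq≥0 (τ₀ - r₀) ⊕ diff≥0 r≤τ ⊛ sq≥0 r₀
    -- The noise is at most 3 r τ₀², and ƛ τ₀ ≤ 128 turns this into 3 · 128² r.
    noise≤ : 0ℚ ≤ C * r - ƛ * ƛ * noise
    noise≤ = subst (0ℚ ≤_) (noise-combine C ƛ τ₀ r noise)
      ( diff≥0 C≥ ⊛ 0≤r
      ⊕ ⟦⟧≥0 3 ⊛ (diff≥0 hi ⊛ (⟦⟧≥0 128 ⊕ 0≤ƛ ⊛ 0≤τ₀)) ⊛ 0≤r
      ⊕ sq≥0 ƛ ⊛ subst (0ℚ ≤_) (noise-slack τ₀ i r₀ c)
          (⟦⟧≥0 2 ⊛ 0≤r ⊛ sq≥0 τ₀ ⊕ ⟦⟧≥0 2 ⊛ 0≤τ₀ ⊛ 0≤r₀ ⊛ 0≤c ⊕ diff≥0 i≤τ₀ ⊛ sq≥0 r₀))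
    -- The form of γ makes the coefficient of x equal to k², so that k² x and 48 e² dominate the
    -- linear term k e. The 48 is 64, from the decrease of the coefficient of e², less the 16 that
    -- the growth of 8 e² takes.
    tail≥0 : ∀ x e → 1ℚ ≤ x → 0ℚ ≤ (γ - ⟦ 16 ⟧ - ⟦ 64 ⟧ * C) * x - (⟦ 8 ⟧ + ⟦ 64 ⟧ * C) * e + ⟦ 48 ⟧ * (e * e)
    tail≥0 x e 1≤x = subst (λ g → 0ℚ ≤ (g - ⟦ 16 ⟧ - ⟦ 64 ⟧ * C) * x - k * e + ⟦ 48 ⟧ * (e * e)) (sym γ≡)
      (*-cancel-≥1 3 (subst₂ _≤_ (sym (*-zeroʳ ⟦ 4 ⟧)) (count-tail C x e)
        (⟦⟧≥0 4 ⊛ sq≥0 k ⊛ diff≥0 1≤x ⊕ ⟦⟧≥0 3 ⊛ sq≥0 k ⊕ ⟦⟧≥0 188 ⊛ sq≥0 e ⊕ sq≥0 (k - ⟦ 2 ⟧ * e))))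
      where
      k : ℚ
      k = ⟦ 8 ⟧ + ⟦ 64 ⟧ * C
    squares′ : r * ((δ + ƛ * (τ₀ - r₀)) * (δ + ƛ * (τ₀ - r₀))) + (τ - r) * ((δ + - (ƛ * r₀)) * (δ + - (ƛ * r₀))) ≡ τ * (δ * δ) + ⟦
        2 ⟧ * δ * δ + ƛ * ƛ * noise
    squares′ = trans (weighted-square τ r (ƛ * (τ₀ - r₀)) (- (ƛ * r₀)) δ)
        (cong₂ (λ a b → τ * (δ * δ) + ⟦ 2 ⟧ * δ * a + b) (estimate-mean ƛ τ₀ i r₀ c) (estimate-spread ƛ τ r τ₀ r₀))
    next-offset : ∀ b → r₀ + (b + c) - p * (τ₀ + (1ℚ + i)) ≡ e + (b - p)
    next-offset b = offset-arrival r₀ b c p τ₀ i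
    next-estimate : ∀ b → ƛ * ((b + c) * τ₀ - (1ℚ + i) * r₀) ≡ δ + ƛ * (b * τ₀ - r₀)
    next-estimate b = estimate-arrival ƛ b c τ₀ i r₀
    L L₁ : ℚ
    L  = γ * p * (⟦ 2 ⟧ * (N - τ₀) - i)
    L₁ = γ * p * (⟦ 2 ⟧ * (N - τ₀) - (1ℚ + i))
    L₁≡ : L₁ ≡ L - γ * p
    L₁≡ = count-budget (γ * p) (⟦ 2 ⟧ * (N - τ₀)) i
    next-pot : (e δ : ℚ) → ℚ
    next-pot e δ = (⟦ 8 ⟧ - u) * (e * e) + ⟦ 32 ⟧ * (⟦ 2 ⟧ - u) * (δ * δ) + L₁
    expanded : r * countPot ƛ p N (1ℚ + i) τ₀ r₀ (1ℚ + c) + (τ - r) * countPot ƛ p N (1ℚ + i) τ₀ r₀ c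
      ≡ (⟦ 8 ⟧ - u) * (τ * (e * e) + ⟦ 2 ⟧ * e * e + variance p τ r) + ⟦ 32 ⟧ * (⟦ 2 ⟧ - u) *
          (τ * (δ * δ) + ⟦ 2 ⟧ * δ * δ + ƛ * ƛ * noise)
        + τ * L₁
    expanded = trans
      (cong₂ (λ x y → r * x + (τ - r) * y)
        (cong₂ next-pot (next-offset 1ℚ) (trans (next-estimate 1ℚ) (cong (λ z → δ + ƛ * (z - r₀)) (*-identityˡ τ₀))))
        (cong₂ next-pot (trans (cong (λ z → r₀ + z - p * (τ₀ + (1ℚ + i))) (sym (+-identityˡ c)))
            (trans (next-offset 0ℚ) (cong (e +_) (+-identityˡ (- p)))))
                        (trans (cong (λ z → ƛ * (z * τ₀ - (1ℚ + i) * r₀)) (sym (+-identityˡ c)))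
                            (trans (next-estimate 0ℚ) (cong (δ +_) (estimate-below ƛ τ₀ r₀))))))
      (trans (count-collect r τ (⟦ 8 ⟧ - u) (⟦ 32 ⟧ * (⟦ 2 ⟧ - u)) L₁ _ _ _ _)
        (cong₂ (λ x y → (⟦ 8 ⟧ - u) * x + ⟦ 32 ⟧ * (⟦ 2 ⟧ - u) * y + τ * L₁) (offset-square τ r p e) squares′))
    identity : ∀ τ i ƛ e δ V W p γ C L r → r ≡ p * τ + e →
      let u = (1ℚ + i) * ƛ in
      τ * ((⟦ 8 ⟧ - i * ƛ) * (e * e) + ⟦ 32 ⟧ * (⟦ 2 ⟧ - i * ƛ) * (δ * δ) + L)
      - ((⟦ 8 ⟧ - u) * (τ * (e * e) + ⟦ 2 ⟧ * e * e + V) + ⟦ 32 ⟧ * (⟦ 2 ⟧ - u) * (τ * (δ * δ) + ⟦ 2 ⟧ * δ * δ + W) + τ *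
          (L - γ * p))
      ≡ (ƛ * τ - ⟦ 64 ⟧ + ⟦ 2 ⟧ * u) * (e * e) + ⟦ 32 ⟧ * (ƛ * τ - ⟦ 64 ⟧ + ⟦ 60 ⟧ + ⟦ 2 ⟧ * u) * (δ * δ)
        + ⟦ 8 ⟧ * (r + p * τ - V) + u * V + ⟦ 32 ⟧ * (⟦ 2 ⟧ * (C * r - W) + u * W)
        + ((γ - ⟦ 16 ⟧ - ⟦ 64 ⟧ * C) * (p * τ) - (⟦ 8 ⟧ + ⟦ 64 ⟧ * C) * e + ⟦ 48 ⟧ * (e * e))
    identity τ i ƛ e δ V W p γ C L _ refl = count-drift τ i ƛ e δ V W p γ C L

  -- The part of the potential of a window that began with τ₁ gaps and the tracked
  -- element at rank r₁ which does not involve the candidate.  The parameter v is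
  -- proportional to the number of arrivals still to come.
  driftPot : (p N v i τ₁ r₁ c : ℚ) → ℚ
  driftPot p N v i τ₁ r₁ c =
    ⟦ 72 ⟧ * ((1ℚ + ⟦ 5 ⟧ * v) * (d * d) + ⟦ 3 ⟧ * v * (e₁ * e₁)) + ½ * (e₁ * e₁) + γ * p * (⟦ 2 ⟧ * (N - (τ₁ + i)))
    where
    e₁ d : ℚ
    e₁ = r₁ - p * τ₁
    d = c - p * i

  -- The cross term 2 d e with e = e₁ + d is at most d² + e² ≤ 3 d² + 2 e₁², and 20 v ≤ 1 keeps its
  -- weight 72 (1 + 5 v) below 90: a cost of 270 d² + 180 e₁². The decrease of v by κ ≥ 1 / τ
  -- releases 360 d² + 216 e₁². The rest and the budget cover the variance.
  window-step : ∀ κ p N v i τ₁ r₁ c → 0ℚ ≤ p → p ≤ 1ℚ → 0ℚ ≤ v → ⟦ 20 ⟧ * v ≤ 1ℚ →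
    0ℚ ≤ r₁ + c → r₁ + c ≤ τ₁ + i → 1ℚ ≤ κ * (τ₁ + i) → 1ℚ ≤ p * (τ₁ + i) →
    (r₁ + c) * driftPot p N v (1ℚ + i) τ₁ r₁ (1ℚ + c) + ((τ₁ + i) - (r₁ + c)) * driftPot p N v (1ℚ + i) τ₁ r₁ c
    ≤ (τ₁ + i) * driftPot p N (κ + v) i τ₁ r₁ c
  window-step κ p N v i τ₁ r₁ c 0≤p p≤1 0≤v 20v≤1 0≤r r≤τ 1≤κτ 1≤pτ =
    by-cert _ (trans (cong (λ z → τ * driftPot p N (κ + v) i τ₁ r₁ c - z) expanded)
      (trans (cong (λ l → τ * driftPot p N (κ + v) i τ₁ r₁ c -
          (⟦ 72 ⟧ * (1ℚ + ⟦ 5 ⟧ * v) * (τ * (d * d) + ⟦ 2 ⟧ * d * e + variance p τ r) + τ *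
          (⟦ 216 ⟧ * v * (e₁ * e₁) + ½ * (e₁ * e₁) + l))) L₁≡)
        (identity τ κ v d e₁ e r (variance p τ r) p γ L (offset-split p r₁ c τ₁ i) (split-off r (p * τ)))))
      ( ⟦⟧≥0 72 ⊛ diff≥0 1≤κτ ⊛ (⟦⟧≥0 5 ⊛ sq≥0 d ⊕ ⟦⟧≥0 3 ⊛ sq≥0 e₁)
      ⊕ ⟦⟧≥0 18 ⊛ diff≥0 20v≤1 ⊛ (sq≥0 d ⊕ sq≥0 e ⊕ variance≥0 p 0≤r r≤τ)
      ⊕ ⟦⟧≥0 72 ⊛ (⟦⟧≥0 1 ⊕ ⟦⟧≥0 5 ⊛ 0≤v) ⊛ sq≥0 (d - e)
      ⊕ ⟦⟧≥0 90 ⊛ sq≥0 (d - e₁)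
      ⊕ ⟦⟧≥0 90 ⊛ variance≤ 0≤p p≤1 0≤r (≤-trans 0≤r r≤τ)
      ⊕ tail≥0 (p * τ) d e₁ 1≤pτ)
    where
    τ r e e₁ d : ℚ
    τ = τ₁ + i
    r = r₁ + c
    e = r - p * τ
    e₁ = r₁ - p * τ₁
    d = c - p * i
    tail≥0 : ∀ x d e → 1ℚ ≤ x → 0ℚ ≤ ⟦ 90 ⟧ * (d * d) + ⟦ 36 ⟧ * (e * e) - ⟦ 90 ⟧ * (⟦ 2 ⟧ * x + e + d) + ⟦ 2 ⟧ * γ * x
    tail≥0 x d e 1≤x = *-cancel-≥1 3 (subst₂ _≤_ (sym (*-zeroʳ ⟦ 4 ⟧)) (window-tail x d e γ)
      ( ⟦⟧≥0 90 ⊛ sq≥0 (⟦ 2 ⟧ * d - 1ℚ) ⊕ sq≥0 (⟦ 12 ⟧ * e - ⟦ 15 ⟧) ⊕ ⟦⟧≥0 315 ⊛ diff≥0 1≤x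
      ⊕ γ-large ⊛ ≤-trans (⟦⟧≥0 1) 1≤x ⊕ ⟦⟧≥0 53 ⊛ ≤-trans (⟦⟧≥0 1) 1≤x))
      where
      γ-large : 0ℚ ≤ ⟦ 8 ⟧ * γ - ⟦ 1088 ⟧
      γ-large = subst (0ℚ ≤_) (scale-shift γ) (⟦⟧≥0 8 ⊛ diff≥0 γ≥ ⊕ ⟦⟧≥0 33553344)
    L L₁ : ℚ
    L  = γ * p * (⟦ 2 ⟧ * (N - (τ₁ + i)))
    L₁ = γ * p * (⟦ 2 ⟧ * (N - (τ₁ + (1ℚ + i))))
    L₁≡ : L₁ ≡ L - ⟦ 2 ⟧ * (γ * p)
    L₁≡ = window-budget (γ * p) N τ₁ i
    next-pot : ℚ → ℚ
    next-pot d = ⟦ 72 ⟧ * ((1ℚ + ⟦ 5 ⟧ * v) * (d * d) + ⟦ 3 ⟧ * v * (e₁ * e₁)) + ½ * (e₁ * e₁) + L₁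
    expanded : r * driftPot p N v (1ℚ + i) τ₁ r₁ (1ℚ + c) + (τ - r) * driftPot p N v (1ℚ + i) τ₁ r₁ c
      ≡ ⟦ 72 ⟧ * (1ℚ + ⟦ 5 ⟧ * v) * (τ * (d * d) + ⟦ 2 ⟧ * d * e + variance p τ r) + τ *
          (⟦ 216 ⟧ * v * (e₁ * e₁) + ½ * (e₁ * e₁) + L₁)
    expanded = trans
      (cong₂ (λ x y → r * next-pot x + (τ - r) * next-pot y) (drift-above c p i) (drift-below c p i))
      (trans (window-collect r τ v (e₁ * e₁) L₁ _ _)
        (cong (λ x → ⟦ 72 ⟧ * (1ℚ + ⟦ 5 ⟧ * v) * x + τ * (⟦ 216 ⟧ * v * (e₁ * e₁) + ½ * (e₁ * e₁) + L₁)) (offset-square τ r p d)))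
    identity : ∀ τ κ v d e₁ e r V p γ L → e ≡ e₁ + d → r ≡ p * τ + e →
      τ * (⟦ 72 ⟧ * ((1ℚ + ⟦ 5 ⟧ * (κ + v)) * (d * d) + ⟦ 3 ⟧ * (κ + v) * (e₁ * e₁)) + ½ * (e₁ * e₁) + L)
      - (⟦ 72 ⟧ * (1ℚ + ⟦ 5 ⟧ * v) * (τ * (d * d) + ⟦ 2 ⟧ * d * e + V) + τ *
          (⟦ 216 ⟧ * v * (e₁ * e₁) + ½ * (e₁ * e₁) + (L - ⟦ 2 ⟧ * (γ * p))))
      ≡ ⟦ 72 ⟧ * (κ * τ - 1ℚ) * (⟦ 5 ⟧ * (d * d) + ⟦ 3 ⟧ * (e₁ * e₁))
        + ⟦ 18 ⟧ * (1ℚ - ⟦ 20 ⟧ * v) * (d * d + e * e + V)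
        + ⟦ 72 ⟧ * (1ℚ + ⟦ 5 ⟧ * v) * ((d - e) * (d - e))
        + ⟦ 90 ⟧ * ((d - e₁) * (d - e₁))
        + ⟦ 90 ⟧ * (r + p * τ - V)
        + (⟦ 90 ⟧ * (d * d) + ⟦ 36 ⟧ * (e₁ * e₁) - ⟦ 90 ⟧ * (⟦ 2 ⟧ * (p * τ) + e₁ + d) + ⟦ 2 ⟧ * γ * (p * τ))
    identity τ κ v d e₁ _ _ V p γ L refl refl = window-drift τ κ v d e₁ V p γ L

  -- The square (x - 8 d)² is the origin of the weights 9 = 8 + 1 and 72 = 8 + 64 in the window
  -- potential.
  window-end : ∀ p N i τ₁ r₁ c x f → x * x ≤ f →
    ⟦ 8 ⟧ * ((x + (c - p * i)) * (x + (c - p * i))) + budget p N (τ₁ + i) ≤ ⟦ 9 ⟧ * f + driftPot p N 0ℚ i τ₁ r₁ c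
  window-end p N i τ₁ r₁ c x f x²≤f = by-cert _ (window-end-identity (r₁ - p * τ₁) (c - p * i) x f (budget p N (τ₁ + i)))
    (⟦⟧≥0 9 ⊛ diff≥0 x²≤f ⊕ sq≥0 (x - ⟦ 8 ⟧ * (c - p * i)) ⊕ nonNegative⁻¹ ½ ⊛ sq≥0 (r₁ - p * τ₁))

  -- Inside a window y has not been replaced, so its offset e₁ + d must be dominated without help
  -- from the distance term. This is the purpose of the summand ½ e₁² of `driftPot`.
  window-final : ∀ p N v i τ₁ r₁ c f → 0ℚ ≤ p → 0ℚ ≤ v → 0ℚ ≤ f → τ₁ + i ≤ N →
    (r₁ + c - p * (τ₁ + i)) * (r₁ + c - p * (τ₁ + i)) ≤ ⟦ 4 ⟧ * (⟦ 9 ⟧ * f + driftPot p N v i τ₁ r₁ c)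
  window-final p N v i τ₁ r₁ c f 0≤p 0≤v 0≤f τ≤N = by-cert _
    (trans (cong (λ e → ⟦ 4 ⟧ * (⟦ 9 ⟧ * f + driftPot p N v i τ₁ r₁ c) - e * e) (offset-split p r₁ c τ₁ i))
           (window-final-identity v (r₁ - p * τ₁) (c - p * i) f (budget p N (τ₁ + i))))
    ( ⟦⟧≥0 36 ⊛ 0≤f ⊕ ⟦⟧≥0 4 ⊛ budget≥0 0≤p τ≤N ⊕ ⟦⟧≥0 1440 ⊛ 0≤v ⊛ sq≥0 (c - p * i) ⊕ ⟦⟧≥0 864 ⊛ 0≤v ⊛ sq≥0 (r₁ - p * τ₁)
    ⊕ ⟦⟧≥0 286 ⊛ sq≥0 (c - p * i) ⊕ sq≥0 (r₁ - p * τ₁ - (c - p * i)))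

  count-final : ∀ ƛ p N i τ₀ r₀ c → 0ℚ ≤ p → 0ℚ ≤ i → i * ƛ ≤ 1ℚ → τ₀ + i ≤ N →
    (r₀ + c - p * (τ₀ + i)) * (r₀ + c - p * (τ₀ + i)) ≤ ⟦ 4 ⟧ * countPot ƛ p N i τ₀ r₀ c
  count-final ƛ p N i τ₀ r₀ c 0≤p 0≤i iƛ≤1 τ≤N = by-cert _
    (count-final-identity (i * ƛ) (r₀ + c - p * (τ₀ + i)) (ƛ * (c * τ₀ - i * r₀)) (γ * p) N τ₀ i)
    ( (⟦⟧≥0 27 ⊕ ⟦⟧≥0 4 ⊛ diff≥0 iƛ≤1) ⊛ sq≥0 (r₀ + c - p * (τ₀ + i))
    ⊕ ⟦⟧≥0 128 ⊛ (⟦⟧≥0 1 ⊕ diff≥0 iƛ≤1) ⊛ sq≥0 (ƛ * (c * τ₀ - i * r₀))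
    ⊕ ⟦⟧≥0 4 ⊛ (γ≥0 ⊛ 0≤p ⊛ (⟦⟧≥0 2 ⊛ diff≥0 τ≤N ⊕ 0≤i)))

  count-start : ∀ ƛ p N τ r → countPot ƛ p N 0ℚ τ r 0ℚ ≡ blockPot p N τ r
  count-start ƛ p N τ r = count-start-identity ƛ p N τ r γ

  -- If the estimate ê is small at the end of a count block, then y is kept.
  count-stay : ∀ ƛ p N i τ₀ r₀ c ê → i * ƛ ≡ 1ℚ → ê ≡ (r₀ + c - p * (τ₀ + i)) + ƛ * (c * τ₀ - i * r₀) →
    ê * ê ≤ ⟦ 1048576 ⟧ → 1ℚ ≤ ⟦ 2 ⟧ * (p * i) →
    blockPot p N (τ₀ + i) (r₀ + c) ≤ countPot ƛ p N i τ₀ r₀ c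
  count-stay ƛ p N i τ₀ r₀ c ê iƛ≡1 ê≡ ê²≤ 1≤2pi = by-cert _
    (trans (cong (λ z → (⟦ 8 ⟧ - z) * (e * e) + ⟦ 32 ⟧ * (⟦ 2 ⟧ - z) * (δ * δ) + γ * p * (⟦ 2 ⟧ * (N - τ₀) - i) - blockPot p N
        (τ₀ + i) (r₀ + c)) iƛ≡1)
           (count-stay-identity e δ p i N τ₀ γ))
    -- The coefficient of e² must return from 7 to 8. As ê = e + δ, the missing e² is at most 2 ê² +
    -- 32 δ², and the saved budget γ / 2 ≥ 2 · 1024² pays for 2 ê².
    ( ⟦⟧≥0 30 ⊛ sq≥0 δ ⊕ sq≥0 (e + ⟦ 2 ⟧ * δ) ⊕ ⟦⟧≥0 2 ⊛ diff≥0 (subst (λ z → z * z ≤ ⟦ 1048576 ⟧) ê≡ ê²≤)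
    ⊕ ½γ ⊛ diff≥0 1≤2pi ⊕ nonNegative⁻¹ ½ ⊛ diff≥0 γ≥)
    where
    e = r₀ + c - p * (τ₀ + i)
    δ = ƛ * (c * τ₀ - i * r₀)
    ½γ : 0ℚ ≤ ½ * γ
    ½γ = nonNegative⁻¹ ½ ⊛ γ≥0

  -- Aiming at half of the estimated offset e + δ leaves half of e² and δ² in
  -- expectation; m is the mean displacement, up to rounding of the window length.
  half-aim : ∀ e δ m → ⟦ 2 ⟧ * m ≤ e + δ + ⟦ 2 ⟧ → e + δ ≤ ⟦ 3 ⟧ * m →
    ⟦ 9 ⟧ * (e * e - ⟦ 2 ⟧ * e * m + ⟦ 2 ⟧ * (m * m)) ≤ ⟦ 6 ⟧ * (e * e) + ⟦ 32 ⟧ * (δ * δ) + ⟦ 36 ⟧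
  half-aim e δ m hi lo = by-cert _ (half-aim-identity e δ m)
    ( nonNegative⁻¹ (½ * ½) ⊛ sq≥0 e ⊕ ⟦⟧≥0 18 ⊛ sq≥0 δ ⊕ sq≥0 (½ * e - ⟦ 2 ⟧ * δ)
    ⊕ nonNegative⁻¹ (⟦ 9 ⟧ * ½) ⊛ sq≥0 (e + δ - ⟦ 2 ⟧ * m + δ)
    ⊕ ⟦⟧≥0 12 ⊛ diff≥0 hi ⊛ diff≥0 lo
    ⊕ sq≥0 (⟦ 2 ⟧ * (e + δ) - ⟦ 6 ⟧ * m + ⟦ 6 ⟧))

  -- Of the 7 e² present at the end of a count block, 6 e² go to the displacement, ½ e² to the same
  -- term of `driftPot` and ½ e² to its 216 v e². The saved budget pays the constant 36.
  count-move : ∀ ƛ p N v i τ₀ r₀ c f → i * ƛ ≡ 1ℚ → ⟦ 432 ⟧ * v ≤ 1ℚ → 1ℚ ≤ ⟦ 2 ⟧ * (p * i) →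
    (let e = r₀ + c - p * (τ₀ + i)
         δ = ƛ * (c * τ₀ - i * r₀) in
     ⟦ 9 ⟧ * f ≤ ⟦ 6 ⟧ * (e * e) + ⟦ 32 ⟧ * (δ * δ) + ⟦ 36 ⟧) →
    ⟦ 9 ⟧ * f + driftPot p N v 0ℚ (τ₀ + i) (r₀ + c) 0ℚ ≤ countPot ƛ p N i τ₀ r₀ c
  count-move ƛ p N v i τ₀ r₀ c f iƛ≡1 v≤ 1≤2pi f≤ = by-cert _
    (trans (cong (λ z → (⟦ 8 ⟧ - z) * (e * e) + ⟦ 32 ⟧ * (⟦ 2 ⟧ - z) * (δ * δ) + γ * p * (⟦ 2 ⟧ * (N - τ₀) - i)
                        - (⟦ 9 ⟧ * f + driftPot p N v 0ℚ (τ₀ + i) (r₀ + c) 0ℚ)) iƛ≡1)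
           (eq e δ (p * i) (γ * p * (⟦ 2 ⟧ * (N - τ₀) - i)) (γ * p * (⟦ 2 ⟧ * (N - (τ₀ + i + 0ℚ)))) γ f v (0ℚ - p * 0ℚ)
             (count-move-rest γ p i N τ₀) (count-move-zero-drift p)))
    ( nonNegative⁻¹ ½ ⊛ diff≥0 v≤ ⊛ sq≥0 e ⊕ ½γ ⊛ diff≥0 1≤2pi ⊕ (nonNegative⁻¹ ½ ⊛ diff≥0 γ≥ ⊕ ⟦⟧≥0 2097116) ⊕ diff≥0 f≤)
    where
    e = r₀ + c - p * (τ₀ + i)
    δ = ƛ * (c * τ₀ - i * r₀)
    ½γ : 0ℚ ≤ ½ * γ
    ½γ = nonNegative⁻¹ ½ ⊛ γ≥0
    eq : ∀ e δ x L L′ γ f v d → L ≡ L′ + γ * x → d ≡ 0ℚ →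
      (⟦ 8 ⟧ - 1ℚ) * (e * e) + ⟦ 32 ⟧ * (⟦ 2 ⟧ - 1ℚ) * (δ * δ) + L
      - (⟦ 9 ⟧ * f + (⟦ 72 ⟧ * ((1ℚ + ⟦ 5 ⟧ * v) * (d * d) + ⟦ 3 ⟧ * v * (e * e)) + ½ * (e * e) + L′))
      ≡ ½ * (1ℚ - ⟦ 432 ⟧ * v) * (e * e) + ½ * γ * (⟦ 2 ⟧ * x - 1ℚ) + (½ * (γ - ⟦ 4194304 ⟧) + ⟦ 2097116 ⟧)
        + (⟦ 6 ⟧ * (e * e) + ⟦ 32 ⟧ * (δ * δ) + ⟦ 36 ⟧ - ⟦ 9 ⟧ * f)
    eq e δ x _ L′ γ f v _ refl refl = count-move-identity e δ x L′ γ f v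

  -- 34848 is 8 · 66². While the maximum is tracked, e = 1 - p τ with 0 ≤ p τ ≤ 67, so |e| ≤ 66.
  startPot : (p N τ : ℚ) → ℚ
  startPot p N τ = ⟦ 34848 ⟧ + budget p N τ

  start-block : ∀ p N τ → 0ℚ ≤ p * τ → p * τ ≤ ⟦ 67 ⟧ → blockPot p N τ 1ℚ ≤ startPot p N τ
  start-block p N τ 0≤pτ pτ≤67 = by-cert _ (start-block-identity p N τ γ) (⟦⟧≥0 8 ⊛ ((⟦⟧≥0 65 ⊕ 0≤pτ) ⊛ diff≥0 pτ≤67))

  budget-step : ∀ {p N τ τ′} → 0ℚ ≤ p → τ ≤ τ′ → startPot p N τ′ ≤ startPot p N τ
  budget-step {p} {N} {τ} {τ′} 0≤p τ≤τ′ = by-cert _ (budget-step-identity p N τ τ′ γ) (γ≥0 ⊛ 0≤p ⊛ (⟦⟧≥0 2 ⊛ diff≥0 τ≤τ′))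

  block-final : ∀ p N τ r → 0ℚ ≤ p → τ ≤ N → (r - p * τ) * (r - p * τ) ≤ ⟦ 4 ⟧ * blockPot p N τ r
  block-final p N τ r 0≤p τ≤N = by-cert _ (block-final-identity p N τ r γ)
      (⟦⟧≥0 31 ⊛ sq≥0 (r - p * τ) ⊕ ⟦⟧≥0 4 ⊛ budget≥0 0≤p τ≤N)

-- The algorithm as a transition function on abstract elements

module Estimator where

  open import Data.Bool.Base using (if_then_else_)
  open import Data.Maybe.Base using (Maybe; just; nothing)
  open import Data.Nat.Base
  open import Data.Nat.Properties using (≤⇒≤ᵇ; ≤ᵇ⇒≤; <⇒≱)
  open import Data.Bool.Properties using (T-≡)
  open import Function.Bundles using (Equivalence)
  open Equivalence using (to; from)

  ≤ᵇ-true : ∀ {m n} → m ≤ n → (m ≤ᵇ n) ≡ true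
  ≤ᵇ-true m≤n = T-≡ .to (≤⇒≤ᵇ m≤n)

  ≤ᵇ-false : ∀ {m n} → n < m → (m ≤ᵇ n) ≡ false
  ≤ᵇ-false {m} {n} n<m with m ≤ᵇ n in eq
  ... | true  = contradiction (≤ᵇ⇒≤ m n (T-≡ .from eq)) (<⇒≱ n<m)
  ... | false = refl

  data Mode : Set where
    startup count up down : Mode

  -- τ is one more than the number of elements read, i the number of arrivals in
  -- the current block, len its planned length, c the number of arrivals above y.
  record St (A : Set) : Set where
    constructor st
    field
      τ i len c : ℕ
      mode      : Mode
      y a b M m : A

  mapSt : {A B : Set} → (A → B) → St A → St B
  mapSt f (st τ i len c mode y a b M m) = st τ i len c mode (f y) (f a) (f b) (f M) (f m)

  initial : {A : Set} → A → St A
  initial z = st 2 0 0 0 startup z z z z z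

  -- `M` and `m` are the extremes of all elements read, `a` and `b` the candidates above and below
  -- `y`. Opening a window resets the candidates to the extremes, so that one exists even if no
  -- arrival falls on its side.
  arrive : {A : Set} → (A → A → Bool) → A → St A → St A
  arrive _≼_ z (st τ i len c mode y a b M m) = st (1 + τ) (1 + i) len
    (if y ≼ z then 1 + c else c) mode y
    (if y ≼ z then (if z ≼ a then z else a) else a)
    (if y ≼ z then b else (if b ≼ z then z else b))
    (if M ≼ z then z else M)
    (if z ≼ m then z else m)

  quotient : ℕ → ℕ → ℕ
  quotient a zero    = 0
  quotient a (suc b) = a / suc b

  countBlock : {A : Set} → St A → St A
  countBlock (st τ i len c mode y a b M m) = st τ 0 (τ / 64) 0 count y a b M m

  window : {A : Set} → Mode → ℕ → St A → St A
  window dir w (st τ i len c mode y a b M m) = st τ 0 w 0 dir y M m M m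

  module Algorithm (N k : ℕ) where

    -- Here q = |c N - k len| and |ê| = τ q / (N len). The test is |ê| ≥ 1024 and the length is 2 τ
    -- / |ê|, rounded only once.
    aim : {A : Set} → Mode → ℕ → St A → St A
    aim dir q σ@(st τ _ len _ _ _ _ _ _ _) =
      if 1024 * (N * len) ≤ᵇ τ * q then window dir (quotient (2 * (N * len)) q) σ else countBlock σ

    boundary : {A : Set} → St A → St A
    -- In startup mode `len` is 0, so every arrival ends a block and `y` follows the maximum.
    boundary (st τ i len c startup y a b M m) =
      if 64 * N ≤ᵇ k * τ then countBlock (st τ i len c startup M a b M m) else st τ i len c startup M a b M m
    boundary σ@(st τ i len c count y a b M m) =
      if k * len ≤ᵇ c * N then aim up (c * N ∸ k * len) σ else aim down (k * len ∸ c * N) σ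
    boundary (st τ i len c up y a b M m)   = countBlock (st τ i len c up a a b M m)
    boundary (st τ i len c down y a b M m) = countBlock (st τ i len c down b a b M m)

    settle : {A : Set} → St A → St A
    settle σ = if St.len σ ≤ᵇ St.i σ then boundary σ else σ

    step : {A : Set} → (A → A → Bool) → A → St A → St A
    step _≼_ z σ = settle (arrive _≼_ z σ)

    push : {A : Set} → (A → A → Bool) → Maybe (St A) → A → Maybe (St A)
    push _≼_ nothing  z = just (initial z)
    push _≼_ (just σ) z = just (step _≼_ z σ)

    module _ {A B : Set} (f : A → B) where

      aim-map : ∀ dir q σ → aim dir q (mapSt f σ) ≡ mapSt f (aim dir q σ)
      aim-map dir q (st τ i len c mode y a b M m) with 1024 * (N * len) ≤ᵇ τ * q
      ... | true  = refl
      ... | false = refl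

      boundary-map : ∀ σ → boundary (mapSt f σ) ≡ mapSt f (boundary σ)
      boundary-map (st τ i len c startup y a b M m) with 64 * N ≤ᵇ k * τ
      ... | true  = refl
      ... | false = refl
      boundary-map σ@(st τ i len c count y a b M m) with k * len ≤ᵇ c * N
      ... | true  = aim-map up (c * N ∸ k * len) σ
      ... | false = aim-map down (k * len ∸ c * N) σ
      boundary-map (st τ i len c up y a b M m)   = refl
      boundary-map (st τ i len c down y a b M m) = refl

      settle-map : ∀ σ → settle (mapSt f σ) ≡ mapSt f (settle σ)
      settle-map σ@(st τ i len c mode y a b M m) with len ≤ᵇ i
      ... | true  = boundary-map σ
      ... | false = refl

      module _ (_≼_ : A → A → Bool) (_⊑_ : B → B → Bool) (compat : ∀ u v → f u ⊑ f v ≡ u ≼ v) where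

        arrive-map : ∀ z σ → arrive _⊑_ (f z) (mapSt f σ) ≡ mapSt f (arrive _≼_ z σ)
        arrive-map z (st τ i len c mode y a b M m)
          rewrite compat y z | compat z a | compat b z | compat M z | compat z m
          with y ≼ z | z ≼ a | b ≼ z | M ≼ z | z ≼ m
        ... | true  | true  | _     | true  | true  = refl
        ... | true  | true  | _     | true  | false = refl
        ... | true  | true  | _     | false | true  = refl
        ... | true  | true  | _     | false | false = refl
        ... | true  | false | _     | true  | true  = refl
        ... | true  | false | _     | true  | false = refl
        ... | true  | false | _     | false | true  = refl
        ... | true  | false | _     | false | false = refl
        ... | false | _     | true  | true  | true  = refl
        ... | false | _     | true  | true  | false = refl
        ... | false | _     | true  | false | true  = refl
        ... | false | _     | true  | false | false = refl
        ... | false | _     | false | true  | true  = refl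
        ... | false | _     | false | true  | false = refl
        ... | false | _     | false | false | true  = refl
        ... | false | _     | false | false | false = refl

        -- The algorithm only moves and compares elements, so it commutes with maps that respect the
        -- comparison. This replaces the stream by indices, and it renumbers the indices when a new
        -- element arrives.
        step-map : ∀ z σ → step _⊑_ (f z) (mapSt f σ) ≡ mapSt f (step _≼_ z σ)
        step-map z σ = trans (cong settle (arrive-map z σ)) (settle-map (arrive _≼_ z σ))

-- Random orderings as sequences of uniform gaps

module RandomOrder where

  open import Defs
  open Estimator
  open RationalLemmas
  open NearestArrival
  open import Data.Bool.Base using (if_then_else_)
  open import Data.Fin.Base using (Fin; zero; suc; toℕ; punchIn)
  open import Data.List.Base as List using (List; []; _∷_; _∷ʳ_; foldl; length; insertAt)
  open import Data.List.Properties using (foldl-∷ʳ; length-++)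
  open import Data.Maybe.Base using (Maybe; just; nothing)
  open import Data.Nat.Base using (_≤ᵇ_)
  open import Data.Rational.Base hiding (_≤ᵇ_)
  open import Data.Rational.Properties
  open import Algebra.Properties.CommutativeMonoid.Sum +-0-commutativeMonoid using (sum; sum-cong-≗; ∑-distrib-+)
  open import Function.Base using (_∘_)

  sum-* : ∀ {n} x (f : Fin n → ℚ) → sum (λ i → x * f i) ≡ x * sum f
  sum-* {zero}  x f = sym (*-zeroʳ x)
  sum-* {suc n} x f = trans (cong (_+_ (x * f zero)) (sum-* x (f ∘ suc))) (sym (*-distribˡ-+ x (f zero) (sum (f ∘ suc))))

  sum-Σ< : ∀ n (f : ℕ → ℚ) → sum {n} (f ∘ toℕ) ≡ Σ< n f
  sum-Σ< zero    f = refl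
  sum-Σ< (suc n) f = trans (cong (f 0 +_) (sum-Σ< n (f ∘ suc))) (sym (Σ<-front n f))

  expectation->>= : {X Y : Set} (v : Y → ℚ) (m : Rand X) (g : X → Rand Y) →
    expectation v (m >>= g) ≡ expectation (λ a → expectation v (g a)) m
  expectation->>= v (return x) g = refl
  expectation->>= v crash      g = refl
  expectation->>= v (draw l f) g = cong (inv (suc l) *_) (sum-cong-≗ λ i → expectation->>= v (f i) g)

  -- The expectation over random orderings, generated from the last element
  -- backwards.
  average : {A : Set} (n : ℕ) → (Fin n → A) → (List A → ℚ) → ℚ
  average zero    x f = f []
  average (suc n) x f = inv (suc n) * sum (λ g → average n (x ∘ punchIn g) (λ l → f (l ∷ʳ x g)))

  length-∷ʳ : {A : Set} (l : List A) (z : A) → length (l ∷ʳ z) ≡ suc (length l)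
  length-∷ʳ l z = trans (length-++ l) (ℕₚ.+-comm (length l) 1)

  average-cong : {A : Set} (n : ℕ) (x : Fin n → A) {f g : List A → ℚ} →
    (∀ l → length l ≡ n → f l ≡ g l) → average n x f ≡ average n x g
  average-cong zero    x h = h [] refl
  average-cong (suc n) x h = cong (inv (suc n) *_) (sum-cong-≗ λ i →
    average-cong n (x ∘ punchIn i) λ l eq → h (l ∷ʳ x i) (trans (length-∷ʳ l (x i)) (cong suc eq)))

  average-* : {A : Set} (n : ℕ) (x : Fin n → A) (a : ℚ) (f : List A → ℚ) →
    average n x (λ l → a * f l) ≡ a * average n x f
  average-* zero    x a f = refl
  average-* (suc n) x a f = trans (cong (inv (suc n) *_)
    (trans (sum-cong-≗ λ i → average-* n (x ∘ punchIn i) a (λ l → f (l ∷ʳ x i)))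
           (sum-* a (λ i → average n (x ∘ punchIn i) (λ l → f (l ∷ʳ x i)))))) (swap (inv (suc n)) a _)
    where
    swap : ∀ a b c → a * (b * c) ≡ b * (a * c)
    swap = solve-∀ ring

  average-+ : {A : Set} (n : ℕ) (x : Fin n → A) (f g : List A → ℚ) →
    average n x (λ l → f l + g l) ≡ average n x f + average n x g
  average-+ zero    x f g = refl
  average-+ (suc n) x f g = trans (cong (inv (suc n) *_)
    (trans (sum-cong-≗ λ i → average-+ n (x ∘ punchIn i) (λ l → f (l ∷ʳ x i)) (λ l → g (l ∷ʳ x i)))
           (∑-distrib-+ (λ i → average n (x ∘ punchIn i) (λ l → f (l ∷ʳ x i)))
               (λ i → average n (x ∘ punchIn i) (λ l → g (l ∷ʳ x i))))))
    (*-distribˡ-+ (inv (suc n)) _ _)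

  insertions : {A : Set} → A → List A → (List A → ℚ) → ℚ
  insertions v ys f = sum (λ i → f (insertAt ys i v))

  insertions-∷ʳ : {A : Set} (v : A) (ys : List A) (z : A) (f : List A → ℚ) →
    insertions v (ys ∷ʳ z) f ≡ insertions v ys (λ l → f (l ∷ʳ z)) + f ((ys ∷ʳ z) ∷ʳ v)
  insertions-∷ʳ v []       z f = rearrange (f (v ∷ z ∷ [])) (f (z ∷ v ∷ []))
    where
    rearrange : ∀ a b → a + (b + 0ℚ) ≡ (a + 0ℚ) + b
    rearrange = solve-∀ ring
  insertions-∷ʳ v (y ∷ ys) z f = trans (cong (_+_ (f (v ∷ y ∷ ys ∷ʳ z))) (insertions-∷ʳ v ys z (λ l → f (y ∷ l))))
    (sym (+-assoc (f (v ∷ y ∷ ys ∷ʳ z)) _ _))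

  inv-cancel : ∀ n x → inv (suc n) * (⟦ suc n ⟧ * x) ≡ x
  inv-cancel n x = trans (sym (*-assoc (inv (suc n)) ⟦ suc n ⟧ x)) (trans (cong (_* x) (inv-* n)) (*-identityˡ x))

  cancel-inv : ∀ n x → ⟦ suc n ⟧ * (inv (suc n) * x) ≡ x
  cancel-inv n x = trans (swap ⟦ suc n ⟧ (inv (suc n)) x) (inv-cancel n x)
    where
    swap : ∀ a b c → a * (b * c) ≡ b * (a * c)
    swap = solve-∀ ring

  -- `shuffle` inserts the head into an ordering of the tail, whereas `average` chooses the last
  -- entry. The choices are exchanged: either the head is inserted before the last entry of the
  -- ordered tail, or it becomes the last entry itself.
  average-insert : {A : Set} (n : ℕ) (x : Fin (suc n) → A) (f : List A → ℚ) →
    average n (x ∘ suc) (λ ys → insertions (x zero) ys f) ≡ ⟦ suc n ⟧ * average (suc n) x f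
  average-insert zero    x f = sym (cancel-inv 0 _)
  average-insert (suc n) x f = begin
    inv (suc n) * sum (λ g → average n (x ∘ suc ∘ punchIn g) (λ l → insertions v (l ∷ʳ x (suc g)) f))
      ≡⟨ cong (inv (suc n) *_) (sum-cong-≗ λ g → trans
           (average-cong n _ λ l _ → insertions-∷ʳ v l (x (suc g)) f)
           (trans (average-+ n _ _ _) (cong (_+ last g) (average-insert n (x ∘ punchIn (suc g)) (λ l → f (l ∷ʳ x (suc g))))))) ⟩
    inv (suc n) * sum (λ g → ⟦ suc n ⟧ * rest g + last g)
      ≡⟨ cong (inv (suc n) *_) (trans (∑-distrib-+ (λ g → ⟦ suc n ⟧ * rest g) last) (cong (_+ sum last) (sum-* ⟦ suc n ⟧ rest))) ⟩
    inv (suc n) * (⟦ suc n ⟧ * sum rest + sum last)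
      ≡⟨ *-distribˡ-+ (inv (suc n)) _ _ ⟩
    inv (suc n) * (⟦ suc n ⟧ * sum rest) + inv (suc n) * sum last
      ≡⟨ cong (_+ inv (suc n) * sum last) (inv-cancel n (sum rest)) ⟩
    sum rest + inv (suc n) * sum last
      ≡⟨ +-comm (sum rest) _ ⟩
    inv (suc n) * sum last + sum rest
      ≡⟨ cancel-inv (suc n) _ ⟨
    ⟦ suc (suc n) ⟧ * average (suc (suc n)) x f
      ∎
    where
    open ≡-Reasoning
    v = x zero
    rest last : Fin (suc n) → ℚ
    rest g = average (suc n) (x ∘ punchIn (suc g)) (λ l → f (l ∷ʳ x (suc g)))
    last g = average n (x ∘ suc ∘ punchIn g) (λ l → f ((l ∷ʳ x (suc g)) ∷ʳ v))

  expectation-shuffle : {A : Set} (n : ℕ) (x : Fin n → A) (f : List A → ℚ) →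
    expectation f (shuffle (List.tabulate x)) ≡ average n x f
  expectation-shuffle zero    x f = refl
  expectation-shuffle (suc n) x f = begin
    expectation f (shuffle (List.tabulate x))
      ≡⟨ expectation->>= f (shuffle (List.tabulate (x ∘ suc))) _ ⟩
    expectation (λ ys → inv (suc (length ys)) * insertions (x zero) ys f) (shuffle (List.tabulate (x ∘ suc)))
      ≡⟨ expectation-shuffle n (x ∘ suc) _ ⟩
    average n (x ∘ suc) (λ ys → inv (suc (length ys)) * insertions (x zero) ys f)
      ≡⟨ average-cong n (x ∘ suc) (λ l eq → cong (λ m → inv (suc m) * insertions (x zero) l f) eq) ⟩
    average n (x ∘ suc) (λ ys → inv (suc n) * insertions (x zero) ys f)
      ≡⟨ average-* n (x ∘ suc) (inv (suc n)) _ ⟩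
    inv (suc n) * average n (x ∘ suc) (λ ys → insertions (x zero) ys f)
      ≡⟨ cong (inv (suc n) *_) (average-insert n x f) ⟩
    inv (suc n) * (⟦ suc n ⟧ * average (suc n) x f)
      ≡⟨ inv-cancel n _ ⟩
    average (suc n) x f
      ∎
    where open ≡-Reasoning

  -- The index, counted from the largest element, of an earlier element after an
  -- arrival at index g.
  lift : ℕ → ℕ → ℕ
  lift g j = if g ≤ᵇ j then suc j else j

  toℕ-punchIn : ∀ {n} (g : Fin (suc n)) (j : Fin n) → toℕ (punchIn g j) ≡ lift (toℕ g) (toℕ j)
  toℕ-punchIn zero    j       = refl
  toℕ-punchIn (suc g) zero    = refl
  toℕ-punchIn (suc g) (suc j) = trans (cong suc (toℕ-punchIn g j)) (lift-suc (toℕ g) (toℕ j))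
    where
    lift-suc : ∀ g j → suc (lift g j) ≡ lift (suc g) (suc j)
    lift-suc zero    j = refl
    lift-suc (suc g) j with g ℕ.<ᵇ j
    ... | true  = refl
    ... | false = refl

  infix 5 _≽_ _≽ᶠ_

  _≽_ : ℕ → ℕ → Bool
  u ≽ v = v ≤ᵇ u

  _≽ᶠ_ : ∀ {n} → Fin n → Fin n → Bool
  u ≽ᶠ v = toℕ u ≽ toℕ v

  lift-above : ∀ {g j} → g ℕ.≤ j → lift g j ≡ suc j
  lift-above g≤j rewrite ≤ᵇ-true g≤j = refl

  lift-below : ∀ {g j} → j ℕ.< g → lift g j ≡ j
  lift-below j<g rewrite ≤ᵇ-false j<g = refl

  lift-≽ : ∀ g u v → lift g u ≽ lift g v ≡ u ≽ v
  lift-≽ g u v with g ℕₚ.≤? u | g ℕₚ.≤? v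
  ... | yes g≤u | yes g≤v rewrite lift-above g≤u | lift-above g≤v = ≤ᵇ-suc v u
    where
    ≤ᵇ-suc : ∀ m n → (suc m ≤ᵇ suc n) ≡ (m ≤ᵇ n)
    ≤ᵇ-suc zero    n = refl
    ≤ᵇ-suc (suc m) n = refl
  ... | yes g≤u | no  g≰v rewrite lift-above g≤u | lift-below (ℕₚ.≰⇒> g≰v) =
    trans (≤ᵇ-true (ℕₚ.m≤n⇒m≤1+n v≤u)) (sym (≤ᵇ-true v≤u))
    where
    v≤u : v ℕ.≤ u
    v≤u = ℕₚ.≤-trans (ℕₚ.<⇒≤ (ℕₚ.≰⇒> g≰v)) g≤u
  ... | no  g≰u | yes g≤v rewrite lift-below (ℕₚ.≰⇒> g≰u) | lift-above g≤v =
    trans (≤ᵇ-false (ℕₚ.m<n⇒m<1+n u<v)) (sym (≤ᵇ-false u<v))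
    where
    u<v : u ℕ.< v
    u<v = ℕₚ.<-≤-trans (ℕₚ.≰⇒> g≰u) g≤v
  ... | no  g≰u | no  g≰v rewrite lift-below (ℕₚ.≰⇒> g≰u) | lift-below (ℕₚ.≰⇒> g≰v) = refl

  module Ranks (N k : ℕ) where
    open Algorithm N k

    -- Elements are named by their index among those read so far. Given the index g of the latest
    -- arrival, the earlier ones are still in uniformly random order, and `punchIn g` turns their
    -- old indices into the new ones.
    rankAverageᶠ : (n : ℕ) → (St (Fin (suc n)) → ℚ) → ℚ
    rankAverageᶠ zero    f = f (initial zero)
    rankAverageᶠ (suc n) f =
      inv (suc (suc n)) * sum (λ g → rankAverageᶠ n (λ σ → f (step _≽ᶠ_ g (mapSt (punchIn g) σ))))

    rankAverage : (n : ℕ) → (St ℕ → ℚ) → ℚ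
    rankAverage zero    f = f (initial 0)
    rankAverage (suc n) f =
      inv (suc (suc n)) * Σ< (suc (suc n)) (λ g → rankAverage n (λ σ → f (step _≽_ g (mapSt (lift g) σ))))

    rankAverageᶠ-cong : ∀ n {f g : St (Fin (suc n)) → ℚ} → (∀ σ → f σ ≡ g σ) → rankAverageᶠ n f ≡ rankAverageᶠ n g
    rankAverageᶠ-cong zero    h = h _
    rankAverageᶠ-cong (suc n) h = cong (inv (suc (suc n)) *_)
        (sum-cong-≗ λ g → rankAverageᶠ-cong n λ σ → h (step _≽ᶠ_ g (mapSt (punchIn g) σ)))

    rankAverage-toℕ : ∀ n (f : St ℕ → ℚ) → rankAverageᶠ n (λ σ → f (mapSt toℕ σ)) ≡ rankAverage n f
    rankAverage-toℕ zero    f = refl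
    rankAverage-toℕ (suc n) f = cong (inv (suc (suc n)) *_) (trans
      (sum-cong-≗ λ g → trans
        (rankAverageᶠ-cong n λ σ → cong f (trans (sym (step-map toℕ _≽ᶠ_ _≽_ (λ _ _ → refl) g (mapSt (punchIn g) σ)))
                                                  (cong (step _≽_ (toℕ g)) (lift-map g σ))))
        (rankAverage-toℕ n (λ σ → f (step _≽_ (toℕ g) (mapSt (lift (toℕ g)) σ)))))
      (sum-Σ< (suc (suc n)) _))
      where
      lift-map : ∀ {n} (g : Fin (suc n)) σ → mapSt toℕ (mapSt (punchIn g) σ) ≡ mapSt (lift (toℕ g)) (mapSt toℕ σ)
      lift-map g (st τ i len c mode y a b M m)
        rewrite toℕ-punchIn g y | toℕ-punchIn g a | toℕ-punchIn g b | toℕ-punchIn g M | toℕ-punchIn g m = refl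

    module _ {A : Set} (_≼_ : A → A → Bool) where

      average-run : ∀ n (x : Fin (suc n) → A) → (∀ u v → (x u ≼ x v) ≡ (u ≽ᶠ v)) → (F : Maybe (St A) → ℚ) →
        average (suc n) x (λ l → F (foldl (push _≼_) nothing l)) ≡ rankAverageᶠ n (λ σ → F (just (mapSt x σ)))
      average-run zero    x compat F = trans (cong (inv 1 *_) (+-identityʳ (F (just (initial (x zero))))))
          (*-identityˡ (F (just (initial (x zero)))))
      average-run (suc n) x compat F = cong (inv (suc (suc n)) *_) (sum-cong-≗ λ g → trans
        (average-cong (suc n) (x ∘ punchIn g) λ l _ → cong F (foldl-∷ʳ (push _≼_) nothing (x g) l))
        (trans (average-run n (x ∘ punchIn g) (compat-punchIn g) (λ σ → F (push _≼_ σ (x g))))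
               (rankAverageᶠ-cong n λ σ → cong (F ∘ just) (step-map x _≽ᶠ_ _≼_ compat g (mapSt (punchIn g) σ)))))
        where
        punchIn-≽ : ∀ (g : Fin (suc (suc n))) u v → punchIn g u ≽ᶠ punchIn g v ≡ u ≽ᶠ v
        punchIn-≽ g u v rewrite toℕ-punchIn g u | toℕ-punchIn g v = lift-≽ (toℕ g) (toℕ u) (toℕ v)
        compat-punchIn : ∀ (g : Fin (suc (suc n))) u v → (x (punchIn g u) ≼ x (punchIn g v)) ≡ (u ≽ᶠ v)
        compat-punchIn g u v = trans (compat (punchIn g u) (punchIn g v)) (punchIn-≽ g u v)

    rankAverage-cong : ∀ m {f g : St ℕ → ℚ} → (∀ σ → f σ ≡ g σ) → rankAverage m f ≡ rankAverage m g
    rankAverage-cong zero    h = h (initial 0)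
    rankAverage-cong (suc m) h = cong (inv (suc (suc m)) *_) (Σ<-cong (suc (suc m)) λ g _ →
      rankAverage-cong m λ σ → h (step _≽_ g (mapSt (lift g) σ)))

    rankAverage-+ : ∀ m (f g : St ℕ → ℚ) → rankAverage m (λ σ → f σ + g σ) ≡ rankAverage m f + rankAverage m g
    rankAverage-+ zero    f g = refl
    rankAverage-+ (suc m) f g = trans (cong (inv (suc (suc m)) *_)
      (trans (Σ<-cong (suc (suc m)) λ j _ → rankAverage-+ m (λ σ → f (step _≽_ j (mapSt (lift j) σ)))
          (λ σ → g (step _≽_ j (mapSt (lift j) σ))))
             (Σ<-+ (suc (suc m)) _ _)))
      (*-distribˡ-+ (inv (suc (suc m))) _ _)

    rankAverage-0 : ∀ m → rankAverage m (λ _ → 0ℚ) ≡ 0ℚ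
    rankAverage-0 zero    = refl
    rankAverage-0 (suc m) = trans (cong (inv (suc (suc m)) *_)
      (trans (Σ<-cong (suc (suc m)) λ _ _ → rankAverage-0 m) (trans (Σ<-const (suc (suc m)) 0ℚ) (*-zeroʳ ⟦ suc (suc m) ⟧))))
      (*-zeroʳ (inv (suc (suc m))))

    rankAverage-* : ∀ m a (f : St ℕ → ℚ) → rankAverage m (λ σ → a * f σ) ≡ a * rankAverage m f
    rankAverage-* zero    a f = refl
    rankAverage-* (suc m) a f = trans (cong (inv (suc (suc m)) *_)
      (trans (Σ<-cong (suc (suc m)) λ g _ → rankAverage-* m a (λ σ → f (step _≽_ g (mapSt (lift g) σ))))
          (Σ<-* (suc (suc m)) a _)))
      (swap (inv (suc (suc m))) a _)
      where
      swap : ∀ a b c → a * (b * c) ≡ b * (a * c)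
      swap = solve-∀ ring

    rankAverage-Σ : ∀ m n (F : ℕ → St ℕ → ℚ) → Σ< n (λ g → rankAverage m (F g)) ≡ rankAverage m (λ σ → Σ< n (λ g → F g σ))
    rankAverage-Σ m zero    F = sym (rankAverage-0 m)
    rankAverage-Σ m (suc n) F = trans (cong (_+ rankAverage m (F n)) (rankAverage-Σ m n F)) (sym (rankAverage-+ m _ (F n)))

-- Effect of one arrival on ranks and distances

module GapArrivals where

  open Estimator
  open RationalLemmas
  open NearestArrival
  open RandomOrder
  open import Data.Bool.Base using (if_then_else_)
  open import Data.Nat.Base using (_≤ᵇ_)
  open import Data.Rational.Base hiding (_≤ᵇ_)
  open import Data.Rational.Properties

  -- Index 0 is the largest of the t elements read, so the rank of y is `suc y` and the minimum has
  -- index t - 1.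
  record Position (t τ y M m : ℕ) : Set where
    constructor position
    field
      τ≡  : τ ≡ suc t
      M≡0 : M ≡ 0
      m≡  : suc m ≡ t
      y<t : y ℕ.< t

  -- In terms of the index before the arrival, exactly the gaps 0, ..., y lie above y, as many as
  -- its rank.
  new-above : ∀ g y → (lift g y ≽ g) ≡ (g ≤ᵇ y)
  new-above g y with g ℕₚ.≤? y
  ... | yes g≤y rewrite lift-above g≤y | ≤ᵇ-true g≤y = ≤ᵇ-true (ℕₚ.m≤n⇒m≤1+n g≤y)
  ... | no  g≰y rewrite lift-below (ℕₚ.≰⇒> g≰y) = refl

  new-below : ∀ g y → (g ≽ lift g y) ≡ (suc y ≤ᵇ g)
  new-below g y with g ℕₚ.≤? y
  ... | yes g≤y rewrite lift-above g≤y = refl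
  ... | no  g≰y rewrite lift-below (ℕₚ.≰⇒> g≰y) = trans (≤ᵇ-true (ℕₚ.<⇒≤ (ℕₚ.≰⇒> g≰y))) (sym (≤ᵇ-true (ℕₚ.≰⇒> g≰y)))

  lift-< : ∀ {g y t} → y ℕ.< t → lift g y ℕ.< suc t
  lift-< {g} {y} y<t with g ≤ᵇ y
  ... | true  = s≤s y<t
  ... | false = ℕₚ.m<n⇒m<1+n y<t

  arrive-position : ∀ {t τ y M m} g → g ℕ.≤ t → Position t τ y M m →
    Position (suc t) (suc τ) (lift g y) (if lift g M ≽ g then g else lift g M) (if g ≽ lift g m then g else lift g m)
  arrive-position {t} {τ} {y} {M} {m} g g≤t (position τ≡ refl refl y<t) = position (cong suc τ≡) (M′≡0 g) m′≡ (lift-< {g} y<t)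
    where
    M′≡0 : ∀ g → (if lift g 0 ≽ g then g else lift g 0) ≡ 0
    M′≡0 zero    = refl
    M′≡0 (suc g) = refl
    m′≡ : suc (if g ≽ lift g m then g else lift g m) ≡ suc (suc m)
    m′≡ rewrite new-below g m with g ℕₚ.≤? m
    ... | yes g≤m rewrite ≤ᵇ-false (s≤s g≤m) | lift-above g≤m = refl
    ... | no  g≰m rewrite ≤ᵇ-true (ℕₚ.≰⇒> g≰m) = cong suc (ℕₚ.≤-antisym g≤t (ℕₚ.≰⇒> g≰m))

  if-≤ : ∀ {A : Set} {x y : A} {g j} → g ℕ.≤ j → (if g ≤ᵇ j then x else y) ≡ x
  if-≤ g≤j rewrite ≤ᵇ-true g≤j = refl

  if-> : ∀ {A : Set} {x y : A} {g j} → j ℕ.< g → (if g ≤ᵇ j then x else y) ≡ y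
  if-> j<g rewrite ≤ᵇ-false j<g = refl

  ⟦⟧-∸ : ∀ {m n} → m ℕ.≤ n → ⟦ n ℕ.∸ m ⟧ ≡ ⟦ n ⟧ - ⟦ m ⟧
  ⟦⟧-∸ {m} {n} m≤n = trans (cancel ⟦ n ℕ.∸ m ⟧ ⟦ m ⟧)
      (cong (_- ⟦ m ⟧) (trans (sym (⟦⟧-+ (n ℕ.∸ m) m)) (cong ⟦_⟧ (ℕₚ.m∸n+n≡m m≤n))))
    where
    cancel : ∀ a b → a ≡ a + b - b
    cancel = solve-∀ ring

  Σ<-cases : ∀ n y (A B : ℚ) → y ℕ.< n → Σ< n (λ g → if g ≤ᵇ y then A else B) ≡ ⟦ suc y ⟧ * A + (⟦ n ⟧ - ⟦ suc y ⟧) * B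
  Σ<-cases n y A B y<n = begin
    Σ< n f                                                    ≡⟨ cong (λ n → Σ< n f) (ℕₚ.m∸n+n≡m y<n) ⟨
    Σ< (n ℕ.∸ suc y ℕ.+ suc y) f                              ≡⟨ Σ<-split (suc y) (n ℕ.∸ suc y) f ⟩
    Σ< (suc y) f + Σ< (n ℕ.∸ suc y) (λ i → f (i ℕ.+ suc y))   ≡⟨ cong₂ _+_
      (trans (Σ<-cong (suc y) λ i i≤y → if-≤ (ℕₚ.≤-pred i≤y)) (Σ<-const (suc y) A))
      (trans (Σ<-cong (n ℕ.∸ suc y) λ i _ → if-> (ℕₚ.m≤n+m (suc y) i)) (Σ<-const (n ℕ.∸ suc y) B)) ⟩
    ⟦ suc y ⟧ * A + ⟦ n ℕ.∸ suc y ⟧ * B                       ≡⟨ cong (λ x → ⟦ suc y ⟧ * A + x * B) (⟦⟧-∸ y<n) ⟩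
    ⟦ suc y ⟧ * A + (⟦ n ⟧ - ⟦ suc y ⟧) * B                   ∎
    where
    open ≡-Reasoning
    f = λ g → if g ≤ᵇ y then A else B

  module _ (y g : ℕ) where

    counted : ℕ → ℕ
    counted c = if lift g y ≽ g then 1 ℕ.+ c else c

    counted-if : ∀ {A : Set} (f : ℕ → A) c → f (counted c) ≡ (if g ≤ᵇ y then f (suc c) else f c)
    counted-if f c rewrite new-above g y with g ≤ᵇ y
    ... | true  = refl
    ... | false = refl

    counted-rank : ∀ r c → suc y ≡ r ℕ.+ c → suc (lift g y) ≡ r ℕ.+ counted c
    counted-rank r c eq rewrite new-above g y with g ≤ᵇ y
    ... | true  = trans (cong suc eq) (sym (ℕₚ.+-suc r c))
    ... | false = eq

    counted-≤ : ∀ c i → c ℕ.≤ i → counted c ℕ.≤ suc i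
    counted-≤ c i c≤i rewrite new-above g y with g ≤ᵇ y
    ... | true  = s≤s c≤i
    ... | false = ℕₚ.m≤n⇒m≤1+n c≤i

    risen : ℕ → ℕ
    risen a = if lift g y ≽ g then (if g ≽ lift g a then g else lift g a) else lift g a

    -- Only an arrival strictly between the candidate and y changes the distance. It then becomes
    -- the candidate, and y itself has moved to index `suc y`.
    rising-gap : ℕ → ℕ → ℕ
    rising-gap d a = if g ≤ᵇ a then d else if g ≤ᵇ y then suc y ℕ.∸ g else d

    risen-gap : ∀ d a → y ≡ d ℕ.+ a → lift g y ≡ rising-gap d a ℕ.+ risen a
    risen-gap d a refl rewrite new-above g y | new-below g a with g ℕₚ.≤? a
    ... | yes g≤a rewrite ≤ᵇ-true g≤a | ≤ᵇ-false (s≤s g≤a)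
                        | ≤ᵇ-true (ℕₚ.≤-trans g≤a (ℕₚ.m≤n+m a d)) = sym (ℕₚ.+-suc d a)
    ... | no  g≰a rewrite ≤ᵇ-false (ℕₚ.≰⇒> g≰a) | ≤ᵇ-true (ℕₚ.≰⇒> g≰a) with g ℕₚ.≤? y
    ...   | yes g≤y rewrite ≤ᵇ-true g≤y = sym (ℕₚ.m∸n+n≡m (ℕₚ.m≤n⇒m≤1+n g≤y))
    ...   | no  g≰y rewrite ≤ᵇ-false (ℕₚ.≰⇒> g≰y) = refl

    fallen : ℕ → ℕ
    fallen b = if lift g y ≽ g then lift g b else (if lift g b ≽ g then g else lift g b)

    -- An arrival below y leaves its index alone, hence no shift in `g ℕ.∸ y`, unlike in
    -- `rising-gap`.
    falling-gap : ℕ → ℕ → ℕ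
    falling-gap d b = if g ≤ᵇ y then d else if g ≤ᵇ b then g ℕ.∸ y else d

    fallen-gap : ∀ d b → b ≡ d ℕ.+ y → fallen b ≡ falling-gap d b ℕ.+ lift g y
    fallen-gap d b refl rewrite new-above g y | new-above g (d ℕ.+ y) with g ℕₚ.≤? y
    ... | yes g≤y rewrite ≤ᵇ-true g≤y | ≤ᵇ-true (ℕₚ.≤-trans g≤y (ℕₚ.m≤n+m y d)) = sym (ℕₚ.+-suc d y)
    ... | no  g≰y rewrite ≤ᵇ-false (ℕₚ.≰⇒> g≰y) with g ℕₚ.≤? d ℕ.+ y
    ...   | yes g≤b rewrite ≤ᵇ-true g≤b = sym (ℕₚ.m∸n+n≡m (ℕₚ.<⇒≤ (ℕₚ.≰⇒> g≰y)))
    ...   | no  g≰b rewrite ≤ᵇ-false (ℕₚ.≰⇒> g≰b) = refl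

    fallen-< : ∀ {t} b → g ℕ.≤ t → b ℕ.< t → fallen b ℕ.< suc t
    fallen-< {t} b g≤t b<t with lift g y ≽ g | lift g b ≽ g
    ... | true  | _     = lift-< {g} b<t
    ... | false | true  = s≤s g≤t
    ... | false | false = lift-< {g} b<t

  Σ<-three : ∀ n a d (f : ℕ → ℚ) (A B : ℚ) → d ℕ.+ a ℕ.< n →
    (∀ g → g ℕ.≤ a → f g ≡ A) → (∀ g → d ℕ.+ a ℕ.< g → f g ≡ B) →
    Σ< n f ≡ ⟦ suc a ⟧ * A + Σ< d (λ i → f (i ℕ.+ suc a)) + (⟦ n ⟧ - ⟦ suc (d ℕ.+ a) ⟧) * B
  Σ<-three n a d f A B d+a<n lo hi = begin
    Σ< n f
      ≡⟨ cong (λ n → Σ< n f) (ℕₚ.m∸n+n≡m d+a<n) ⟨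
    Σ< (n ℕ.∸ suc (d ℕ.+ a) ℕ.+ suc (d ℕ.+ a)) f
      ≡⟨ Σ<-split (suc (d ℕ.+ a)) (n ℕ.∸ suc (d ℕ.+ a)) f ⟩
    Σ< (suc (d ℕ.+ a)) f + Σ< (n ℕ.∸ suc (d ℕ.+ a)) (λ i → f (i ℕ.+ suc (d ℕ.+ a)))
      ≡⟨ cong₂ _+_ (trans (cong (λ m → Σ< m f) (sym (ℕₚ.+-suc d a))) (Σ<-split (suc a) d f))
                   (trans (Σ<-cong (n ℕ.∸ suc (d ℕ.+ a)) λ i _ → hi _ (ℕₚ.m≤n+m (suc (d ℕ.+ a)) i))
                       (Σ<-const (n ℕ.∸ suc (d ℕ.+ a)) B)) ⟩
    Σ< (suc a) f + Σ< d (λ i → f (i ℕ.+ suc a)) + ⟦ n ℕ.∸ suc (d ℕ.+ a) ⟧ * B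
      ≡⟨ cong₂ (λ x y → x + Σ< d (λ i → f (i ℕ.+ suc a)) + y * B)
           (trans (Σ<-cong (suc a) λ g g≤a → lo g (ℕₚ.≤-pred g≤a)) (Σ<-const (suc a) A)) (⟦⟧-∸ d+a<n) ⟩
    ⟦ suc a ⟧ * A + Σ< d (λ i → f (i ℕ.+ suc a)) + (⟦ n ⟧ - ⟦ suc (d ℕ.+ a) ⟧) * B
      ∎
    where open ≡-Reasoning

  private
    collect : ∀ n a d (A S : ℚ) → ⟦ suc a ⟧ * A + S + (⟦ n ⟧ - ⟦ suc (d ℕ.+ a) ⟧) * A ≡ (⟦ n ⟧ - ⟦ d ⟧) * A + S
    collect n a d A S = trans (cong (λ x → ⟦ suc a ⟧ * A + S + (⟦ n ⟧ - x) * A)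
        (trans (cong ⟦_⟧ (sym (ℕₚ.+-suc d a))) (⟦⟧-+ d (suc a))))
      (eq ⟦ n ⟧ ⟦ suc a ⟧ ⟦ d ⟧ A S)
      where
      eq : ∀ n a d A S → a * A + S + (n - (d + a)) * A ≡ (n - d) * A + S
      eq = solve-∀ ring

  Σ<-reverse : ∀ d (f : ℕ → ℚ) → Σ< d (λ i → f (d ℕ.∸ i)) ≡ Σ< d (λ i → f (suc i))
  Σ<-reverse zero    f = refl
  Σ<-reverse (suc d) f = trans (Σ<-front d _) (trans (cong (f (suc d) +_) (Σ<-reverse d f)) (+-comm (f (suc d)) _))

  -- The d gaps inside the interval produce each of the distances 1, ..., d exactly once, and all
  -- others keep d. The right-hand side has the shape of the left-hand side of `gapCost-step`.
  Σ<-rising : ∀ n y d a (F : ℕ → ℚ) → y ≡ d ℕ.+ a → y ℕ.< n →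
    Σ< n (λ g → F (rising-gap y g d a)) ≡ (⟦ n ⟧ - ⟦ d ⟧) * F d + Σ< d (λ i → F (suc i))
  Σ<-rising n y d a F refl y<n = trans
    (Σ<-three n a d (λ g → F (rising-gap y g d a)) (F d) (F d) y<n
      (λ g g≤a → cong F (if-≤ g≤a))
      (λ g y<g → cong F (trans (if-> (ℕₚ.≤-<-trans (ℕₚ.m≤n+m a d) y<g)) (if-> y<g))))
    (trans (cong (λ S → ⟦ suc a ⟧ * F d + S + (⟦ n ⟧ - ⟦ suc (d ℕ.+ a) ⟧) * F d)
      (trans (Σ<-cong d λ i i<d → cong F (trans (if-> (ℕₚ.m≤n+m (suc a) i)) (trans (if-≤ (in-gap i<d)) (distance i))))
             (Σ<-reverse d F)))
      (collect n a d (F d) _))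
    where
    in-gap : ∀ {i} → i ℕ.< d → i ℕ.+ suc a ℕ.≤ d ℕ.+ a
    in-gap {i} i<d = subst (ℕ._≤ d ℕ.+ a) (sym (ℕₚ.+-suc i a)) (ℕₚ.+-monoˡ-≤ a i<d)
    distance : ∀ i → suc (d ℕ.+ a) ℕ.∸ (i ℕ.+ suc a) ≡ d ℕ.∸ i
    distance i = trans (cong₂ ℕ._∸_ (cong suc (ℕₚ.+-comm d a)) (ℕₚ.+-comm i (suc a))) (ℕₚ.[m+n]∸[m+o]≡n∸o (suc a) d i)

  Σ<-falling : ∀ n y d b (F : ℕ → ℚ) → b ≡ d ℕ.+ y → b ℕ.< n →
    Σ< n (λ g → F (falling-gap y g d b)) ≡ (⟦ n ⟧ - ⟦ d ⟧) * F d + Σ< d (λ i → F (suc i))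
  Σ<-falling n y d b F refl b<n = trans
    (Σ<-three n y d (λ g → F (falling-gap y g d b)) (F d) (F d) b<n
      (λ g g≤y → cong F (if-≤ g≤y))
      (λ g b<g → cong F (trans (if-> (ℕₚ.≤-<-trans (ℕₚ.m≤n+m y d) b<g)) (if-> b<g))))
    (trans (cong (λ S → ⟦ suc y ⟧ * F d + S + (⟦ n ⟧ - ⟦ suc (d ℕ.+ y) ⟧) * F d)
      (Σ<-cong d λ i i<d → cong F (trans (if-> (ℕₚ.m≤n+m (suc y) i)) (trans (if-≤ (in-gap i<d)) (distance i)))))
      (collect n y d (F d) _))
    where
    in-gap : ∀ {i} → i ℕ.< d → i ℕ.+ suc y ℕ.≤ d ℕ.+ y
    in-gap {i} i<d = subst (ℕ._≤ d ℕ.+ y) (sym (ℕₚ.+-suc i y)) (ℕₚ.+-monoˡ-≤ y i<d)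
    distance : ∀ i → (i ℕ.+ suc y) ℕ.∸ y ≡ suc i
    distance i = trans (cong (ℕ._∸ y) (ℕₚ.+-suc i y)) (ℕₚ.m+n∸n≡m (suc i) y)

-- Rounding of the window length

module WindowLength where

  open Estimator
  open RationalLemmas
  open import Data.Rational.Base
  open import Data.Rational.Properties

  -- `h` stands for |ê| and `suc x` for `N * len`, as a successor so that it can be cancelled.
  module _ (x τ q : ℕ) (h : ℚ) (h≡ : ⟦ suc x ⟧ * h ≡ ⟦ τ ⟧ * ⟦ q ⟧) where

    estimate≥0 : 0ℚ ≤ h
    estimate≥0 = *-cancel-≥1 x (subst₂ _≤_ (sym (*-zeroʳ ⟦ suc x ⟧)) (sym h≡) (⟦⟧≥0 τ ⊛ ⟦⟧≥0 q))

    estimate-small : τ ℕ.* q ℕ.< 1024 ℕ.* suc x → h * h ≤ ⟦ 1048576 ⟧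
    estimate-small small = by-cert _ (eq h) (diff≥0 h≤ ⊛ (⟦⟧≥0 1024 ⊕ estimate≥0))
      where
      h≤ : h ≤ ⟦ 1024 ⟧
      h≤ = *-cancel-≥1 x (subst₂ _≤_ (trans (⟦⟧-* τ q) (sym h≡)) (trans (⟦⟧-* 1024 (suc x)) (*-comm ⟦ 1024 ⟧ ⟦ suc x ⟧))
          (⟦⟧-mono (ℕₚ.<⇒≤ small)))
      eq : ∀ h → ⟦ 1048576 ⟧ - h * h ≡ (⟦ 1024 ⟧ - h) * (⟦ 1024 ⟧ + h)
      eq = solve-∀ ring

    module _ (large : 1024 ℕ.* suc x ℕ.≤ τ ℕ.* q) (q≤ : q ℕ.≤ suc x) where

      private
        w : ℕ
        w = quotient (2 ℕ.* suc x) q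

        q>0 : 0 ℕ.< q
        q>0 = ℕₚ.n≢0⇒n>0 λ { refl → contradiction (subst (1024 ℕ.* suc x ℕ.≤_) (ℕₚ.*-zeroʳ τ) large) λ () }

      quotient-bounds : ∀ {q} → 0 ℕ.< q → quotient (2 ℕ.* suc x) q ℕ.* q ℕ.≤ 2 ℕ.* suc x
                                        × 2 ℕ.* suc x ℕ.< suc (quotient (2 ℕ.* suc x) q) ℕ.* q
      quotient-bounds {suc q} _ = ℕᵈ.m/n*n≤m (2 ℕ.* suc x) (suc q) ,
        subst (ℕ._< suc (2 ℕ.* suc x ℕ./ suc q) ℕ.* suc q) (sym (ℕᵈ.m≡m%n+[m/n]*n (2 ℕ.* suc x) (suc q)))
          (ℕₚ.+-monoˡ-< (2 ℕ.* suc x ℕ./ suc q ℕ.* suc q) (ℕᵈ.m%n<n (2 ℕ.* suc x) (suc q)))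

      private
        lo : w ℕ.* q ℕ.≤ 2 ℕ.* suc x
        lo = proj₁ (quotient-bounds q>0)
        hi : 2 ℕ.* suc x ℕ.< suc w ℕ.* q
        hi = proj₂ (quotient-bounds q>0)

      window≥2 : 2 ℕ.≤ w
      window≥2 = ℕₚ.≤-pred (ℕₚ.*-cancelʳ-< q 2 (suc w) (ℕₚ.≤-<-trans (ℕₚ.*-monoʳ-≤ 2 q≤) hi))

      -- The threshold 1024 yields w ≤ 2 τ / |ê| ≤ τ / 512. Then κ = 1 / (512 w) satisfies κ τ ≥ 1
      -- although v = κ s never exceeds 1 / 512.
      window-short : 512 ℕ.* w ℕ.≤ τ
      window-short = ℕₚ.*-cancelʳ-≤ (512 ℕ.* w) τ q {{ℕ.>-nonZero q>0}} (ℕₚ.≤-trans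
        (subst₂ ℕ._≤_ (sym (ℕₚ.*-assoc 512 w q)) (sym (ℕₚ.*-assoc 512 2 (suc x))) (ℕₚ.*-monoʳ-≤ 512 lo)) large)

      -- The mean distance m that this window length realises is close to half of h.
      window-mean : ∃[ m ] ⟦ suc w ⟧ * m ≡ ⟦ τ ⟧ + ⟦ w ⟧ × ⟦ 2 ⟧ * m ≤ h + ⟦ 2 ⟧ × h ≤ ⟦ 3 ⟧ * m
      window-mean = m , m≡ , *-cancel-≥1 w upper , *-cancel-≥1 1 (*-cancel-≥1 w lower)
        where
        m : ℚ
        m = inv (suc w) * (⟦ τ ⟧ + ⟦ w ⟧)
        m≡ : ⟦ suc w ⟧ * m ≡ ⟦ τ ⟧ + ⟦ w ⟧
        m≡ = trans (swap ⟦ suc w ⟧ (inv (suc w)) (⟦ τ ⟧ + ⟦ w ⟧)) (trans (cong (_* (⟦ τ ⟧ + ⟦ w ⟧)) (inv-* w)) (*-identityˡ _))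
          where
          swap : ∀ a b c → a * (b * c) ≡ b * a * c
          swap = solve-∀ ring
        scaled : ∀ z → ⟦ suc x ⟧ * (⟦ z ⟧ * h) ≡ ⟦ τ ⟧ * ⟦ z ℕ.* q ⟧
        scaled z = trans (swap ⟦ suc x ⟧ ⟦ z ⟧ h) (trans (cong (⟦ z ⟧ *_) h≡)
            (trans (swap ⟦ z ⟧ ⟦ τ ⟧ ⟦ q ⟧) (cong (⟦ τ ⟧ *_) (sym (⟦⟧-* z q)))))
          where
          swap : ∀ a b c → a * (b * c) ≡ b * (a * c)
          swap = solve-∀ ring
        2τX : ⟦ τ ⟧ * ⟦ 2 ℕ.* suc x ⟧ ≡ ⟦ suc x ⟧ * (⟦ 2 ⟧ * ⟦ τ ⟧)
        2τX = trans (cong (⟦ τ ⟧ *_) (⟦⟧-* 2 (suc x))) (swap ⟦ τ ⟧ ⟦ suc x ⟧)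
          where
          swap : ∀ t x → t * (⟦ 2 ⟧ * x) ≡ x * (⟦ 2 ⟧ * t)
          swap = solve-∀ ring
        2τ≤ : ⟦ 2 ⟧ * ⟦ τ ⟧ ≤ ⟦ suc w ⟧ * h
        2τ≤ = *-cancel-≥1 x (subst₂ _≤_ 2τX (sym (scaled (suc w))) (*-mono-≥0 (⟦⟧≥0 τ) (⟦⟧-mono (ℕₚ.<⇒≤ hi))))
        ≤2τ : ⟦ w ⟧ * h ≤ ⟦ 2 ⟧ * ⟦ τ ⟧
        ≤2τ = *-cancel-≥1 x (subst₂ _≤_ (sym (scaled w)) 2τX (*-mono-≥0 (⟦⟧≥0 τ) (⟦⟧-mono lo)))
        upper : ⟦ suc w ⟧ * (⟦ 2 ⟧ * m) ≤ ⟦ suc w ⟧ * (h + ⟦ 2 ⟧)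
        upper = by-cert (⟦ suc w ⟧ * h - ⟦ 2 ⟧ * ⟦ τ ⟧ + ⟦ 2 ⟧) (trans (cong (λ z → ⟦ suc w ⟧ * (h + ⟦ 2 ⟧) - z)
            (trans (assoc ⟦ suc w ⟧ m) (cong (⟦ 2 ⟧ *_) m≡)))
            (trans (cong (λ z → z * (h + ⟦ 2 ⟧) - ⟦ 2 ⟧ * (⟦ τ ⟧ + ⟦ w ⟧)) (⟦⟧-suc w)) (trans (eq ⟦ w ⟧ h ⟦ τ ⟧)
              (cong (λ z → z * h - ⟦ 2 ⟧ * ⟦ τ ⟧ + ⟦ 2 ⟧) (sym (⟦⟧-suc w))))))
          (diff≥0 2τ≤ ⊕ ⟦⟧≥0 2)
          where
          assoc : ∀ a m → a * (⟦ 2 ⟧ * m) ≡ ⟦ 2 ⟧ * (a * m)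
          assoc = solve-∀ ring
          eq : ∀ w h t → (1ℚ + w) * (h + ⟦ 2 ⟧) - ⟦ 2 ⟧ * (t + w) ≡ (1ℚ + w) * h - ⟦ 2 ⟧ * t + ⟦ 2 ⟧
          eq = solve-∀ ring
        lower : ⟦ suc w ⟧ * (⟦ 2 ⟧ * h) ≤ ⟦ suc w ⟧ * (⟦ 2 ⟧ * (⟦ 3 ⟧ * m))
        lower = by-cert (⟦ 3 ⟧ * (⟦ 2 ⟧ * ⟦ τ ⟧ - ⟦ w ⟧ * h) + (⟦ w ⟧ - ⟦ 2 ⟧) * h + ⟦ 6 ⟧ * ⟦ w ⟧)
          (trans (cong (_- ⟦ suc w ⟧ * (⟦ 2 ⟧ * h)) (trans (assoc ⟦ suc w ⟧ m) (cong (⟦ 6 ⟧ *_) m≡)))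
            (trans (cong (λ z → ⟦ 6 ⟧ * (⟦ τ ⟧ + ⟦ w ⟧) - z * (⟦ 2 ⟧ * h)) (⟦⟧-suc w)) (eq ⟦ w ⟧ h ⟦ τ ⟧)))
          (⟦⟧≥0 3 ⊛ diff≥0 ≤2τ ⊕ diff≥0 (⟦⟧-mono window≥2) ⊛ estimate≥0 ⊕ ⟦⟧≥0 6 ⊛ ⟦⟧≥0 w)
          where
          assoc : ∀ a m → a * (⟦ 2 ⟧ * (⟦ 3 ⟧ * m)) ≡ ⟦ 6 ⟧ * (a * m)
          assoc = solve-∀ ring
          eq : ∀ w h t → ⟦ 6 ⟧ * (t + w) - (1ℚ + w) * (⟦ 2 ⟧ * h) ≡ ⟦ 3 ⟧ * (⟦ 2 ⟧ * t - w * h) + (w - ⟦ 2 ⟧) * h + ⟦ 6 ⟧ * w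
          eq = solve-∀ ring

-- The supermartingale along the states of the algorithm

module Supermartingale (C γ : ℚ) (scale : RationalLemmas.Scale C γ) (n k : ℕ) (k≤n : k ℕ.≤ n) where

  open Estimator
  open RationalLemmas
  open Identities
  open NearestArrival
  open WindowLength
  open Potentials C γ scale
  open RandomOrder
  open GapArrivals
  open import Data.Rational.Base hiding (_≤ᵇ_)
  open import Data.Rational.Properties

  N : ℕ
  N = suc n

  open Algorithm N k
  open Ranks N k

  p : ℚ
  p = inv N * ⟦ k ⟧

  inv-≤ : ∀ l a b → a ℕ.* suc l ℕ.≤ b → ⟦ a ⟧ ≤ inv (suc l) * ⟦ b ⟧
  inv-≤ l a b h = subst (_≤ inv (suc l) * ⟦ b ⟧) eq (*-mono-≥0 (inv≥0 (suc l)) (⟦⟧-mono h))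
    where
    eq : inv (suc l) * ⟦ a ℕ.* suc l ⟧ ≡ ⟦ a ⟧
    eq = trans (cong (λ m → inv (suc l) * ⟦ m ⟧) (ℕₚ.*-comm a (suc l)))
        (trans (cong (inv (suc l) *_) (⟦⟧-* (suc l) a)) (inv-cancel l ⟦ a ⟧))

  inv-≥ : ∀ l a b → b ℕ.≤ a ℕ.* suc l → inv (suc l) * ⟦ b ⟧ ≤ ⟦ a ⟧
  inv-≥ l a b h = subst (inv (suc l) * ⟦ b ⟧ ≤_) eq (*-mono-≥0 (inv≥0 (suc l)) (⟦⟧-mono h))
    where
    eq : inv (suc l) * ⟦ a ℕ.* suc l ⟧ ≡ ⟦ a ⟧
    eq = trans (cong (λ m → inv (suc l) * ⟦ m ⟧) (ℕₚ.*-comm a (suc l)))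
        (trans (cong (inv (suc l) *_) (⟦⟧-* (suc l) a)) (inv-cancel l ⟦ a ⟧))

  p-* : ∀ b → p * ⟦ b ⟧ ≡ inv N * ⟦ k ℕ.* b ⟧
  p-* b = trans (*-assoc (inv N) ⟦ k ⟧ ⟦ b ⟧) (cong (inv N *_) (sym (⟦⟧-* k b)))

  p≥0 : 0ℚ ≤ p
  p≥0 = inv≥0 N ⊛ ⟦⟧≥0 k

  p≤1 : p ≤ 1ℚ
  p≤1 = inv-≥ n 1 k (subst (k ℕ.≤_) (sym (ℕₚ.+-identityʳ N)) (ℕₚ.m≤n⇒m≤1+n k≤n))

  pN≡k : p * ⟦ N ⟧ ≡ ⟦ k ⟧
  pN≡k = trans (p-* N) (trans (cong (λ m → inv N * ⟦ m ⟧) (ℕₚ.*-comm k N))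
      (trans (cong (inv N *_) (⟦⟧-* N k)) (inv-cancel n ⟦ k ⟧)))

  1≤p* : ∀ {b} → 64 ℕ.* N ℕ.≤ k ℕ.* b → 1ℚ ≤ p * ⟦ b ⟧
  1≤p* {b} h = subst (1ℚ ≤_) (sym (p-* b)) (inv-≤ n 1 (k ℕ.* b) (ℕₚ.≤-trans (ℕₚ.*-monoˡ-≤ N {1} {64} (s≤s z≤n)) h))

  -- The potential of a window of length len when s of its arrivals are still to
  -- come, with the signs chosen such that the candidate lies in direction of e.
  windowPot : (t len s i τ₁ r₁ c : ℕ) → ℚ → ℕ → ℚ
  windowPot t len s i τ₁ r₁ c e d =
    ⟦ 9 ⟧ * gapCost s (suc t) e d + driftPot p ⟦ N ⟧ (inv (512 ℕ.* len) * ⟦ s ⟧) ⟦ i ⟧ ⟦ τ₁ ⟧ ⟦ r₁ ⟧ ⟦ c ⟧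

  -- The states that occur while a block is under way, with their potentials; i is
  -- related to the length of the block by R.
  data Running (R : ℕ → ℕ → Set) (t : ℕ) : St ℕ → ℚ → Set where
    counting : ∀ {τ i len c y a b M m} τ₀ r₀ → Position t τ y M m →
      τ ≡ τ₀ ℕ.+ i → suc y ≡ r₀ ℕ.+ c → R i len → c ℕ.≤ i → r₀ ℕ.≤ τ₀ →
      64 ℕ.* len ℕ.≤ τ₀ → τ₀ ℕ.≤ 128 ℕ.* len → 64 ℕ.* N ℕ.≤ k ℕ.* τ₀ →
      Running R t (st τ i len c count y a b M m) (countPot (inv len) p ⟦ N ⟧ ⟦ i ⟧ ⟦ τ₀ ⟧ ⟦ r₀ ⟧ ⟦ c ⟧)
    rising-window : ∀ {τ i len c y a b M m} τ₁ r₁ s d → Position t τ y M m →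
      τ ≡ τ₁ ℕ.+ i → suc y ≡ r₁ ℕ.+ c → R i len → len ≡ s ℕ.+ i → y ≡ d ℕ.+ a →
      512 ℕ.* len ℕ.≤ τ₁ → 64 ℕ.* N ℕ.≤ k ℕ.* τ₁ →
      Running R t (st τ i len c up y a b M m)
        (windowPot t len s i τ₁ r₁ c (⟦ r₁ ⟧ - p * ⟦ τ₁ ⟧) d)
    falling-window : ∀ {τ i len c y a b M m} τ₁ r₁ s d → Position t τ y M m →
      τ ≡ τ₁ ℕ.+ i → suc y ≡ r₁ ℕ.+ c → R i len → len ≡ s ℕ.+ i → b ≡ d ℕ.+ y → b ℕ.< t →
      512 ℕ.* len ℕ.≤ τ₁ → 64 ℕ.* N ℕ.≤ k ℕ.* τ₁ →
      Running R t (st τ i len c down y a b M m)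
        (windowPot t len s i τ₁ r₁ c (- (⟦ r₁ ⟧ - p * ⟦ τ₁ ⟧)) d)

  -- `Settled` holds between steps and `Arrived` before a possible block end has been handled. Hence
  -- i < len in one and i ≤ len in the other, and the startup bound rises from 64 N to 65 N, as one
  -- arrival adds k ≤ N.
  data Settled (t : ℕ) : St ℕ → ℚ → Set where
    starting : ∀ {τ i c a b M m} → Position t τ 0 M m → k ℕ.* τ ℕ.< 64 ℕ.* N →
      Settled t (st τ i 0 c startup 0 a b M m) (startPot p ⟦ N ⟧ ⟦ τ ⟧)
    running : ∀ {σ v} → Running ℕ._<_ t σ v → Settled t σ v

  data Arrived (t : ℕ) : St ℕ → ℚ → Set where
    starting : ∀ {τ i c y a b M m} → Position t τ y M m → k ℕ.* τ ℕ.≤ 65 ℕ.* N →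
      Arrived t (st τ i 0 c startup y a b M m) (startPot p ⟦ N ⟧ ⟦ τ ⟧)
    running : ∀ {σ v} → Running ℕ._≤_ t σ v → Arrived t σ v

  Averaged : (t : ℕ) → St ℕ → ℚ → Set
  Averaged t σ v = ∃[ w ] (∀ g → g ℕ.≤ t → Arrived (suc t) (arrive _≽_ g (mapSt (lift g) σ)) (w g))
                        × Σ< (suc t) w ≤ ⟦ suc t ⟧ * v

  ⟦⟧-rank : ∀ y r c → suc y ≡ r ℕ.+ c → ⟦ suc y ⟧ ≡ ⟦ r ⟧ + ⟦ c ⟧
  ⟦⟧-rank y r c eq = trans (cong ⟦_⟧ eq) (⟦⟧-+ r c)

  average-count : ∀ t ƛ τ₀ r₀ i c y → suc t ≡ τ₀ ℕ.+ i → suc y ≡ r₀ ℕ.+ c → y ℕ.< t → c ℕ.≤ i → i ℕ.≤ τ₀ → r₀ ℕ.≤ τ₀ →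
    0ℚ ≤ ƛ → ⟦ 64 ⟧ ≤ ƛ * ⟦ τ₀ ⟧ → ƛ * ⟦ τ₀ ⟧ ≤ ⟦ 128 ⟧ → 1ℚ ≤ p * ⟦ τ₀ ⟧ →
    Σ< (suc t) (λ g → countPot ƛ p ⟦ N ⟧ ⟦ suc i ⟧ ⟦ τ₀ ⟧ ⟦ r₀ ⟧ ⟦ counted y g c ⟧)
    ≤ ⟦ suc t ⟧ * countPot ƛ p ⟦ N ⟧ ⟦ i ⟧ ⟦ τ₀ ⟧ ⟦ r₀ ⟧ ⟦ c ⟧
  average-count t ƛ τ₀ r₀ i c y τ≡ r≡ y<t c≤i i≤τ₀ r₀≤τ₀ 0≤ƛ lo hi 1≤pτ₀ = subst₂ _≤_ (sym lhs) rhs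
    (count-step ƛ p ⟦ N ⟧ ⟦ i ⟧ ⟦ τ₀ ⟧ ⟦ r₀ ⟧ ⟦ c ⟧ 0≤ƛ p≥0 p≤1 (⟦⟧≥0 i) (⟦⟧-mono i≤τ₀) (⟦⟧≥0 r₀) (⟦⟧≥0 c) (⟦⟧-mono r₀≤τ₀)
      (subst₂ _≤_ (⟦⟧-rank y r₀ c r≡) (⟦⟧-rank t τ₀ i τ≡) (⟦⟧-mono (s≤s (ℕₚ.<⇒≤ y<t)))) lo hi 1≤pτ₀)
    where
    Φ = λ c → countPot ƛ p ⟦ N ⟧ ⟦ suc i ⟧ ⟦ τ₀ ⟧ ⟦ r₀ ⟧ ⟦ c ⟧
    Φ′ = λ c → countPot ƛ p ⟦ N ⟧ (1ℚ + ⟦ i ⟧) ⟦ τ₀ ⟧ ⟦ r₀ ⟧ c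
    rhs : (⟦ τ₀ ⟧ + ⟦ i ⟧) * countPot ƛ p ⟦ N ⟧ ⟦ i ⟧ ⟦ τ₀ ⟧ ⟦ r₀ ⟧ ⟦ c ⟧ ≡ ⟦ suc t ⟧ * countPot ƛ p ⟦ N ⟧ ⟦ i ⟧ ⟦ τ₀ ⟧ ⟦ r₀ ⟧ ⟦ c
        ⟧
    rhs = cong (_* countPot ƛ p ⟦ N ⟧ ⟦ i ⟧ ⟦ τ₀ ⟧ ⟦ r₀ ⟧ ⟦ c ⟧) (sym (⟦⟧-rank t τ₀ i τ≡))
    lhs : Σ< (suc t) (λ g → Φ (counted y g c)) ≡ (⟦ r₀ ⟧ + ⟦ c ⟧) * Φ′ (1ℚ + ⟦ c ⟧) + ((⟦ τ₀ ⟧ + ⟦ i ⟧) - (⟦ r₀ ⟧ + ⟦ c ⟧)) * Φ′ ⟦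
        c ⟧
    lhs = trans (Σ<-cong (suc t) λ g _ → counted-if y g Φ c)
      (trans (Σ<-cases (suc t) y (Φ (suc c)) (Φ c) (ℕₚ.m<n⇒m<1+n y<t))
      (cong₂ _+_ (cong₂ _*_ (⟦⟧-rank y r₀ c r≡) (cong₂ (λ i c → countPot ƛ p ⟦ N ⟧ i ⟦ τ₀ ⟧ ⟦ r₀ ⟧ c) (⟦⟧-suc i) (⟦⟧-suc c)))
                 (cong₂ _*_ (cong₂ _-_ (⟦⟧-rank t τ₀ i τ≡) (⟦⟧-rank y r₀ c r≡))
                     (cong (λ i → countPot ƛ p ⟦ N ⟧ i ⟦ τ₀ ⟧ ⟦ r₀ ⟧ ⟦ c ⟧) (⟦⟧-suc i)))))

  average-drift : ∀ t κ v τ₁ r₁ i c y → suc t ≡ τ₁ ℕ.+ i → suc y ≡ r₁ ℕ.+ c → y ℕ.< t →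
    0ℚ ≤ v → ⟦ 20 ⟧ * v ≤ 1ℚ → 1ℚ ≤ κ * ⟦ suc t ⟧ → 1ℚ ≤ p * ⟦ suc t ⟧ →
    Σ< (suc t) (λ g → driftPot p ⟦ N ⟧ v ⟦ suc i ⟧ ⟦ τ₁ ⟧ ⟦ r₁ ⟧ ⟦ counted y g c ⟧)
    ≤ ⟦ suc t ⟧ * driftPot p ⟦ N ⟧ (κ + v) ⟦ i ⟧ ⟦ τ₁ ⟧ ⟦ r₁ ⟧ ⟦ c ⟧
  average-drift t κ v τ₁ r₁ i c y τ≡ r≡ y<t 0≤v 20v≤1 1≤κτ 1≤pτ = subst₂ _≤_ (sym lhs) rhs
    (window-step κ p ⟦ N ⟧ v ⟦ i ⟧ ⟦ τ₁ ⟧ ⟦ r₁ ⟧ ⟦ c ⟧ p≥0 p≤1 0≤v 20v≤1 (⟦⟧≥0 r₁ ⊕ ⟦⟧≥0 c)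
      (subst₂ _≤_ (⟦⟧-rank y r₁ c r≡) (⟦⟧-rank t τ₁ i τ≡) (⟦⟧-mono (s≤s (ℕₚ.<⇒≤ y<t))))
      (subst (λ x → 1ℚ ≤ κ * x) (⟦⟧-rank t τ₁ i τ≡) 1≤κτ) (subst (λ x → 1ℚ ≤ p * x) (⟦⟧-rank t τ₁ i τ≡) 1≤pτ))
    where
    Φ = λ c → driftPot p ⟦ N ⟧ v ⟦ suc i ⟧ ⟦ τ₁ ⟧ ⟦ r₁ ⟧ ⟦ c ⟧
    Φ′ = λ c → driftPot p ⟦ N ⟧ v (1ℚ + ⟦ i ⟧) ⟦ τ₁ ⟧ ⟦ r₁ ⟧ c
    rhs : (⟦ τ₁ ⟧ + ⟦ i ⟧) * driftPot p ⟦ N ⟧ (κ + v) ⟦ i ⟧ ⟦ τ₁ ⟧ ⟦ r₁ ⟧ ⟦ c ⟧ ≡ ⟦ suc t ⟧ * driftPot p ⟦ N ⟧ (κ + v) ⟦ i ⟧ ⟦ τ₁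
        ⟧ ⟦ r₁ ⟧ ⟦ c ⟧
    rhs = cong (_* driftPot p ⟦ N ⟧ (κ + v) ⟦ i ⟧ ⟦ τ₁ ⟧ ⟦ r₁ ⟧ ⟦ c ⟧) (sym (⟦⟧-rank t τ₁ i τ≡))
    lhs : Σ< (suc t) (λ g → Φ (counted y g c)) ≡ (⟦ r₁ ⟧ + ⟦ c ⟧) * Φ′ (1ℚ + ⟦ c ⟧) + ((⟦ τ₁ ⟧ + ⟦ i ⟧) - (⟦ r₁ ⟧ + ⟦ c ⟧)) * Φ′ ⟦
        c ⟧
    lhs = trans (Σ<-cong (suc t) λ g _ → counted-if y g Φ c)
      (trans (Σ<-cases (suc t) y (Φ (suc c)) (Φ c) (ℕₚ.m<n⇒m<1+n y<t))
      (cong₂ _+_ (cong₂ _*_ (⟦⟧-rank y r₁ c r≡) (cong₂ (λ i c → driftPot p ⟦ N ⟧ v i ⟦ τ₁ ⟧ ⟦ r₁ ⟧ c) (⟦⟧-suc i) (⟦⟧-suc c)))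
                 (cong₂ _*_ (cong₂ _-_ (⟦⟧-rank t τ₁ i τ≡) (⟦⟧-rank y r₁ c r≡))
                     (cong (λ i → driftPot p ⟦ N ⟧ v i ⟦ τ₁ ⟧ ⟦ r₁ ⟧ ⟦ c ⟧) (⟦⟧-suc i)))))

  inv-unit : ∀ {m} → 1 ℕ.≤ m → inv m * ⟦ m ⟧ ≡ 1ℚ
  inv-unit {suc m} _ = inv-* m

  module Window (t len s τ₁ i : ℕ) (τ≡ : suc t ≡ τ₁ ℕ.+ i) (s<len : s ℕ.< len)
                (len≤ : 512 ℕ.* len ℕ.≤ τ₁) (N≤ : 64 ℕ.* N ℕ.≤ k ℕ.* τ₁) where

    κ : ℚ
    κ = inv (512 ℕ.* len)

    κ≥0 : 0ℚ ≤ κ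
    κ≥0 = inv≥0 (512 ℕ.* len)

    private
      1≤len : 1 ℕ.≤ len
      1≤len = ℕₚ.≤-trans (s≤s z≤n) s<len

      κ-unit : κ * ⟦ 512 ℕ.* len ⟧ ≡ 1ℚ
      κ-unit = inv-unit (ℕₚ.*-mono-≤ {1} {512} (s≤s z≤n) 1≤len)

      τ₁≤τ : τ₁ ℕ.≤ suc t
      τ₁≤τ = subst (τ₁ ℕ.≤_) (sym τ≡) (ℕₚ.m≤m+n τ₁ i)

    v≥0 : 0ℚ ≤ κ * ⟦ s ⟧
    v≥0 = κ≥0 ⊛ ⟦⟧≥0 s

    20v≤1 : ⟦ 20 ⟧ * (κ * ⟦ s ⟧) ≤ 1ℚ
    20v≤1 = subst₂ _≤_ (trans (cong (κ *_) (⟦⟧-* 20 s)) (swap-20 κ ⟦ s ⟧)) κ-unit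
      (*-mono-≥0 κ≥0 (⟦⟧-mono (ℕₚ.*-mono-≤ (ℕₚ.≤ᵇ⇒≤ 20 512 _) (ℕₚ.<⇒≤ s<len))))

    1≤κτ : 1ℚ ≤ κ * ⟦ suc t ⟧
    1≤κτ = subst (_≤ κ * ⟦ suc t ⟧) κ-unit (*-mono-≥0 κ≥0 (⟦⟧-mono (ℕₚ.≤-trans len≤ τ₁≤τ)))

    1≤pτ : 1ℚ ≤ p * ⟦ suc t ⟧
    1≤pτ = 1≤p* (ℕₚ.≤-trans N≤ (ℕₚ.*-monoʳ-≤ k τ₁≤τ))

    κ-suc : κ + κ * ⟦ s ⟧ ≡ κ * ⟦ suc s ⟧
    κ-suc = trans (distribute-suc κ ⟦ s ⟧) (cong (κ *_) (sym (⟦⟧-suc s)))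

    -- gap g is the distance after an arrival at g.
    average-window : ∀ r₁ c y d e (gap : ℕ → ℕ) → suc y ≡ r₁ ℕ.+ c → y ℕ.< t →
      (∀ F → Σ< (suc t) (λ g → F (gap g)) ≡ (⟦ suc t ⟧ - ⟦ d ⟧) * F d + Σ< d (λ i → F (suc i))) →
      Σ< (suc t) (λ g → ⟦ 9 ⟧ * gapCost s (suc (suc t)) e (gap g)
                        + driftPot p ⟦ N ⟧ (κ * ⟦ s ⟧) ⟦ suc i ⟧ ⟦ τ₁ ⟧ ⟦ r₁ ⟧ ⟦ counted y g c ⟧)
      ≤ ⟦ suc t ⟧ * (⟦ 9 ⟧ * gapCost (suc s) (suc t) e d + driftPot p ⟦ N ⟧ (κ * ⟦ suc s ⟧) ⟦ i ⟧ ⟦ τ₁ ⟧ ⟦ r₁ ⟧ ⟦ c ⟧)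
    average-window r₁ c y d e gap r≡ y<t Σgap = begin
      Σ< (suc t) (λ g → ⟦ 9 ⟧ * G g + D g)
        ≡⟨ trans (Σ<-+ (suc t) (λ g → ⟦ 9 ⟧ * G g) D) (cong (_+ Σ< (suc t) D) (Σ<-* (suc t) ⟦ 9 ⟧ G)) ⟩
      ⟦ 9 ⟧ * Σ< (suc t) G + Σ< (suc t) D
        ≡⟨ cong (λ x → ⟦ 9 ⟧ * x + Σ< (suc t) D) (trans (Σgap (gapCost s (suc (suc t)) e)) (gapCost-step s t e d)) ⟩
      ⟦ 9 ⟧ * (⟦ suc t ⟧ * gapCost (suc s) (suc t) e d) + Σ< (suc t) D
        ≤⟨ +-monoʳ-≤ (⟦ 9 ⟧ * (⟦ suc t ⟧ * gapCost (suc s) (suc t) e d))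
            (average-drift t κ (κ * ⟦ s ⟧) τ₁ r₁ i c y τ≡ r≡ y<t v≥0 20v≤1 1≤κτ 1≤pτ) ⟩
      ⟦ 9 ⟧ * (⟦ suc t ⟧ * gapCost (suc s) (suc t) e d) + ⟦ suc t ⟧ * drift (κ + κ * ⟦ s ⟧)
        ≡⟨ distribute-9 ⟦ suc t ⟧ (gapCost (suc s) (suc t) e d) (drift (κ + κ * ⟦ s ⟧)) ⟩
      ⟦ suc t ⟧ * (⟦ 9 ⟧ * gapCost (suc s) (suc t) e d + drift (κ + κ * ⟦ s ⟧))
        ≡⟨ cong (λ v → ⟦ suc t ⟧ * (⟦ 9 ⟧ * gapCost (suc s) (suc t) e d + drift v)) κ-suc ⟩
      ⟦ suc t ⟧ * (⟦ 9 ⟧ * gapCost (suc s) (suc t) e d + drift (κ * ⟦ suc s ⟧))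
        ∎
      where
      open ≤-Reasoning
      G D : ℕ → ℚ
      G g = gapCost s (suc (suc t)) e (gap g)
      D g = driftPot p ⟦ N ⟧ (κ * ⟦ s ⟧) ⟦ suc i ⟧ ⟦ τ₁ ⟧ ⟦ r₁ ⟧ ⟦ counted y g c ⟧
      drift : ℚ → ℚ
      drift v = driftPot p ⟦ N ⟧ v ⟦ i ⟧ ⟦ τ₁ ⟧ ⟦ r₁ ⟧ ⟦ c ⟧

  averaged : ∀ {t σ v} → Settled t σ v → Averaged t σ v
  averaged {t} (starting {τ} pos@(position refl _ _ _) kτ<) =
    (λ _ → startPot p ⟦ N ⟧ ⟦ suc τ ⟧) ,
    (λ g g≤t → starting (arrive-position g g≤t pos) bound) ,
    subst (_≤ ⟦ suc t ⟧ * startPot p ⟦ N ⟧ ⟦ τ ⟧) (sym (Σ<-const (suc t) (startPot p ⟦ N ⟧ ⟦ suc τ ⟧)))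
      (*-mono-≥0 (⟦⟧≥0 (suc t)) (budget-step {p} {⟦ N ⟧} {⟦ τ ⟧} {⟦ suc τ ⟧} p≥0 (⟦⟧-mono (ℕₚ.n≤1+n τ))))
    where
    bound : k ℕ.* suc τ ℕ.≤ 65 ℕ.* N
    bound = subst (ℕ._≤ 65 ℕ.* N) (sym (ℕₚ.*-suc k τ)) (ℕₚ.+-mono-≤ (ℕₚ.m≤n⇒m≤1+n k≤n) (ℕₚ.<⇒≤ kτ<))
  averaged {t} (running (counting {i = i} {suc l} {c} {y} τ₀ r₀ pos@(position refl _ _ y<t) τ≡ r≡ (s≤s i≤l) c≤i r₀≤ lo hi N≤)) =
    (λ g → countPot (inv (suc l)) p ⟦ N ⟧ ⟦ suc i ⟧ ⟦ τ₀ ⟧ ⟦ r₀ ⟧ ⟦ counted y g c ⟧) ,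
    (λ g g≤t → running (counting τ₀ r₀ (arrive-position g g≤t pos) (trans (cong suc τ≡) (sym (ℕₚ.+-suc τ₀ i)))
      (counted-rank y g r₀ c r≡) (s≤s i≤l) (counted-≤ y g c i c≤i) r₀≤ lo hi N≤)) ,
    average-count t (inv (suc l)) τ₀ r₀ i c y τ≡ r≡ y<t c≤i
      (ℕₚ.≤-trans (ℕₚ.m≤n⇒m≤1+n i≤l) (ℕₚ.≤-trans (ℕₚ.m≤m+n (suc l) (63 ℕ.* suc l)) lo)) r₀≤
      (inv≥0 (suc l)) (inv-≤ l 64 τ₀ lo) (inv-≥ l 128 τ₀ hi) (1≤p* N≤)
  averaged (running (rising-window τ₁ r₁ zero d pos τ≡ r≡ i<len refl y≡ len≤ N≤)) = contradiction i<len (ℕₚ.<-irrefl refl)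
  averaged {t} (running (rising-window {i = i} {len} {c} {y} {a} τ₁ r₁ (suc s) d pos@(position refl _ _ y<t) τ≡ r≡ i<len len≡ y≡
      len≤ N≤)) =
    _ ,
    (λ g g≤t → running (rising-window τ₁ r₁ s (rising-gap y g d a) (arrive-position g g≤t pos)
        (trans (cong suc τ≡) (sym (ℕₚ.+-suc τ₁ i)))
      (counted-rank y g r₁ c r≡) i<len (trans len≡ (sym (ℕₚ.+-suc s i))) (risen-gap y g d a y≡) len≤ N≤)) ,
    Window.average-window t len s τ₁ i τ≡ (subst (s ℕ.<_) (sym len≡) (ℕₚ.m≤m+n (suc s) i)) len≤ N≤ r₁ c y d (⟦ r₁ ⟧ - p * ⟦ τ₁ ⟧)
        (λ g → rising-gap y g d a)
      r≡ y<t (λ F → Σ<-rising (suc t) y d a F y≡ (ℕₚ.m<n⇒m<1+n y<t))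
  averaged (running (falling-window τ₁ r₁ zero d pos τ≡ r≡ i<len refl b≡ b<t len≤ N≤)) = contradiction i<len (ℕₚ.<-irrefl refl)
  averaged {t} (running (falling-window {i = i} {len} {c} {y} {a} {b} τ₁ r₁ (suc s) d pos@(position refl _ _ y<t) τ≡ r≡ i<len len≡
      b≡ b<t len≤ N≤)) =
    _ ,
    (λ g g≤t → running (falling-window τ₁ r₁ s (falling-gap y g d b) (arrive-position g g≤t pos)
        (trans (cong suc τ≡) (sym (ℕₚ.+-suc τ₁ i)))
      (counted-rank y g r₁ c r≡) i<len (trans len≡ (sym (ℕₚ.+-suc s i))) (fallen-gap y g d b b≡) (fallen-< y g b g≤t b<t) len≤
          N≤)) ,
    Window.average-window t len s τ₁ i τ≡ (subst (s ℕ.<_) (sym len≡) (ℕₚ.m≤m+n (suc s) i)) len≤ N≤ r₁ c y d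
        (- (⟦ r₁ ⟧ - p * ⟦ τ₁ ⟧)) (λ g → falling-gap y g d b)
      r≡ y<t (λ F → Σ<-falling (suc t) y d b F b≡ (ℕₚ.m<n⇒m<1+n b<t))

  Bounded : (t : ℕ) → St ℕ → ℚ → Set
  Bounded t σ v = ∃[ v′ ] v′ ≤ v × Settled t σ v′

  -- With no arrivals counted, δ is 0 and the potential is `blockPot`. Since k ≤ N, the hypothesis
  -- forces τ ≥ 64; so the length is positive, and rounding down at most halves it.
  count-block : ∀ {t τ y a b M m} → Position t τ y M m → 64 ℕ.* N ℕ.≤ k ℕ.* τ →
    Settled t (st τ 0 (τ ℕ./ 64) 0 count y a b M m) (blockPot p ⟦ N ⟧ ⟦ τ ⟧ ⟦ suc y ⟧)
  count-block {t} {τ} {y = y} pos@(position τ≡ _ _ y<t) N≤ = subst (Settled t _)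
      (count-start (inv (τ ℕ./ 64)) p ⟦ N ⟧ ⟦ τ ⟧ ⟦ suc y ⟧)
    (running (counting τ (suc y) pos (sym (ℕₚ.+-identityʳ τ)) (sym (ℕₚ.+-identityʳ (suc y))) len>0 z≤n
      (subst (suc y ℕ.≤_) (sym τ≡) (ℕₚ.m≤n⇒m≤1+n y<t))
      (subst (ℕ._≤ τ) (ℕₚ.*-comm (τ ℕ./ 64) 64) (ℕᵈ.m/n*n≤m τ 64)) upper N≤))
    where
    64≤τ : 64 ℕ.≤ τ
    64≤τ = ℕₚ.*-cancelʳ-≤ 64 τ N (ℕₚ.≤-trans N≤ (subst (ℕ._≤ τ ℕ.* N) (ℕₚ.*-comm τ k) (ℕₚ.*-monoʳ-≤ τ (ℕₚ.m≤n⇒m≤1+n k≤n))))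
    len>0 : 0 ℕ.< τ ℕ./ 64
    len>0 = ℕᵈ.m≥n⇒m/n>0 64≤τ
    upper : τ ℕ.≤ 128 ℕ.* (τ ℕ./ 64)
    upper = subst₂ ℕ._≤_ (sym (ℕᵈ.m≡m%n+[m/n]*n τ 64)) (trans (sym (ℕₚ.*-distribˡ-+ (τ ℕ./ 64) 64 64)) (ℕₚ.*-comm (τ ℕ./ 64) 128))
      (ℕₚ.+-monoˡ-≤ (τ ℕ./ 64 ℕ.* 64) (ℕₚ.≤-trans (ℕₚ.<⇒≤ (ℕᵈ.m%n<n τ 64)) (ℕₚ.*-monoˡ-≤ 64 {1} len>0)))

  settled-start : ∀ {t τ i c y a b M m} → Position t τ y M m → k ℕ.* τ ℕ.≤ 65 ℕ.* N →
    Bounded t (boundary (st τ i 0 c startup y a b M m)) (startPot p ⟦ N ⟧ ⟦ τ ⟧)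
  settled-start {t} {τ} {M = zero} (position τ≡ refl m≡ y<t) kτ≤ = decide (ℕₚ.≤-<-connex (64 ℕ.* N) (k ℕ.* τ))
    where
    pos′ : Position t τ 0 0 _
    pos′ = position τ≡ refl m≡ (ℕₚ.≤-trans (s≤s z≤n) y<t)
    pτ≤ : p * ⟦ τ ⟧ ≤ ⟦ 67 ⟧
    pτ≤ = ≤-trans (subst (_≤ ⟦ 65 ⟧) (sym (p-* τ)) (inv-≥ n 65 (k ℕ.* τ) kτ≤)) (⟦⟧-mono (ℕₚ.≤ᵇ⇒≤ 65 67 _))
    decide : _ ⊎ _ → Bounded t _ _
    decide (inj₁ N≤) = _ , start-block p ⟦ N ⟧ ⟦ τ ⟧ (p≥0 ⊛ ⟦⟧≥0 τ) pτ≤ , subst (λ σ → Settled t σ _) (sym (if-≤ N≤))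
        (count-block pos′ N≤)
    decide (inj₂ <N) = _ , ≤-refl , subst (λ σ → Settled t σ _) (sym (if-> <N)) (starting pos′ <N)

  module EndOfCount {t τ len c y a b M m τ₀ r₀ : ℕ} (pos : Position t τ y M m)
    (τ≡ : τ ≡ τ₀ ℕ.+ len) (r≡ : suc y ≡ r₀ ℕ.+ c) (c≤len : c ℕ.≤ len) (1≤len : 1 ℕ.≤ len)
    (hi : τ₀ ℕ.≤ 128 ℕ.* len) (N≤ : 64 ℕ.* N ℕ.≤ k ℕ.* τ₀) where

    σ : St ℕ
    σ = st τ len len c count y a b M m

    e δ Φ : ℚ
    e = ⟦ r₀ ⟧ + ⟦ c ⟧ - p * (⟦ τ₀ ⟧ + ⟦ len ⟧)
    δ = inv len * (⟦ c ⟧ * ⟦ τ₀ ⟧ - ⟦ len ⟧ * ⟦ r₀ ⟧)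
    Φ = countPot (inv len) p ⟦ N ⟧ ⟦ len ⟧ ⟦ τ₀ ⟧ ⟦ r₀ ⟧ ⟦ c ⟧

    private
      τℚ : ⟦ τ ⟧ ≡ ⟦ τ₀ ⟧ + ⟦ len ⟧
      τℚ = trans (cong ⟦_⟧ τ≡) (⟦⟧-+ τ₀ len)

      rℚ : ⟦ suc y ⟧ ≡ ⟦ r₀ ⟧ + ⟦ c ⟧
      rℚ = ⟦⟧-rank y r₀ c r≡

      unit : ⟦ len ⟧ * inv len ≡ 1ℚ
      unit = trans (*-comm ⟦ len ⟧ (inv len)) (inv-unit 1≤len)

      N≤τ : 64 ℕ.* N ℕ.≤ k ℕ.* τ
      N≤τ = ℕₚ.≤-trans N≤ (ℕₚ.*-monoʳ-≤ k (subst (τ₀ ℕ.≤_) (sym τ≡) (ℕₚ.m≤m+n τ₀ len)))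

      -- From p τ₀ ≥ 64 and τ₀ ≤ 128 len. This is what makes the saved budget at least γ / 2.
      1≤2pi : 1ℚ ≤ ⟦ 2 ⟧ * (p * ⟦ len ⟧)
      1≤2pi = subst (1ℚ ≤_) (trans (cong (inv N *_) (trans (⟦⟧-* 2 (k ℕ.* len)) (cong (⟦ 2 ⟧ *_) (⟦⟧-* k len))))
          (swap-2 (inv N) ⟦ k ⟧ ⟦ len ⟧))
        (inv-≤ n 1 (2 ℕ.* (k ℕ.* len)) (subst (ℕ._≤ 2 ℕ.* (k ℕ.* len)) (sym (ℕₚ.+-identityʳ N))
          (ℕₚ.*-cancelˡ-≤ 64 (ℕₚ.≤-trans N≤ (ℕₚ.≤-trans (ℕₚ.*-monoʳ-≤ k hi) (ℕₚ.≤-reflexive (regroup k len)))))))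
        where
        regroup : ∀ k l → k ℕ.* (128 ℕ.* l) ≡ 64 ℕ.* (2 ℕ.* (k ℕ.* l))
        regroup k l = trans (sym (ℕₚ.*-assoc k 128 l))
            (trans (cong (ℕ._* l) (ℕₚ.*-comm k 128)) (trans (ℕₚ.*-assoc 128 k l) (ℕₚ.*-assoc 64 2 (k ℕ.* l))))

    -- In e + δ = τ (c / len - p) the unknown rank r₀ has cancelled, so ê can be computed from the
    -- count.
    X≡ : ⟦ N ℕ.* len ⟧ * (e + δ) ≡ ⟦ τ ⟧ * (⟦ c ℕ.* N ⟧ - ⟦ k ℕ.* len ⟧)
    X≡ = begin
      ⟦ N ℕ.* len ⟧ * (e + δ)
        ≡⟨ cong (_* (e + δ)) (⟦⟧-* N len) ⟩
      ⟦ N ⟧ * ⟦ len ⟧ * (e + δ)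
        ≡⟨ estimate-expand ⟦ N ⟧ ⟦ len ⟧ (inv len) p ⟦ r₀ ⟧ ⟦ c ⟧ ⟦ τ₀ ⟧ ⟩
      ⟦ N ⟧ * ⟦ len ⟧ * (⟦ r₀ ⟧ + ⟦ c ⟧) - p * ⟦ N ⟧ * ⟦ len ⟧ * (⟦ τ₀ ⟧ + ⟦ len ⟧) + ⟦ N ⟧ * (⟦ len ⟧ * inv len) *
          (⟦ c ⟧ * ⟦ τ₀ ⟧ - ⟦ len ⟧ * ⟦ r₀ ⟧)
        ≡⟨ cong₂ (λ x y → ⟦ N ⟧ * ⟦ len ⟧ * (⟦ r₀ ⟧ + ⟦ c ⟧) - x * ⟦ len ⟧ * (⟦ τ₀ ⟧ + ⟦ len ⟧) + ⟦ N ⟧ * y *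
            (⟦ c ⟧ * ⟦ τ₀ ⟧ - ⟦ len ⟧ * ⟦ r₀ ⟧)) pN≡k unit ⟩
      ⟦ N ⟧ * ⟦ len ⟧ * (⟦ r₀ ⟧ + ⟦ c ⟧) - ⟦ k ⟧ * ⟦ len ⟧ * (⟦ τ₀ ⟧ + ⟦ len ⟧) + ⟦ N ⟧ * 1ℚ * (⟦ c ⟧ * ⟦ τ₀ ⟧ - ⟦ len ⟧ * ⟦ r₀ ⟧)
        ≡⟨ estimate-contract ⟦ N ⟧ ⟦ len ⟧ ⟦ k ⟧ ⟦ r₀ ⟧ ⟦ c ⟧ ⟦ τ₀ ⟧ ⟩
      (⟦ τ₀ ⟧ + ⟦ len ⟧) * (⟦ c ⟧ * ⟦ N ⟧ - ⟦ k ⟧ * ⟦ len ⟧)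
        ≡⟨ cong₂ _*_ (sym τℚ) (cong₂ _-_ (sym (⟦⟧-* c N)) (sym (⟦⟧-* k len))) ⟩
      ⟦ τ ⟧ * (⟦ c ℕ.* N ⟧ - ⟦ k ℕ.* len ⟧)
        ∎
      where
      open ≡-Reasoning

    stay : ∀ ê → ê ≡ e + δ → ê * ê ≤ ⟦ 1048576 ⟧ → Bounded t (countBlock σ) Φ
    stay ê ê≡ small = _ , subst₂ (λ x y → blockPot p ⟦ N ⟧ x y ≤ Φ) (sym τℚ) (sym rℚ)
      (count-stay (inv len) p ⟦ N ⟧ ⟦ len ⟧ ⟦ τ₀ ⟧ ⟦ r₀ ⟧ ⟦ c ⟧ ê unit ê≡ small 1≤2pi) , count-block pos N≤τ

    private
      x : ℕ
      x = ℕ.pred (N ℕ.* len)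

      sx≡ : suc x ≡ N ℕ.* len
      sx≡ = ℕₚ.suc-pred (N ℕ.* len) {{ℕ.>-nonZero (ℕₚ.*-mono-≤ {1} {N} (s≤s z≤n) 1≤len)}}

      e≡ : ⟦ suc y ⟧ - p * ⟦ τ ⟧ ≡ e
      e≡ = cong₂ (λ r τ → r - p * τ) rℚ τℚ

    Goal : St ℕ → Set
    Goal σ = Bounded t σ Φ

    -- The offset e′ and the error δ′ of its estimate, measured in the direction dir.
    module Aiming (dir : Mode) (q d : ℕ) (e′ δ′ : ℚ) (e² : e′ * e′ ≡ e * e) (δ² : δ′ * δ′ ≡ δ * δ)
      (h² : (e + δ) * (e + δ) ≡ (e′ + δ′) * (e′ + δ′)) (h≡ : ⟦ N ℕ.* len ⟧ * (e′ + δ′) ≡ ⟦ τ ⟧ * ⟦ q ⟧)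
      (q≤ : q ℕ.≤ N ℕ.* len) (d≤τ : d ℕ.≤ suc t) (e′≤ : e′ ≤ 1ℚ + ⟦ d ⟧) where

      private
        h≡′ : ⟦ suc x ⟧ * (e′ + δ′) ≡ ⟦ τ ⟧ * ⟦ q ⟧
        h≡′ = trans (cong (λ X → ⟦ X ⟧ * (e′ + δ′)) sx≡) h≡

        q≤′ : q ℕ.≤ suc x
        q≤′ = subst (q ℕ.≤_) (sym sx≡) q≤

        w : ℕ
        w = quotient (2 ℕ.* (N ℕ.* len)) q

        move≤ : 2 ℕ.≤ w → ∃[ μ ] ⟦ suc w ⟧ * μ ≡ ⟦ τ ⟧ + ⟦ w ⟧ × ⟦ 2 ⟧ * μ ≤ (e′ + δ′) + ⟦ 2 ⟧ × e′ + δ′ ≤ ⟦ 3 ⟧ * μ →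
          windowPot t w w 0 τ (suc y) 0 e′ d ≤ Φ
        move≤ w≥2 (μ , μ≡ , μ≤ , ≤μ) = subst₂ (λ x y → ⟦ 9 ⟧ * gapCost w (suc t) e′ d + driftPot p ⟦ N ⟧ ν 0ℚ x y 0ℚ ≤ Φ) (sym τℚ)
            (sym rℚ)
          (count-move (inv len) p ⟦ N ⟧ ν ⟦ len ⟧ ⟦ τ₀ ⟧ ⟦ r₀ ⟧ ⟦ c ⟧ (gapCost w (suc t) e′ d) unit 432ν≤1 1≤2pi gap≤)
          where
          ν : ℚ
          ν = inv (512 ℕ.* w) * ⟦ w ⟧
          432ν≤1 : ⟦ 432 ⟧ * ν ≤ 1ℚ
          432ν≤1 = subst₂ _≤_ (trans (cong (inv (512 ℕ.* w) *_) (⟦⟧-* 432 w)) (swap-432 (inv (512 ℕ.* w)) ⟦ w ⟧))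
            (inv-unit (ℕₚ.*-mono-≤ {1} {512} (s≤s z≤n) (ℕₚ.≤-trans (s≤s z≤n) w≥2)))
            (*-mono-≥0 (inv≥0 (512 ℕ.* w)) (⟦⟧-mono (ℕₚ.*-monoˡ-≤ w (ℕₚ.≤ᵇ⇒≤ 432 512 _))))
          gap≤ : ⟦ 9 ⟧ * gapCost w (suc t) e′ d ≤ ⟦ 6 ⟧ * (e * e) + ⟦ 32 ⟧ * (δ * δ) + ⟦ 36 ⟧
          gap≤ = subst₂ (λ x y → ⟦ 9 ⟧ * gapCost w (suc t) e′ d ≤ ⟦ 6 ⟧ * x + ⟦ 32 ⟧ * y + ⟦ 36 ⟧) e² δ²
            (≤-trans (*-mono-≥0 (⟦⟧≥0 9) (gapCost-bound w t e′ d μ d≤τ e′≤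
                (trans μ≡ (cong (λ x → ⟦ x ⟧ + ⟦ w ⟧) (Position.τ≡ pos)))))
              (half-aim e′ δ′ μ μ≤ ≤μ))

      aimed : (∀ w → 1 ℕ.≤ w → 512 ℕ.* w ℕ.≤ τ → Running ℕ._<_ t (window dir w σ) (windowPot t w w 0 τ (suc y) 0 e′ d)) →
        Goal (aim dir q σ)
      aimed start = decide (ℕₚ.≤-<-connex (1024 ℕ.* (N ℕ.* len)) (τ ℕ.* q))
        where
        go : 1024 ℕ.* suc x ℕ.≤ τ ℕ.* q → Goal (window dir w σ)
        go large = _ , move≤ w≥2 mean , running (start w (ℕₚ.≤-trans (s≤s z≤n) w≥2) short)
          where
          w≥2 : 2 ℕ.≤ w
          w≥2 = subst (λ X → 2 ℕ.≤ quotient (2 ℕ.* X) q) sx≡ (window≥2 x τ q (e′ + δ′) h≡′ large q≤′)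
          short : 512 ℕ.* w ℕ.≤ τ
          short = subst (λ X → 512 ℕ.* quotient (2 ℕ.* X) q ℕ.≤ τ) sx≡ (window-short x τ q (e′ + δ′) h≡′ large q≤′)
          mean : ∃[ μ ] ⟦ suc w ⟧ * μ ≡ ⟦ τ ⟧ + ⟦ w ⟧ × ⟦ 2 ⟧ * μ ≤ (e′ + δ′) + ⟦ 2 ⟧ × e′ + δ′ ≤ ⟦ 3 ⟧ * μ
          mean = subst (λ X → let w = quotient (2 ℕ.* X) q in
              ∃[ μ ] ⟦ suc w ⟧ * μ ≡ ⟦ τ ⟧ + ⟦ w ⟧ × ⟦ 2 ⟧ * μ ≤ (e′ + δ′) + ⟦ 2 ⟧ × e′ + δ′ ≤ ⟦ 3 ⟧ * μ)
            sx≡ (window-mean x τ q (e′ + δ′) h≡′ large q≤′)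
        decide : _ ⊎ _ → Goal _
        decide (inj₁ large) = subst Goal (sym (if-≤ large)) (go (subst (λ X → 1024 ℕ.* X ℕ.≤ τ ℕ.* q) (sym sx≡) large))
        decide (inj₂ small) = subst Goal (sym (if-> small)) (stay (e + δ) refl (subst (_≤ ⟦ 1048576 ⟧) (sym h²)
          (estimate-small x τ q (e′ + δ′) h≡′ (subst (λ X → τ ℕ.* q ℕ.< 1024 ℕ.* X) (sym sx≡) small))))

    aim-up : k ℕ.* len ℕ.≤ c ℕ.* N → Goal (aim up (c ℕ.* N ℕ.∸ k ℕ.* len) σ)
    aim-up ≤c = Aiming.aimed up q y e δ refl refl refl (trans X≡ (cong (⟦ τ ⟧ *_) (sym (⟦⟧-∸ ≤c)))) q≤
      (ℕₚ.<⇒≤ (ℕₚ.m<n⇒m<1+n (Position.y<t pos))) e≤ start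
      where
      q : ℕ
      q = c ℕ.* N ℕ.∸ k ℕ.* len
      q≤ : q ℕ.≤ N ℕ.* len
      q≤ = ℕₚ.≤-trans (ℕₚ.m∸n≤m (c ℕ.* N) (k ℕ.* len)) (subst (c ℕ.* N ℕ.≤_) (ℕₚ.*-comm len N) (ℕₚ.*-monoˡ-≤ N c≤len))
      -- The first candidate is the maximum, at distance y, and e is at most the rank y + 1. So even
      -- the farthest candidate does not fall short of the target by more than 1, as `gapCost-bound`
      -- requires.
      e≤ : e ≤ 1ℚ + ⟦ y ⟧
      e≤ = by-cert (p * ⟦ τ ⟧)
        (trans (cong (λ z → 1ℚ + ⟦ y ⟧ - z) (trans (sym e≡) (cong (_- p * ⟦ τ ⟧) (⟦⟧-suc y)))) (offset-below ⟦ y ⟧ (p * ⟦ τ ⟧)))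
        (p≥0 ⊛ ⟦⟧≥0 τ)
      start : ∀ w → 1 ℕ.≤ w → 512 ℕ.* w ℕ.≤ τ → Running ℕ._<_ t (window up w σ) (windowPot t w w 0 τ (suc y) 0 e y)
      start w w≥1 short = subst (λ e → Running ℕ._<_ t (window up w σ) (windowPot t w w 0 τ (suc y) 0 e y)) e≡
        (rising-window τ (suc y) w y pos (sym (ℕₚ.+-identityʳ τ)) (sym (ℕₚ.+-identityʳ (suc y))) w≥1 (sym (ℕₚ.+-identityʳ w))
          (trans (sym (ℕₚ.+-identityʳ y)) (cong (y ℕ.+_) (sym (Position.M≡0 pos)))) short N≤τ)

    aim-down : c ℕ.* N ℕ.≤ k ℕ.* len → Goal (aim down (k ℕ.* len ℕ.∸ c ℕ.* N) σ)
    aim-down c≤ = Aiming.aimed down q d (- e) (- δ) (square-neg e) (square-neg δ) (square-neg-sum e δ)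
      (trans (neg-scale ⟦ N ℕ.* len ⟧ e δ) (trans (cong -_ X≡)
          (trans (neg-difference ⟦ τ ⟧ ⟦ c ℕ.* N ⟧ ⟦ k ℕ.* len ⟧) (cong (⟦ τ ⟧ *_) (sym (⟦⟧-∸ c≤))))))
      (ℕₚ.≤-trans (ℕₚ.m∸n≤m (k ℕ.* len) (c ℕ.* N)) (ℕₚ.*-monoˡ-≤ len (ℕₚ.m≤n⇒m≤1+n k≤n)))
      (ℕₚ.<⇒≤ (ℕₚ.m<n⇒m<1+n (ℕₚ.≤-<-trans (ℕₚ.m∸n≤m m y) m<t))) e≤ start
      where
      q d : ℕ
      q = k ℕ.* len ℕ.∸ c ℕ.* N
      d = m ℕ.∸ y
      y≤m : y ℕ.≤ m
      y≤m = ℕₚ.≤-pred (subst (suc y ℕ.≤_) (sym (Position.m≡ pos)) (Position.y<t pos))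
      m<t : m ℕ.< t
      m<t = subst (m ℕ.<_) (Position.m≡ pos) ℕₚ.≤-refl
      τ-split : ⟦ τ ⟧ ≡ 1ℚ + ⟦ d ⟧ + ⟦ suc y ⟧
      τ-split = trans
        (cong ⟦_⟧ (trans (Position.τ≡ pos) (cong suc (trans (sym (Position.m≡ pos))
            (trans (cong suc (sym (ℕₚ.m∸n+n≡m y≤m))) (sym (ℕₚ.+-suc d y)))))))
        (trans (⟦⟧-+ (suc d) (suc y)) (cong (_+ ⟦ suc y ⟧) (⟦⟧-suc d)))
      -- Likewise for the minimum at distance d: -e = p τ - r is at most τ - r, which is 1 + d.
      e≤ : - e ≤ 1ℚ + ⟦ d ⟧
      e≤ = by-cert ((1ℚ - p) * ⟦ τ ⟧)
        (trans (cong (λ z → 1ℚ + ⟦ d ⟧ - - z) (sym e≡)) (trans (offset-complement ⟦ d ⟧ ⟦ suc y ⟧ (p * ⟦ τ ⟧))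
          (trans (cong (_- p * ⟦ τ ⟧) (sym τ-split)) (factor-complement ⟦ τ ⟧ p))))
        (diff≥0 p≤1 ⊛ ⟦⟧≥0 τ)
      start : ∀ w → 1 ℕ.≤ w → 512 ℕ.* w ℕ.≤ τ → Running ℕ._<_ t (window down w σ) (windowPot t w w 0 τ (suc y) 0 (- e) d)
      start w w≥1 short = subst (λ e → Running ℕ._<_ t (window down w σ) (windowPot t w w 0 τ (suc y) 0 (- e) d)) e≡
        (falling-window τ (suc y) w d pos (sym (ℕₚ.+-identityʳ τ)) (sym (ℕₚ.+-identityʳ (suc y))) w≥1 (sym (ℕₚ.+-identityʳ w))
          (sym (ℕₚ.m∸n+n≡m y≤m)) m<t short N≤τ)

    settled-count : Goal (boundary σ)
    settled-count = decide (ℕₚ.≤-<-connex (k ℕ.* len) (c ℕ.* N))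
      where
      decide : _ ⊎ _ → Goal _
      decide (inj₁ ≤c) = subst Goal (sym (if-≤ ≤c)) (aim-up ≤c)
      decide (inj₂ c<) = subst Goal (sym (if-> c<)) (aim-down (ℕₚ.<⇒≤ c<))

  -- `x` is the offset at the opening of the window, shifted by the final distance to the candidate;
  -- adding the drift c - p i gives the offset of the new y.
  settled-window : ∀ {t τ c a b M m} f τ₁ r₁ i x v y′ → Position t τ y′ M m → x * x ≤ f → v ≡ 0ℚ →
    64 ℕ.* N ℕ.≤ k ℕ.* τ → τ ≡ τ₁ ℕ.+ i → ⟦ suc y′ ⟧ - p * ⟦ τ ⟧ ≡ x + (⟦ c ⟧ - p * ⟦ i ⟧) →
    Bounded t (st τ 0 (τ ℕ./ 64) 0 count y′ a b M m) (⟦ 9 ⟧ * f + driftPot p ⟦ N ⟧ v ⟦ i ⟧ ⟦ τ₁ ⟧ ⟦ r₁ ⟧ ⟦ c ⟧)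
  settled-window {τ = τ} {c = c} f τ₁ r₁ i x v y′ pos x²≤f refl N≤ τ≡ e≡ =
    _ , subst₂ (λ e τ → ⟦ 8 ⟧ * (e * e) + budget p ⟦ N ⟧ τ ≤ ⟦ 9 ⟧ * f + driftPot p ⟦ N ⟧ 0ℚ ⟦ i ⟧ ⟦ τ₁ ⟧ ⟦ r₁ ⟧ ⟦ c ⟧)
          (sym e≡) (sym (trans (cong ⟦_⟧ τ≡) (⟦⟧-+ τ₁ i))) (window-end p ⟦ N ⟧ ⟦ i ⟧ ⟦ τ₁ ⟧ ⟦ r₁ ⟧ ⟦ c ⟧ x f x²≤f) ,
    count-block pos N≤

  ≤-+-⟦⟧ : ∀ {x} d → x ≤ x + ⟦ d ⟧
  ≤-+-⟦⟧ {x} d = by-cert ⟦ d ⟧ (sum-minus x ⟦ d ⟧) (⟦⟧≥0 d)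

  settled-rising : ∀ {t τ i len c y a b M m} τ₁ r₁ s d → Position t τ y M m →
    τ ≡ τ₁ ℕ.+ i → suc y ≡ r₁ ℕ.+ c → s ≡ 0 → y ≡ d ℕ.+ a → 64 ℕ.* N ℕ.≤ k ℕ.* τ₁ →
    Bounded t (boundary (st τ i len c up y a b M m))
      (windowPot t len s i τ₁ r₁ c (⟦ r₁ ⟧ - p * ⟦ τ₁ ⟧) d)
  settled-rising {t} {τ} {i} {len} {c} {y} {a} τ₁ r₁ s d (position τ≡ M≡ m≡ y<t) τ≡′ r≡ refl y≡ N≤ =
    settled-window {c = c} (gapCost 0 (suc t) e₁ d) τ₁ r₁ i (e₁ - ⟦ d ⟧) (inv (512 ℕ.* len) * ⟦ 0 ⟧) a
      (position τ≡ M≡ m≡ (ℕₚ.≤-<-trans (subst (a ℕ.≤_) (sym y≡) (ℕₚ.m≤n+m a d)) y<t))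
      (subst ((e₁ - ⟦ d ⟧) * (e₁ - ⟦ d ⟧) ≤_) (sym (gapCost-end (suc t) e₁ d)) (≤-+-⟦⟧ d))
      (*-zeroʳ (inv (512 ℕ.* len)))
      (ℕₚ.≤-trans N≤ (ℕₚ.*-monoʳ-≤ k (subst (τ₁ ℕ.≤_) (sym τ≡′) (ℕₚ.m≤m+n τ₁ i)))) τ≡′
      (trans (cong (λ z → ⟦ suc a ⟧ - p * z) (trans (cong ⟦_⟧ τ≡′) (⟦⟧-+ τ₁ i)))
        (trans (cong (_- p * (⟦ τ₁ ⟧ + ⟦ i ⟧)) rank) (rising-offset ⟦ r₁ ⟧ ⟦ c ⟧ ⟦ d ⟧ p ⟦ τ₁ ⟧ ⟦ i ⟧)))
    where
    e₁ : ℚ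
    e₁ = ⟦ r₁ ⟧ - p * ⟦ τ₁ ⟧
    rank : ⟦ suc a ⟧ ≡ ⟦ r₁ ⟧ + ⟦ c ⟧ - ⟦ d ⟧
    rank = trans (sum-minus-left ⟦ d ⟧ ⟦ suc a ⟧) (cong (_- ⟦ d ⟧) (trans (sym (⟦⟧-+ d (suc a)))
      (trans (cong ⟦_⟧ (trans (ℕₚ.+-suc d a) (trans (cong suc (sym y≡)) r≡))) (⟦⟧-+ r₁ c))))

  settled-falling : ∀ {t τ i len c y a b M m} τ₁ r₁ s d → Position t τ y M m →
    τ ≡ τ₁ ℕ.+ i → suc y ≡ r₁ ℕ.+ c → s ≡ 0 → b ≡ d ℕ.+ y → b ℕ.< t → 64 ℕ.* N ℕ.≤ k ℕ.* τ₁ →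
    Bounded t (boundary (st τ i len c down y a b M m))
      (windowPot t len s i τ₁ r₁ c (- (⟦ r₁ ⟧ - p * ⟦ τ₁ ⟧)) d)
  settled-falling {t} {τ} {i} {len} {c} {y} {a} {b} τ₁ r₁ s d (position τ≡ M≡ m≡ y<t) τ≡′ r≡ refl b≡ b<t N≤ =
    settled-window {c = c} (gapCost 0 (suc t) (- e₁) d) τ₁ r₁ i (e₁ + ⟦ d ⟧) (inv (512 ℕ.* len) * ⟦ 0 ⟧) b
      (position τ≡ M≡ m≡ b<t)
      (subst ((e₁ + ⟦ d ⟧) * (e₁ + ⟦ d ⟧) ≤_) (sym (trans (gapCost-end (suc t) (- e₁) d)
          (cong (_+ ⟦ d ⟧) (square-neg-difference e₁ ⟦ d ⟧)))) (≤-+-⟦⟧ d))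
      (*-zeroʳ (inv (512 ℕ.* len)))
      (ℕₚ.≤-trans N≤ (ℕₚ.*-monoʳ-≤ k (subst (τ₁ ℕ.≤_) (sym τ≡′) (ℕₚ.m≤m+n τ₁ i)))) τ≡′
      (trans (cong (λ z → ⟦ suc b ⟧ - p * z) (trans (cong ⟦_⟧ τ≡′) (⟦⟧-+ τ₁ i)))
        (trans (cong (_- p * (⟦ τ₁ ⟧ + ⟦ i ⟧)) rank) (falling-offset ⟦ r₁ ⟧ ⟦ c ⟧ ⟦ d ⟧ p ⟦ τ₁ ⟧ ⟦ i ⟧)))
    where
    e₁ : ℚ
    e₁ = ⟦ r₁ ⟧ - p * ⟦ τ₁ ⟧
    rank : ⟦ suc b ⟧ ≡ ⟦ d ⟧ + (⟦ r₁ ⟧ + ⟦ c ⟧)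
    rank = trans (cong ⟦_⟧ (trans (cong suc b≡) (trans (sym (ℕₚ.+-suc d y)) (cong (d ℕ.+_) r≡))))
      (trans (⟦⟧-+ d (r₁ ℕ.+ c)) (cong (⟦ d ⟧ +_) (⟦⟧-+ r₁ c)))

  block-length : ∀ {len s i} → len ≡ s ℕ.+ i → len ℕ.≤ i → s ≡ 0
  block-length {s = zero}      eq   len≤i = refl
  block-length {s = suc s} {i} refl len≤i = contradiction (ℕₚ.≤-trans (s≤s (ℕₚ.m≤n+m i s)) len≤i) ℕₚ.1+n≰n

  settled : ∀ {t σ v} → Arrived t σ v → Bounded t (settle σ) v
  settled (starting pos kτ≤) = settled-start pos kτ≤
  settled {t} (running (counting {i = i} {len} {c} τ₀ r₀ pos τ≡ r≡ i≤len c≤i r₀≤ lo hi N≤)) = decide (ℕₚ.≤-<-connex len i)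
    where
    τ₀>0 : 0 ℕ.< τ₀
    τ₀>0 = ℕₚ.n≢0⇒n>0 λ { refl → contradiction (subst (64 ℕ.* N ℕ.≤_) (ℕₚ.*-zeroʳ k) N≤) λ () }
    1≤len : 1 ℕ.≤ len
    1≤len = ℕₚ.n≢0⇒n>0 λ { refl → contradiction hi (ℕₚ.<⇒≱ τ₀>0) }
    at-end : i ≡ len → Bounded t _ _
    at-end refl = EndOfCount.settled-count pos τ≡ r≡ c≤i 1≤len hi N≤
    decide : _ ⊎ _ → Bounded t _ _
    decide (inj₁ len≤i) = subst (λ σ → Bounded t σ _) (sym (if-≤ len≤i)) (at-end (ℕₚ.≤-antisym i≤len len≤i))
    decide (inj₂ i<len) = _ , ≤-refl , subst (λ σ → Settled t σ _) (sym (if-> i<len))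
        (running (counting τ₀ r₀ pos τ≡ r≡ i<len c≤i r₀≤ lo hi N≤))
  settled {t} (running (rising-window {i = i} {len} τ₁ r₁ s d pos τ≡ r≡ i≤len len≡ y≡ len≤ N≤)) = decide (ℕₚ.≤-<-connex len i)
    where
    decide : _ ⊎ _ → Bounded t _ _
    decide (inj₁ len≤i) = subst (λ σ → Bounded t σ _) (sym (if-≤ len≤i))
        (settled-rising {len = len} τ₁ r₁ s d pos τ≡ r≡ (block-length len≡ len≤i) y≡ N≤)
    decide (inj₂ i<len) = _ , ≤-refl , subst (λ σ → Settled t σ _) (sym (if-> i<len))
        (running (rising-window τ₁ r₁ s d pos τ≡ r≡ i<len len≡ y≡ len≤ N≤))
  settled {t} (running (falling-window {i = i} {len} τ₁ r₁ s d pos τ≡ r≡ i≤len len≡ b≡ b<t len≤ N≤)) = decide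
      (ℕₚ.≤-<-connex len i)
    where
    decide : _ ⊎ _ → Bounded t _ _
    decide (inj₁ len≤i) = subst (λ σ → Bounded t σ _) (sym (if-≤ len≤i))
        (settled-falling {len = len} τ₁ r₁ s d pos τ≡ r≡ (block-length len≡ len≤i) b≡ b<t N≤)
    decide (inj₂ i<len) = _ , ≤-refl , subst (λ σ → Settled t σ _) (sym (if-> i<len))
        (running (falling-window τ₁ r₁ s d pos τ≡ r≡ i<len len≡ b≡ b<t len≤ N≤))

  -- Averaging over the last arrival replaces f by its conditional expectation one arrival earlier,
  -- which inherits the bound by the supermartingale property. For this the induction needs an
  -- arbitrary f.
  rankAverage-≤ : ∀ m (f : St ℕ → ℚ) → (∀ σ v → Settled (suc m) σ v → f σ ≤ ⟦ 4 ⟧ * v) →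
    rankAverage m f ≤ ⟦ 4 ⟧ * startPot p ⟦ N ⟧ ⟦ 2 ⟧
  rankAverage-≤ zero    f f≤ = f≤ (initial 0) _ (starting (position refl refl refl (s≤s z≤n)) 2k<64N)
    where
    2k<64N : k ℕ.* 2 ℕ.< 64 ℕ.* N
    2k<64N = subst (ℕ._< 64 ℕ.* N) (ℕₚ.*-comm 2 k) (ℕₚ.≤-<-trans (ℕₚ.*-monoˡ-≤ k {2} {64} (ℕₚ.≤ᵇ⇒≤ 2 64 _))
        (ℕₚ.*-monoʳ-< 64 (s≤s k≤n)))
  rankAverage-≤ (suc m) f f≤ = subst (_≤ ⟦ 4 ⟧ * startPot p ⟦ N ⟧ ⟦ 2 ⟧)
    (trans (rankAverage-* m (inv τ) _) (cong (inv τ *_) (sym (rankAverage-Σ m τ (λ g σ → f (next g σ))))))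
    (rankAverage-≤ m (λ σ → inv τ * Σ< τ (λ g → f (next g σ))) bound)
    where
    τ : ℕ
    τ = suc (suc m)
    next : ℕ → St ℕ → St ℕ
    next g σ = step _≽_ g (mapSt (lift g) σ)
    bound : ∀ σ v → Settled (suc m) σ v → inv τ * Σ< τ (λ g → f (next g σ)) ≤ ⟦ 4 ⟧ * v
    bound σ v σ-ok = conclude (averaged σ-ok)
      where
      next-≤ : ∀ g w → Arrived τ (arrive _≽_ g (mapSt (lift g) σ)) w → f (next g σ) ≤ ⟦ 4 ⟧ * w
      next-≤ g w arrived = conclude (settled arrived)
        where
        conclude : Bounded τ (next g σ) w → f (next g σ) ≤ ⟦ 4 ⟧ * w
        conclude (v′ , v′≤w , ok) = ≤-trans (f≤ (next g σ) v′ ok) (*-mono-≥0 (⟦⟧≥0 4) v′≤w)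
      conclude : Averaged (suc m) σ v → inv τ * Σ< τ (λ g → f (next g σ)) ≤ ⟦ 4 ⟧ * v
      conclude (w , arrived , Σw≤) = subst (inv τ * Σ< τ (λ g → f (next g σ)) ≤_)
          (trans (cong (inv τ *_) (swap-factor ⟦ 4 ⟧ ⟦ τ ⟧ v)) (inv-cancel (suc m) _))
        (*-mono-≥0 (inv≥0 τ) (≤-trans (Σ<-mono τ (λ g g<τ → next-≤ g (w g) (arrived g (ℕₚ.≤-pred g<τ))))
          (≤-trans (≤-reflexive (Σ<-* τ ⟦ 4 ⟧ w)) (*-mono-≥0 (⟦⟧≥0 4) Σw≤))))

  final-error : ∀ σ v → Settled n σ v → (⟦ suc (St.y σ) ⟧ - ⟦ k ⟧) * (⟦ suc (St.y σ) ⟧ - ⟦ k ⟧) ≤ ⟦ 4 ⟧ * v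
  -- Startup that lasts to the end of the stream means k < 64, and then the maximum has constant
  -- error.
  final-error σ v (starting {τ} (position refl _ _ _) kτ<) = subst (λ z → (1ℚ - z) * (1ℚ - z) ≤ ⟦ 4 ⟧ * v) pN≡k
    (≤-trans (block-final p ⟦ N ⟧ ⟦ N ⟧ 1ℚ p≥0 ≤-refl)
      (*-mono-≥0 (⟦⟧≥0 4) (start-block p ⟦ N ⟧ ⟦ N ⟧ (p≥0 ⊛ ⟦⟧≥0 N)
          (≤-trans (subst (_≤ ⟦ 65 ⟧) (sym (p-* N)) (inv-≥ n 65 (k ℕ.* N) kN≤)) (⟦⟧-mono (ℕₚ.≤ᵇ⇒≤ 65 67 _))))))
    where
    kN≤ : k ℕ.* N ℕ.≤ 65 ℕ.* N
    kN≤ = ℕₚ.≤-trans (ℕₚ.<⇒≤ kτ<) (ℕₚ.*-monoˡ-≤ N (ℕₚ.≤ᵇ⇒≤ 64 65 _))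
  final-error σ v (running (counting {i = i} {suc l} {c} {y} τ₀ r₀ (position refl _ _ _) τ≡ r≡ (s≤s i≤l) _ _ _ _ _)) =
    subst (λ z → z * z ≤ ⟦ 4 ⟧ * v) (sym (cong₂ _-_ (⟦⟧-rank y r₀ c r≡) (trans (sym pN≡k) (cong (p *_) (⟦⟧-rank n τ₀ i τ≡)))))
      (count-final (inv (suc l)) p ⟦ N ⟧ ⟦ i ⟧ ⟦ τ₀ ⟧ ⟦ r₀ ⟧ ⟦ c ⟧ p≥0 (⟦⟧≥0 i) iƛ≤1 (≤-reflexive (sym (⟦⟧-rank n τ₀ i τ≡))))
    where
    iƛ≤1 : ⟦ i ⟧ * inv (suc l) ≤ 1ℚ
    iƛ≤1 = subst (_≤ 1ℚ) (*-comm (inv (suc l)) ⟦ i ⟧)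
        (inv-≥ l 1 i (subst (i ℕ.≤_) (sym (ℕₚ.+-identityʳ (suc l))) (ℕₚ.m≤n⇒m≤1+n i≤l)))
  final-error σ v (running (rising-window {i = i} {len} {c} {y} {a} τ₁ r₁ s d (position refl _ _ y<t) τ≡ r≡ _ _ y≡ _ _)) =
    subst (λ z → z * z ≤ ⟦ 4 ⟧ * v) (sym (cong₂ _-_ (⟦⟧-rank y r₁ c r≡) (trans (sym pN≡k) (cong (p *_) (⟦⟧-rank n τ₁ i τ≡)))))
      (window-final p ⟦ N ⟧ (inv (512 ℕ.* len) * ⟦ s ⟧) ⟦ i ⟧ ⟦ τ₁ ⟧ ⟦ r₁ ⟧ ⟦ c ⟧ (gapCost s (suc n) (⟦ r₁ ⟧ - p * ⟦ τ₁ ⟧) d) p≥0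
          (inv≥0 (512 ℕ.* len) ⊛ ⟦⟧≥0 s)
        (gapCost≥0 s n (⟦ r₁ ⟧ - p * ⟦ τ₁ ⟧) d (ℕₚ.≤-trans (subst (d ℕ.≤_) (sym y≡) (ℕₚ.m≤m+n d a)) (ℕₚ.<⇒≤ (ℕₚ.m<n⇒m<1+n y<t))))
        (≤-reflexive (sym (⟦⟧-rank n τ₁ i τ≡))))
  final-error σ v (running (falling-window {i = i} {len} {c} {y} {a} {b} τ₁ r₁ s d (position refl _ _ y<t) τ≡ r≡ _ _ b≡ b<t _
      _)) =
    subst (λ z → z * z ≤ ⟦ 4 ⟧ * v) (sym (cong₂ _-_ (⟦⟧-rank y r₁ c r≡) (trans (sym pN≡k) (cong (p *_) (⟦⟧-rank n τ₁ i τ≡)))))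
      (window-final p ⟦ N ⟧ (inv (512 ℕ.* len) * ⟦ s ⟧) ⟦ i ⟧ ⟦ τ₁ ⟧ ⟦ r₁ ⟧ ⟦ c ⟧ (gapCost s (suc n) (- (⟦ r₁ ⟧ - p * ⟦ τ₁ ⟧)) d)
          p≥0 (inv≥0 (512 ℕ.* len) ⊛ ⟦⟧≥0 s)
        (gapCost≥0 s n (- (⟦ r₁ ⟧ - p * ⟦ τ₁ ⟧)) d (ℕₚ.≤-trans (subst (d ℕ.≤_) (sym b≡) (ℕₚ.m≤m+n d y))
            (ℕₚ.<⇒≤ (ℕₚ.m<n⇒m<1+n b<t))))
        (≤-reflexive (sym (⟦⟧-rank n τ₁ i τ≡))))

  startPot-≤ : startPot p ⟦ N ⟧ ⟦ 2 ⟧ ≤ ⟦ 34848 ⟧ + ⟦ 2 ⟧ * (γ * ⟦ k ⟧)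
  startPot-≤ = by-cert (⟦ 4 ⟧ * (γ * p)) (trans (cong (λ z → ⟦ 34848 ⟧ + ⟦ 2 ⟧ * (γ * z) - startPot p ⟦ N ⟧ ⟦ 2 ⟧) (sym pN≡k))
      (startPot-identity γ p ⟦ N ⟧)) (⟦⟧≥0 4 ⊛ (γ≥0 ⊛ p≥0))

-- The program for the word RAM

module WordProgram where

  open import Defs
  open import Data.Integer.Base using (+_)

  -- Memory map: 0 n, 1 k, 2 τ, 3 y, 4 a, 5 b, 6 M, 7 m, 8 the arrival, 9 mode,
  -- 10 i, 11 len, 12 c, 13 n + 1, 17 the constant 1; 14, 15, 16, 18, 19 scratch.

  setup : Program
  setup = const 17 (+ 1) ⨾ arith 13 add 0 17 ⨾ const 2 (+ 2)

  spread : Program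
  spread = copy 4 3 ⨾ copy 5 3 ⨾ copy 6 3 ⨾ copy 7 3

  receive : Program
  receive =
      (if 3 ≤ 8 then arith 12 add 12 17 ⨾ (if 8 ≤ 4 then copy 4 8 else skip)
                else (if 5 ≤ 8 then copy 5 8 else skip))
    ⨾ (if 6 ≤ 8 then copy 6 8 else skip)
    ⨾ (if 8 ≤ 7 then copy 7 8 else skip)
    ⨾ arith 10 add 10 17
    ⨾ arith 2 add 2 17

  startCount : Program
  startCount = const 9 (+ 1) ⨾ const 10 (+ 0) ⨾ const 12 (+ 0) ⨾ const 14 (+ 64) ⨾ arith 11 quo 2 14

  -- Expects q in word 14, `N * len` in word 15 and the code of the direction in word 16, which is
  -- reused for the constant 2 once the code has been copied.
  startWindow : Program
  startWindow = copy 9 16 ⨾ const 10 (+ 0) ⨾ const 12 (+ 0) ⨾ copy 4 6 ⨾ copy 5 7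
    ⨾ const 16 (+ 2) ⨾ arith 15 mul 16 15 ⨾ arith 11 quo 15 14

  endStartup : Program
  endStartup = copy 3 6 ⨾ const 14 (+ 64) ⨾ arith 14 mul 14 13 ⨾ arith 15 mul 1 2
    ⨾ (if 14 ≤ 15 then startCount else skip)

  endCount : Program
  endCount = arith 14 mul 12 13 ⨾ arith 15 mul 1 11
    ⨾ (if 15 ≤ 14 then arith 14 sub 14 15 ⨾ const 16 (+ 2) else (arith 14 sub 15 14 ⨾ const 16 (+ 3)))
    ⨾ arith 15 mul 13 11 ⨾ const 18 (+ 1024) ⨾ arith 18 mul 18 15 ⨾ arith 19 mul 2 14
    ⨾ (if 18 ≤ 19 then startWindow else startCount)

  endWindow : Program
  endWindow = const 14 (+ 2) ⨾ (if 9 ≤ 14 then copy 3 4 else copy 3 5) ⨾ startCount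

  endBlock : Program
  endBlock = const 14 (+ 0) ⨾ (if 9 ≤ 14 then endStartup else (if 9 ≤ 17 then endCount else endWindow))

  body : Program
  body = next 8 ⨾ receive ⨾ (if 11 ≤ 10 then endBlock else skip)

  -- As τ is one more than the number of elements read, τ ≤ n means that another one is still to
  -- come.
  mainLoop : Program
  mainLoop = while 2 ≤ 0 loop body

  program : Program
  program = setup ⨾ next 3 ⨾ spread ⨾ mainLoop ⨾ copy 0 3

  branch : Addr → Addr → Program → Program → Program
  branch a b P Q = if a ≤ b then P else Q

  iterate : Addr → Addr → Program → Program
  iterate a b P = while a ≤ b loop P

-- Symbolic execution: the program simulates the abstract algorithm

module ProgramExecution where

  open import Defs
  open Estimator
  open WordProgram
  open import Data.Bool.Base using (if_then_else_; T)
  open import Data.Fin.Base using (fromℕ<)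
  open import Data.Integer.Base using (+_)
  import Data.Integer.Properties as ℤₚ
  open import Data.List.Base using (List; []; _∷_; foldl; length)
  open import Data.Nat.Base
  open import Data.Nat.Properties
  open import Data.Unit.Base using (⊤)
  open import Data.Vec.Base using (Vec; _∷_; lookup; replicate; _[_]≔_)
  open import Relation.Binary.Bundles using (DecTotalOrder)
  open import Relation.Nullary.Decidable using (dec-true)

  code : Mode → ℕ
  code startup = 0
  code count   = 1
  code up      = 2
  code down    = 3

  -- Memory has `20 + e` words, so that any size from twenty on is covered. The bound on B
  -- accommodates the largest products, `τ * q` ≤ N³ and `1024 * (N * len)`.
  module Execution (O : DecTotalOrder 0ℓ 0ℓ 0ℓ) (e B n k : ℕ) (k≤n : k ≤ n)
                   (B≥ : 1024 * (suc n * (suc n * suc n)) ≤ B) where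

    open DecTotalOrder O using (Carrier) renaming (_≤?_ to _≤ᴼ?_)

    s N : ℕ
    s = 20 + e
    N = suc n

    open Machine O s B
    open Algorithm N k

    infix 4 _≼_
    _≼_ : Carrier → Carrier → Bool
    u ≼ v = does (u ≤ᴼ? v)

    Memory : Set
    Memory = Vec (Word Carrier) s

    get : (a : ℕ) {_ : T (a <ᵇ s)} → Memory → Word Carrier
    get a {p} μ = lookup μ (fromℕ< (<ᵇ⇒< a s p))

    set : (a : ℕ) {_ : T (a <ᵇ s)} → Word Carrier → Memory → Memory
    set a {p} w μ = μ [ fromℕ< (<ᵇ⇒< a s p) ]≔ w

    read-ok : ∀ a {p} μ xs → read a ⟨ μ , xs ⟩ ≡ return (get a {p} μ)
    read-ok a {p} μ xs with a <? s
    ... | yes _   = refl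
    ... | no  a≮s = contradiction (<ᵇ⇒< a s p) a≮s

    write-ok : ∀ a {p} w μ xs → fits w ≡ true → write a w ⟨ μ , xs ⟩ ≡ return ⟨ set a {p} w μ , xs ⟩
    write-ok a {p} w μ xs fit with a <? s | fits w
    ... | yes _   | true  = refl
    ... | no  a≮s | _     = contradiction (<ᵇ⇒< a s p) a≮s
    write-ok a {p} w μ xs () | yes _ | false

    fits-int : ∀ {z} → z ≤ B → fits (int (+ z)) ≡ true
    fits-int {z} z≤B = dec-true (z ≤? B) z≤B

    -- Deterministic code that leaves the stream alone. As a record it exposes program and memories
    -- to unification without unfolding `exec`.
    record Runs (t : ℕ) (xs : List Carrier) (P : Program) (μ μ′ : Memory) : Set where
      constructor runs
      field run-≡ : exec t P ⟨ μ , xs ⟩ ≡ return ⟨ μ′ , xs ⟩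

    open Runs

    module _ {t : ℕ} {xs : List Carrier} where

      const-ok : ∀ {a p μ} z → z ≤ B → Runs t xs (const a (+ z)) μ (set a {p} (int (+ z)) μ)
      const-ok {a} {p} {μ} z z≤B = runs (write-ok a {p} (int (+ z)) μ xs (fits-int z≤B))

      copy-ok : ∀ {a b p q μ} w → get b {q} μ ≡ w → fits w ≡ true → Runs t xs (copy a b) μ (set a {p} w μ)
      copy-ok {a} {b} {p} {q} {μ} w refl fit =
        runs (trans (cong (_>>= (λ w → write a w ⟨ μ , xs ⟩)) (read-ok b {q} μ xs)) (write-ok a {p} w μ xs fit))

      arith-ok : ∀ {a op b c p q r μ} x y z → get b {q} μ ≡ int (+ x) → get c {r} μ ≡ int (+ y) →
        applyOp op (+ x) (+ y) ≡ return (+ z) → z ≤ B → Runs t xs (arith a op b c) μ (set a {p} (int (+ z)) μ)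
      arith-ok {a} {op} {b} {c} {p} {q} {r} {μ} x y z b≡ c≡ op≡ z≤B = runs proof
        where
        proof : exec t (arith a op b c) ⟨ μ , xs ⟩ ≡ return ⟨ set a {p} (int (+ z)) μ , xs ⟩
        proof rewrite read-ok b {q} μ xs | b≡ | read-ok c {r} μ xs | c≡ | op≡ = write-ok a {p} (int (+ z)) μ xs (fits-int z≤B)

      skip-ok : ∀ {μ} → Runs t xs skip μ μ
      skip-ok = runs refl

      branch-≤ : ∀ {a b P Q p q μ μ′} x y → get a {p} μ ≡ int (+ x) → get b {q} μ ≡ int (+ y) →
        x ≤ y → Runs t xs P μ μ′ → Runs t xs (branch a b P Q) μ μ′
      branch-≤ {a} {b} {P} {Q} {p} {q} {μ} {μ′} x y a≡ b≡ x≤y (runs h) = runs proof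
        where
        proof : exec t (branch a b P Q) ⟨ μ , xs ⟩ ≡ return ⟨ μ′ , xs ⟩
        proof rewrite read-ok a {p} μ xs | a≡ | read-ok b {q} μ xs | b≡ | ≤ᵇ-true x≤y = h

      branch-> : ∀ {a b P Q p q μ μ′} x y → get a {p} μ ≡ int (+ x) → get b {q} μ ≡ int (+ y) →
        y < x → Runs t xs Q μ μ′ → Runs t xs (branch a b P Q) μ μ′
      branch-> {a} {b} {P} {Q} {p} {q} {μ} {μ′} x y a≡ b≡ y<x (runs h) = runs proof
        where
        proof : exec t (branch a b P Q) ⟨ μ , xs ⟩ ≡ return ⟨ μ′ , xs ⟩
        proof rewrite read-ok a {p} μ xs | a≡ | read-ok b {q} μ xs | b≡ | ≤ᵇ-false y<x = h

      -- Both outcomes are given by one function of the comparison, so that the resulting memory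
      -- matches the conditionals in `arrive`.
      branch-≼ : ∀ {a b P Q p q μ} u v (f : Bool → Memory) → get a {p} μ ≡ elem u → get b {q} μ ≡ elem v →
        Runs t xs P μ (f true) → Runs t xs Q μ (f false) → Runs t xs (branch a b P Q) μ (f (u ≼ v))
      branch-≼ {a} {b} {P} {Q} {p} {q} {μ} u v f a≡ b≡ (runs h₁) (runs h₂) = runs proof
        where
        proof : exec t (branch a b P Q) ⟨ μ , xs ⟩ ≡ return ⟨ f (u ≼ v) , xs ⟩
        proof rewrite read-ok a {p} μ xs | a≡ | read-ok b {q} μ xs | b≡ with u ≼ v
        ... | true  = h₁
        ... | false = h₂

      infixr 5 _then_

      _then_ : ∀ {P Q μ μ′ μ″} → Runs t xs P μ μ′ → Runs t xs Q μ′ μ″ → Runs t xs (P ⨾ Q) μ μ″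
      _then_ {Q = Q} (runs h₁) (runs h₂) = runs (trans (cong (_>>= exec t Q) h₁) h₂)

    while-≤ : ∀ {t a b P p q μ xs} x y → get a {p} μ ≡ int (+ x) → get b {q} μ ≡ int (+ y) → x ≤ y →
      exec (suc t) (iterate a b P) ⟨ μ , xs ⟩ ≡ (exec (suc t) P ⟨ μ , xs ⟩ >>= exec t (iterate a b P))
    while-≤ {a = a} {b} {p = p} {q} {μ} {xs} x y a≡ b≡ x≤y
      rewrite read-ok a {p} μ xs | a≡ | read-ok b {q} μ xs | b≡ | ≤ᵇ-true x≤y = refl

    while-> : ∀ {t a b P p q μ xs} x y → get a {p} μ ≡ int (+ x) → get b {q} μ ≡ int (+ y) → y < x →
      exec (suc t) (iterate a b P) ⟨ μ , xs ⟩ ≡ return ⟨ μ , xs ⟩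
    while-> {a = a} {b} {p = p} {q} {μ} {xs} x y a≡ b≡ y<x
      rewrite read-ok a {p} μ xs | a≡ | read-ok b {q} μ xs | b≡ | ≤ᵇ-false y<x = refl

    -- τ ≥ 64 gives the next count block a positive length. In count mode the length enters products
    -- and a division, hence the two bounds on it.
    ModeFits : Mode → ℕ → ℕ → Set
    ModeFits startup τ len = ⊤
    ModeFits count   τ len = 64 ≤ τ × 1 ≤ len × len ≤ τ
    ModeFits up      τ len = 64 ≤ τ
    ModeFits down    τ len = 64 ≤ τ

    record Fits (σ : St Carrier) : Set where
      constructor fits-in
      field
        i≤τ  : St.i σ ≤ St.τ σ
        c≤τ  : St.c σ ≤ St.τ σ
        mode-fits : ModeFits (St.mode σ) (St.τ σ) (St.len σ)

    open Fits

    countBlock-fits : ∀ σ → 64 ≤ St.τ σ → Fits (countBlock σ)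
    countBlock-fits (st τ i len c mode y a b M m) 64≤τ = fits-in z≤n z≤n (64≤τ , ℕᵈ.m≥n⇒m/n>0 64≤τ , ℕᵈ.m/n≤m τ 64)

    if-elim : ∀ {A : Set} (P : A → Set) β {x y} → P x → P y → P (if β then x else y)
    if-elim P true  px py = px
    if-elim P false px py = py

    boundary-fits : ∀ σ → Fits σ → Fits (boundary σ)
    boundary-fits (st τ i len c startup y a b M m) (fits-in i≤ c≤ _) = decide (≤-<-connex (64 * N) (k * τ))
      where
      decide : _ ⊎ _ → Fits (boundary (st τ i len c startup y a b M m))
      decide (inj₁ N≤) = if-elim Fits (64 * N ≤ᵇ k * τ) (countBlock-fits (st τ i len c startup M a b M m)
        (*-cancelʳ-≤ 64 τ N (≤-trans N≤ (subst (_≤ τ * N) (*-comm τ k) (*-monoʳ-≤ τ (m≤n⇒m≤1+n k≤n)))))) (fits-in i≤ c≤ _)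
      decide (inj₂ <N) = subst Fits (sym (cong (λ β → if β then countBlock σ′ else σ′) (≤ᵇ-false <N))) (fits-in i≤ c≤ _)
        where
        σ′ : St Carrier
        σ′ = st τ i len c startup M a b M m
    boundary-fits σ@(st τ i len c count y a b M m) (fits-in i≤ c≤ (64≤τ , _)) =
      if-elim Fits (k * len ≤ᵇ c * N) (aim-fits up (c * N ∸ k * len) λ _ → 64≤τ) (aim-fits down (k * len ∸ c * N) λ _ → 64≤τ)
      where
      aim-fits : ∀ dir q → (∀ len → ModeFits dir τ len) → Fits (aim dir q σ)
      aim-fits dir q ok = if-elim Fits (1024 * (N * len) ≤ᵇ τ * q) (fits-in z≤n z≤n (ok _)) (countBlock-fits σ 64≤τ)
    boundary-fits (st τ i len c up y a b M m) (fits-in i≤ c≤ 64≤τ) = countBlock-fits (st τ i len c up a a b M m) 64≤τ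
    boundary-fits (st τ i len c down y a b M m) (fits-in i≤ c≤ 64≤τ) = countBlock-fits (st τ i len c down b a b M m) 64≤τ

    arrive-fits : ∀ z σ → Fits σ → Fits (arrive _≼_ z σ)
    arrive-fits z (st τ i len c mode y a b M m) (fits-in i≤ c≤ ok) = fits-in (s≤s i≤) (c′≤ (y ≼ z)) (mode-step mode ok)
      where
      c′≤ : ∀ β → (if β then suc c else c) ≤ suc τ
      c′≤ true  = s≤s c≤
      c′≤ false = m≤n⇒m≤1+n c≤
      mode-step : ∀ mode → ModeFits mode τ len → ModeFits mode (suc τ) len
      mode-step startup ok = ok
      mode-step count   (64≤τ , 1≤len , len≤τ) = m≤n⇒m≤1+n 64≤τ , 1≤len , m≤n⇒m≤1+n len≤τ
      mode-step up      ok = m≤n⇒m≤1+n ok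
      mode-step down    ok = m≤n⇒m≤1+n ok

    step-fits : ∀ z σ → Fits σ → Fits (step _≼_ z σ)
    step-fits z σ ok = if-elim Fits (St.len σ ≤ᵇ suc (St.i σ)) (boundary-fits (arrive _≼_ z σ) (arrive-fits z σ ok))
        (arrive-fits z σ ok)

    boundary-τ : (σ : St Carrier) → St.τ (boundary σ) ≡ St.τ σ
    boundary-τ (st τ i len c startup y a b M m) = if-elim (λ σ → St.τ σ ≡ τ) (64 * N ≤ᵇ k * τ) refl refl
    boundary-τ σ@(st τ i len c count y a b M m) = if-elim (λ σ → St.τ σ ≡ τ) (k * len ≤ᵇ c * N)
      (if-elim (λ σ → St.τ σ ≡ τ) (1024 * (N * len) ≤ᵇ τ * (c * N ∸ k * len)) refl refl)
      (if-elim (λ σ → St.τ σ ≡ τ) (1024 * (N * len) ≤ᵇ τ * (k * len ∸ c * N)) refl refl)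
    boundary-τ (st τ i len c up y a b M m)   = refl
    boundary-τ (st τ i len c down y a b M m) = refl

    step-τ : ∀ z (σ : St Carrier) → St.τ (step _≼_ z σ) ≡ suc (St.τ σ)
    step-τ z σ = if-elim (λ σ′ → St.τ σ′ ≡ suc (St.τ σ)) (St.len σ ≤ᵇ suc (St.i σ)) (boundary-τ (arrive _≼_ z σ)) refl

    record Scratch : Set where
      constructor scratch
      field w₈ w₁₄ w₁₅ w₁₆ w₁₈ w₁₉ : Word Carrier

    module _ (rest : Vec (Word Carrier) e) where

      layout : St Carrier → Scratch → Memory
      layout (st τ i len c mode y a b M m) (scratch w₈ w₁₄ w₁₅ w₁₆ w₁₈ w₁₉) =
        int (+ n) ∷ int (+ k) ∷ int (+ τ) ∷ elem y ∷ elem a ∷ elem b ∷ elem M ∷ elem m ∷ w₈ ∷ int (+ code mode)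
        ∷ int (+ i) ∷ int (+ len) ∷ int (+ c) ∷ int (+ N) ∷ w₁₄ ∷ w₁₅ ∷ w₁₆ ∷ int (+ 1) ∷ w₁₈ ∷ w₁₉ ∷ rest

      module _ (t : ℕ) (xs : List Carrier) where

        Reaches : Program → St Carrier → Scratch → St Carrier → Set
        Reaches P σ S σ′ = ∃[ S′ ] Runs t xs P (layout σ S) (layout σ′ S′)

        receive-ok : ∀ {τ i len c mode y a b M m} z w₁₄ w₁₅ w₁₆ w₁₈ w₁₉ → suc c ≤ B → suc i ≤ B → suc τ ≤ B →
          Reaches receive (st τ i len c mode y a b M m) (scratch (elem z) w₁₄ w₁₅ w₁₆ w₁₈ w₁₉)
                          (arrive _≼_ z (st τ i len c mode y a b M m))
        receive-ok {τ} {i} {len} {c} {mode} {y} {a} {b} {M} {m} z w₁₄ w₁₅ w₁₆ w₁₈ w₁₉ c< i< τ< = S ,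
          ( branch-≼ y z f refl refl
              (arith-ok c 1 (suc c) refl refl (cong (λ x → return (+ x)) (+-comm c 1)) c<
                then branch-≼ z a f₁ refl refl (copy-ok (elem z) refl refl) (skip-ok))
              (branch-≼ b z f₂ refl refl (copy-ok (elem z) refl refl) (skip-ok))
          then branch-≼ M z f₃ refl refl (copy-ok (elem z) refl refl) (skip-ok)
          then branch-≼ z m f₄ refl refl (copy-ok (elem z) refl refl) (skip-ok)
          then arith-ok i 1 (suc i) refl refl (cong (λ x → return (+ x)) (+-comm i 1)) i<
          then arith-ok τ 1 (suc τ) refl refl (cong (λ x → return (+ x)) (+-comm τ 1)) τ<)
          where
          S : Scratch
          S = scratch (elem z) w₁₄ w₁₅ w₁₆ w₁₈ w₁₉
          c′ : Bool → ℕ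
          c′ β = if β then suc c else c
          a′ b′ : Bool → Carrier
          a′ β = if β then (if z ≼ a then z else a) else a
          b′ β = if β then b else (if b ≼ z then z else b)
          f f₁ f₂ f₃ f₄ : Bool → Memory
          f  β = layout (st τ i len (c′ β) mode y (a′ β) (b′ β) M m) S
          f₁ β = layout (st τ i len (suc c) mode y (if β then z else a) b M m) S
          f₂ β = layout (st τ i len c mode y a (if β then z else b) M m) S
          f₃ β = layout (st τ i len (c′ (y ≼ z)) mode y (a′ (y ≼ z)) (b′ (y ≼ z)) (if β then z else M) m) S
          f₄ β = layout (st τ i len (c′ (y ≼ z)) mode y (a′ (y ≼ z)) (b′ (y ≼ z)) (if M ≼ z then z else M) (if β then z else m)) S

        private
          mul≡ : ∀ x y → applyOp mul (+ x) (+ y) ≡ return (+ (x * y))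
          mul≡ x y = cong return (sym (ℤₚ.pos-* x y))

          sub≡ : ∀ x y → y ≤ x → applyOp sub (+ x) (+ y) ≡ return (+ (x ∸ y))
          sub≡ x y y≤x = cong return (trans (ℤₚ.[+m]-[+n]≡m⊖n x y) (ℤₚ.⊖-≥ y≤x))

          quo≡ : ∀ x {y} → 0 < y → applyOp quo (+ x) (+ y) ≡ return (+ quotient x y)
          quo≡ x {suc y} _ = cong return (ℤₚ.*-identityˡ (+ (x / suc y)))

          within : ∀ {a x} → a ≤ 1024 → x ≤ N * (N * N) → a * x ≤ B
          within a≤ x≤ = ≤-trans (*-mono-≤ a≤ x≤) B≥

          1≤1024 : 1 ≤ 1024
          1≤1024 = s≤s z≤n

          N≤N² : N ≤ N * N
          N≤N² = m≤m*n N N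

          N²≤N³ : N * N ≤ N * (N * N)
          N²≤N³ = *-monoʳ-≤ N N≤N²

          N²-fits : ∀ {a x} → a ≤ 1024 → x ≤ N * N → a * x ≤ B
          N²-fits a≤ x≤ = within a≤ (≤-trans x≤ N²≤N³)

          small : ∀ {x} → x ≤ N * (N * N) → x ≤ B
          small {x} x≤ = subst (_≤ B) (+-identityʳ x) (within 1≤1024 x≤)

          constant : ∀ {a} → a ≤ 1024 → a ≤ B
          constant {a} a≤ = subst (_≤ B) (*-identityʳ a) (within a≤ (s≤s z≤n))

          product : ∀ {x y} → x ≤ N → y ≤ N → x * y ≤ B
          product x≤ y≤ = small (≤-trans (*-mono-≤ x≤ y≤) N²≤N³)

        startCount-ok : ∀ σ S → St.τ σ ≤ N → Reaches startCount σ S (countBlock σ)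
        startCount-ok σ@(st τ i len c mode y a b M m) S@(scratch w₈ w₁₄ w₁₅ w₁₆ w₁₈ w₁₉) τ≤N =
          scratch w₈ (int (+ 64)) w₁₅ w₁₆ w₁₈ w₁₉ ,
          ( const-ok 1 (constant 1≤1024)
          then const-ok 0 z≤n
          then const-ok 0 z≤n
          then const-ok 64 (constant (≤ᵇ⇒≤ 64 1024 _))
          then arith-ok τ 64 (τ / 64) refl refl (quo≡ τ (s≤s z≤n))
              (small (≤-trans (ℕᵈ.m/n≤m τ 64) (≤-trans τ≤N (≤-trans N≤N² N²≤N³)))))

        startWindow-ok : ∀ dir q σ w₈ w₁₈ w₁₉ → 0 < q → St.len σ ≤ N →
          Reaches startWindow σ (scratch w₈ (int (+ q)) (int (+ (N * St.len σ))) (int (+ code dir)) w₁₈ w₁₉)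
                  (window dir (quotient (2 * (N * St.len σ)) q) σ)
        startWindow-ok dir q (st τ i len c mode y a b M m) w₈ w₁₈ w₁₉ 0<q len≤N =
          scratch w₈ (int (+ q)) (int (+ (2 * (N * len)))) (int (+ 2)) w₁₈ w₁₉ ,
          ( copy-ok (int (+ code dir)) refl (fits-int (code≤ dir))
          then const-ok 0 z≤n
          then const-ok 0 z≤n
          then copy-ok (elem M) refl refl
          then copy-ok (elem m) refl refl
          then const-ok 2 (constant (≤ᵇ⇒≤ 2 1024 _))
          then arith-ok 2 (N * len) (2 * (N * len)) refl refl (mul≡ 2 (N * len)) 2X≤
          then arith-ok (2 * (N * len)) q (quotient (2 * (N * len)) q) refl refl (quo≡ (2 * (N * len)) 0<q)
              (≤-trans (quotient-≤ q) 2X≤))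
          where
          2X≤ : 2 * (N * len) ≤ B
          2X≤ = N²-fits (≤ᵇ⇒≤ 2 1024 _) (*-monoʳ-≤ N len≤N)
          code≤ : ∀ dir → code dir ≤ B
          code≤ startup = z≤n
          code≤ count   = constant 1≤1024
          code≤ up      = constant (≤ᵇ⇒≤ 2 1024 _)
          code≤ down    = constant (≤ᵇ⇒≤ 3 1024 _)
          quotient-≤ : ∀ {x} q → quotient x q ≤ x
          quotient-≤ zero        = z≤n
          quotient-≤ {x} (suc q) = ℕᵈ.m/n≤m x (suc q)

        endStartup-ok : ∀ {τ i len c y a b M m} S → τ ≤ N →
          Reaches endStartup (st τ i len c startup y a b M m) S (boundary (st τ i len c startup y a b M m))
        endStartup-ok {τ} {i} {len} {c} {y} {a} {b} {M} {m} S@(scratch w₈ w₁₄ w₁₅ w₁₆ w₁₈ w₁₉) τ≤N = decide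
            (≤-<-connex (64 * N) (k * τ))
          where
          σ σ′ : St Carrier
          σ  = st τ i len c startup y a b M m
          σ′ = st τ i len c startup M a b M m
          S′ : Scratch
          S′ = scratch w₈ (int (+ (64 * N))) (int (+ (k * τ))) w₁₆ w₁₈ w₁₉
          prepare : ∀ {μ} → Runs t xs (branch 14 15 startCount skip) (layout σ′ S′) μ → Runs t xs endStartup (layout σ S) μ
          prepare h =
              copy-ok (elem M) refl refl
            then const-ok 64 (constant (≤ᵇ⇒≤ 64 1024 _))
            then arith-ok 64 N (64 * N) refl refl (mul≡ 64 N) (within (≤ᵇ⇒≤ 64 1024 _) (≤-trans N≤N² N²≤N³))
            then arith-ok k τ (k * τ) refl refl (mul≡ k τ) (product (m≤n⇒m≤1+n k≤n) τ≤N)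
            then h
          decide : _ ⊎ _ → Reaches endStartup σ S (boundary σ)
          decide (inj₁ N≤) = subst (Reaches endStartup σ S) (sym (cong (λ β → if β then countBlock σ′ else σ′) (≤ᵇ-true N≤)))
            (let S″ , h = startCount-ok σ′ S′ τ≤N in S″ , prepare (branch-≤ (64 * N) (k * τ) refl refl N≤ h))
          decide (inj₂ <N) = subst (Reaches endStartup σ S) (sym (cong (λ β → if β then countBlock σ′ else σ′) (≤ᵇ-false <N)))
            (S′ , prepare (branch-> (64 * N) (k * τ) refl refl <N (skip-ok)))

        endCount-ok : ∀ {τ i len c y a b M m} S → τ ≤ N → c ≤ N → 1 ≤ len → len ≤ N →
          Reaches endCount (st τ i len c count y a b M m) S (boundary (st τ i len c count y a b M m))
        endCount-ok {τ} {i} {len} {c} {y} {a} {b} {M} {m} S@(scratch w₈ w₁₄ w₁₅ w₁₆ w₁₈ w₁₉) τ≤N c≤N 1≤len len≤N = decide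
            (≤-<-connex (k * len) (c * N))
          where
          σ : St Carrier
          σ = st τ i len c count y a b M m
          k≤N : k ≤ N
          k≤N = m≤n⇒m≤1+n k≤n
          rest-of : Program
          rest-of = arith 15 mul 13 11 ⨾ const 18 (+ 1024) ⨾ arith 18 mul 18 15 ⨾ arith 19 mul 2 14 ⨾ branch 18 19 startWindow
              startCount
          S₁ : Scratch
          S₁ = scratch w₈ (int (+ (c * N))) (int (+ (k * len))) w₁₆ w₁₈ w₁₉
          S₂ : Mode → ℕ → Scratch
          S₂ dir q = scratch w₈ (int (+ q)) (int (+ (k * len))) (int (+ code dir)) w₁₈ w₁₉
          S₃ : Mode → ℕ → Scratch
          S₃ dir q = scratch w₈ (int (+ q)) (int (+ (N * len))) (int (+ code dir)) (int (+ (1024 * (N * len)))) (int (+ (τ * q)))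
          aimed : ∀ dir q → q ≤ N * N → Reaches rest-of σ (S₂ dir q) (aim dir q σ)
          aimed dir q q≤ = choose (≤-<-connex (1024 * (N * len)) (τ * q))
            where
            prepare : ∀ {μ} → Runs t xs (branch 18 19 startWindow startCount) (layout σ (S₃ dir q)) μ → Runs t xs rest-of
                (layout σ (S₂ dir q)) μ
            prepare h =
                arith-ok N len (N * len) refl refl (mul≡ N len) (product ≤-refl len≤N)
              then const-ok 1024 (constant ≤-refl)
              then arith-ok 1024 (N * len) (1024 * (N * len)) refl refl (mul≡ 1024 (N * len)) (N²-fits ≤-refl (*-monoʳ-≤ N len≤N))
              then arith-ok τ q (τ * q) refl refl (mul≡ τ q) (small (*-mono-≤ τ≤N q≤))
              then h
            choose : _ ⊎ _ → Reaches rest-of σ (S₂ dir q) (aim dir q σ)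
            choose (inj₁ large) = subst (Reaches rest-of σ (S₂ dir q))
                (sym (cong (λ β → if β then window dir (quotient (2 * (N * len)) q) σ else countBlock σ) (≤ᵇ-true large)))
              (let S″ , h = startWindow-ok dir q σ w₈ _ _ q>0 len≤N in S″ , prepare (branch-≤ (1024 * (N * len)) (τ * q) refl refl large h))
              where
              -- For q = 0 the test would read 1024 N len ≤ 0, so a window never opens with a
              -- division by 0.
              q>0 : 0 < q
              q>0 = n≢0⇒n>0 λ { refl → contradiction (subst (1024 * (N * len) ≤_) (*-zeroʳ τ) large)
                  (<⇒≱ (*-mono-≤ {1} {1024} 1≤1024 (*-mono-≤ {1} {N} (s≤s z≤n) 1≤len))) }
            choose (inj₂ little) = subst (Reaches rest-of σ (S₂ dir q))
                (sym (cong (λ β → if β then window dir (quotient (2 * (N * len)) q) σ else countBlock σ) (≤ᵇ-false little)))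
              (let S″ , h = startCount-ok σ (S₃ dir q) τ≤N in S″ , prepare (branch-> (1024 * (N * len)) (τ * q) refl refl little h))
          prepare : ∀ {μ dir q} → Runs t xs (branch 15 14 (arith 14 sub 14 15 ⨾ const 16 (+ 2))
              (arith 14 sub 15 14 ⨾ const 16 (+ 3))) (layout σ S₁) (layout σ (S₂ dir q)) →
            Runs t xs rest-of (layout σ (S₂ dir q)) μ → Runs t xs endCount (layout σ S) μ
          prepare h h′ =
              arith-ok c N (c * N) refl refl (mul≡ c N) (product c≤N ≤-refl)
            then arith-ok k len (k * len) refl refl (mul≡ k len) (product k≤N len≤N)
            then h then h′
          decide : _ ⊎ _ → Reaches endCount σ S (boundary σ)
          decide (inj₁ ≤c) = subst (Reaches endCount σ S)
              (sym (cong (λ β → if β then aim up (c * N ∸ k * len) σ else aim down (k * len ∸ c * N) σ) (≤ᵇ-true ≤c)))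
            (let S″ , h = aimed up (c * N ∸ k * len) q≤ in S″ , prepare {dir = up} (branch-≤ (k * len) (c * N) refl refl ≤c
              (arith-ok (c * N) (k * len) (c * N ∸ k * len) refl refl (sub≡ (c * N) (k * len) ≤c) (small (≤-trans q≤ N²≤N³))
               then const-ok 2 (constant (≤ᵇ⇒≤ 2 1024 _)))) h)
            where
            q≤ : c * N ∸ k * len ≤ N * N
            q≤ = ≤-trans (m∸n≤m (c * N) (k * len)) (*-monoˡ-≤ N c≤N)
          decide (inj₂ c<) = subst (Reaches endCount σ S)
              (sym (cong (λ β → if β then aim up (c * N ∸ k * len) σ else aim down (k * len ∸ c * N) σ) (≤ᵇ-false c<)))
            (let S″ , h = aimed down (k * len ∸ c * N) q≤ in S″ , prepare {dir = down} (branch-> (k * len) (c * N) refl refl c<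
              (arith-ok (k * len) (c * N) (k * len ∸ c * N) refl refl (sub≡ (k * len) (c * N) (<⇒≤ c<)) (small (≤-trans q≤ N²≤N³))
               then const-ok 3 (constant (≤ᵇ⇒≤ 3 1024 _)))) h)
            where
            q≤ : k * len ∸ c * N ≤ N * N
            q≤ = ≤-trans (m∸n≤m (k * len) (c * N)) (*-mono-≤ k≤N len≤N)

        endBlock-ok : ∀ σ S → St.τ σ ≤ N → St.c σ ≤ St.τ σ → ModeFits (St.mode σ) (St.τ σ) (St.len σ) →
          Reaches endBlock σ S (boundary σ)
        endBlock-ok σ@(st τ i len c startup y a b M m) (scratch w₈ w₁₄ w₁₅ w₁₆ w₁₈ w₁₉) τ≤N c≤τ _ =
          let S′ , h = endStartup-ok (scratch w₈ (int (+ 0)) w₁₅ w₁₆ w₁₈ w₁₉) τ≤N in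
          S′ , (const-ok 0 z≤n then branch-≤ 0 0 refl refl z≤n h)
        endBlock-ok σ@(st τ i len c count y a b M m) (scratch w₈ w₁₄ w₁₅ w₁₆ w₁₈ w₁₉) τ≤N c≤τ (_ , 1≤len , len≤τ) =
          let S′ , h = endCount-ok (scratch w₈ (int (+ 0)) w₁₅ w₁₆ w₁₈ w₁₉) τ≤N (≤-trans c≤τ τ≤N) 1≤len (≤-trans len≤τ τ≤N) in
          S′ , (const-ok 0 z≤n then branch-> 1 0 refl refl (s≤s z≤n) (branch-≤ 1 1 refl refl ≤-refl h))
        endBlock-ok σ@(st τ i len c up y a b M m) (scratch w₈ w₁₄ w₁₅ w₁₆ w₁₈ w₁₉) τ≤N c≤τ _ =
          let S′ , h = startCount-ok (st τ i len c up a a b M m) (scratch w₈ (int (+ 2)) w₁₅ w₁₆ w₁₈ w₁₉) τ≤N in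
          S′ , (const-ok 0 z≤n then branch-> 2 0 refl refl (s≤s z≤n) (branch-> 2 1 refl refl (s≤s (s≤s z≤n))
            (const-ok 2 (constant (≤ᵇ⇒≤ 2 1024 _)) then branch-≤ 2 2 refl refl ≤-refl (copy-ok (elem a) refl refl) then h)))
        endBlock-ok σ@(st τ i len c down y a b M m) (scratch w₈ w₁₄ w₁₅ w₁₆ w₁₈ w₁₉) τ≤N c≤τ _ =
          let S′ , h = startCount-ok (st τ i len c down b a b M m) (scratch w₈ (int (+ 2)) w₁₅ w₁₆ w₁₈ w₁₉) τ≤N in
          S′ , (const-ok 0 z≤n then branch-> 3 0 refl refl (s≤s z≤n) (branch-> 3 1 refl refl (s≤s (s≤s z≤n))
            (const-ok 2 (constant (≤ᵇ⇒≤ 2 1024 _)) then branch-> 3 2 refl refl ≤-refl (copy-ok (elem b) refl refl) then h)))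

        settle-ok : ∀ σ S → St.τ σ ≤ N → Fits σ → Reaches (branch 11 10 endBlock skip) σ S (settle σ)
        settle-ok σ@(st τ i len c mode y a b M m) S@(scratch w₈ w₁₄ w₁₅ w₁₆ w₁₈ w₁₉) τ≤N ok = decide (≤-<-connex len i)
          where
          decide : _ ⊎ _ → Reaches (branch 11 10 endBlock skip) σ S (settle σ)
          decide (inj₁ len≤i) = subst (Reaches (branch 11 10 endBlock skip) σ S)
              (sym (cong (λ β → if β then boundary σ else σ) (≤ᵇ-true len≤i)))
            (let S′ , h = endBlock-ok σ S τ≤N (c≤τ ok) (mode-fits ok) in S′ , branch-≤ len i refl refl len≤i h)
          decide (inj₂ i<len) = subst (Reaches (branch 11 10 endBlock skip) σ S)
              (sym (cong (λ β → if β then boundary σ else σ) (≤ᵇ-false i<len)))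
            (S , branch-> len i refl refl i<len (skip-ok))

        body-ok : ∀ z σ S → St.τ σ ≤ n → Fits σ →
          ∃[ S′ ] exec t body ⟨ layout σ S , z ∷ xs ⟩ ≡ return ⟨ layout (step _≼_ z σ) S′ , xs ⟩
        body-ok z σ@(st τ i len c mode y a b M m) S@(scratch w₈ w₁₄ w₁₅ w₁₆ w₁₈ w₁₉) τ≤n ok =
          let S₁ , h₁ = receive-ok {τ} {i} {len} {c} {mode} {y} {a} {b} {M} {m} z w₁₄ w₁₅ w₁₆ w₁₈ w₁₉ (field-fits (c≤τ ok)) (field-fits (i≤τ ok)) (field-fits ≤-refl)
              S₂ , h₂ = settle-ok (arrive _≼_ z σ) S₁ (s≤s τ≤n) (arrive-fits z σ ok)
          in S₂ , trans (cong (_>>= exec t (receive ⨾ branch 11 10 endBlock skip)) (write-ok 8 (elem z) (layout σ S) xs refl))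
              (run-≡ (h₁ then h₂))
          where
          field-fits : ∀ {x} → x ≤ τ → suc x ≤ B
          field-fits x≤τ = small (≤-trans (s≤s (≤-trans x≤τ τ≤n)) (≤-trans N≤N² N²≤N³))

      -- The fuel is one unit per remaining element and one for the failing test.
      loop-ok : ∀ xs σ S → St.τ σ + length xs ≡ N → Fits σ →
        ∃[ S′ ] exec (suc (length xs)) mainLoop ⟨ layout σ S , xs ⟩ ≡ return
            ⟨ layout (foldl (λ σ z → step _≼_ z σ) σ xs) S′ , [] ⟩
      loop-ok [] σ@(st τ i len c mode y a b M m) S@(scratch w₈ w₁₄ w₁₅ w₁₆ w₁₈ w₁₉) τ≡ ok =
        S , while-> {0} {2} {0} {body} {μ = layout σ S} {[]} τ n refl refl (subst (n <_) (trans (sym τ≡) (+-identityʳ τ)) ≤-refl)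
      loop-ok (z ∷ xs) σ@(st τ i len c mode y a b M m) S@(scratch w₈ w₁₄ w₁₅ w₁₆ w₁₈ w₁₉) τ≡ ok =
        let S₁ , h₁ = body-ok (suc (suc (length xs))) xs z σ S τ≤n ok
            S₂ , h₂ = loop-ok xs (step _≼_ z σ) S₁ (trans (cong (_+ length xs) (step-τ z σ)) τ+≡) (step-fits z σ ok)
        in S₂ , trans (while-≤ {suc (length xs)} {2} {0} {body} {μ = layout σ S} {z ∷ xs} τ n refl refl τ≤n)
            (trans (cong (_>>= exec (suc (length xs)) mainLoop) h₁) h₂)
        where
        τ+≡ : suc τ + length xs ≡ N
        τ+≡ = trans (sym (+-suc τ (length xs))) τ≡
        τ≤n : τ ≤ n
        τ≤n = ≤-pred (subst (suc τ ≤_) τ+≡ (m≤m+n (suc τ) (length xs)))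

    output : Carrier → List Carrier → Carrier
    output z xs = St.y (foldl (λ σ z → step _≼_ z σ) (initial z) xs)

    run-ok : ∀ z xs → suc (length xs) ≡ n → run (suc (length xs)) program n k (z ∷ xs) ≡ return (output z xs)
    run-ok z xs len≡ = begin
      run t program n k (z ∷ xs)
        ≡⟨ cong (_>>= (λ σ → write 1 (int (+ k)) σ >>= λ σ → exec t program σ >>= finish))
            (write-ok 0 (int (+ n)) μ₀ (z ∷ xs) (fits-int n≤B)) ⟩
      (write 1 (int (+ k)) ⟨ set 0 (int (+ n)) μ₀ , z ∷ xs ⟩ >>= λ σ → exec t program σ >>= finish)
        ≡⟨ cong (_>>= (λ σ → exec t program σ >>= finish))
            (write-ok 1 (int (+ k)) (set 0 (int (+ n)) μ₀) (z ∷ xs) (fits-int (≤-trans k≤n n≤B))) ⟩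
      (exec t program ⟨ μ₁ , z ∷ xs ⟩ >>= finish)
        ≡⟨ cong (_>>= finish) executed ⟩
      (read 0 ⟨ set 0 (elem (St.y σ)) (layout rest σ S) , [] ⟩ >>= asElem)
        ≡⟨ cong (_>>= asElem) (read-ok 0 (set 0 (elem (St.y σ)) (layout rest σ S)) []) ⟩
      return (St.y σ)
        ∎
      where
      open ≡-Reasoning
      t : ℕ
      t = suc (length xs)
      finish : State → Rand Carrier
      finish σ = read 0 σ >>= asElem
      rest : Vec (Word Carrier) e
      rest = replicate e (int (+ 0))
      μ₀ μ₁ μ₂ : Memory
      μ₀ = replicate s (int (+ 0))
      μ₁ = set 1 (int (+ k)) (set 0 (int (+ n)) μ₀)
      μ₂ = set 2 (int (+ 2)) (set 13 (int (+ N)) (set 17 (int (+ 1)) μ₁))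
      -- All other words still hold 0, which also encodes startup mode with i = len = c = 0, as in
      -- `initial`.
      S₀ : Scratch
      S₀ = scratch (int (+ 0)) (int (+ 0)) (int (+ 0)) (int (+ 0)) (int (+ 0)) (int (+ 0))
      constant : ∀ {a} → a ≤ 1024 → a ≤ B
      constant {a} a≤ = ≤-trans (subst (_≤ 1024 * (N * (N * N))) (*-identityʳ a) (*-mono-≤ a≤ (s≤s z≤n))) B≥
      N≤B : N ≤ B
      N≤B = ≤-trans (≤-trans (m≤m*n N (N * N)) (m≤n*m (N * (N * N)) 1024)) B≥
      n≤B : n ≤ B
      n≤B = ≤-trans (n≤1+n n) N≤B
      looped : ∃[ S ] exec t mainLoop ⟨ layout rest (initial z) S₀ , xs ⟩ ≡ return
          ⟨ layout rest (foldl (λ σ z → step _≼_ z σ) (initial z) xs) S , [] ⟩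
      looped = loop-ok rest xs (initial z) S₀ (cong suc len≡) (fits-in z≤n z≤n _)
      S : Scratch
      S = proj₁ looped
      σ : St Carrier
      σ = foldl (λ σ z → step _≼_ z σ) (initial z) xs
      setup-ok : Runs t (z ∷ xs) setup μ₁ μ₂
      setup-ok = const-ok 1 (constant (s≤s z≤n))
        then arith-ok n 1 N refl refl (cong (λ x → return (+ x)) (+-comm n 1)) N≤B
        then const-ok 2 (constant (≤ᵇ⇒≤ 2 1024 _))
      spread-ok : Runs t xs spread (set 3 (elem z) μ₂) (layout rest (initial z) S₀)
      spread-ok = copy-ok (elem z) refl refl then copy-ok (elem z) refl refl then copy-ok (elem z) refl refl then copy-ok (elem z)
          refl refl
      executed : exec t program ⟨ μ₁ , z ∷ xs ⟩ ≡ return ⟨ set 0 (elem (St.y σ)) (layout rest σ S) , [] ⟩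
      executed = trans (cong (_>>= exec t (next 3 ⨾ spread ⨾ mainLoop ⨾ copy 0 3)) (run-≡ setup-ok))
        (trans (cong (_>>= exec t (spread ⨾ mainLoop ⨾ copy 0 3)) (write-ok 3 (elem z) μ₂ xs refl))
        (trans (cong (_>>= exec t (mainLoop ⨾ copy 0 3)) (run-≡ spread-ok))
        (trans (cong (_>>= exec t (copy 0 3)) (proj₂ looped))
            (run-≡ (copy-ok {t} {a = 0} {b = 3} {μ = layout rest σ S} (elem (St.y σ)) refl refl)))))

-- The mean square error with explicit constants

module MeanSquareError where

  open Estimator
  open RationalLemmas
  open RandomOrder
  open import Data.Rational.Base
  open import Data.Rational.Properties

  -- 139392 is 4 · 34848; as k ≥ 1, this constant is absorbed into a multiple of k.
  mean-square′ : ∀ C γ (scale : Scale C γ) m k → 1 ℕ.≤ k → k ℕ.≤ suc m →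
    Ranks.rankAverage (suc (suc m)) k m (λ σ → (⟦ suc (St.y σ) ⟧ - ⟦ k ⟧) * (⟦ suc (St.y σ) ⟧ - ⟦ k ⟧))
    ≤ (⟦ 139392 ⟧ + ⟦ 8 ⟧ * γ) * ⟦ k ⟧
  mean-square′ C γ scale m k 1≤k k≤n = ≤-trans (rankAverage-≤ m _ final-error)
    (≤-trans (*-mono-≥0 (⟦⟧≥0 4) startPot-≤) (by-cert _ (eq γ ⟦ k ⟧) (⟦⟧≥0 139392 ⊛ diff≥0 (⟦⟧-mono 1≤k))))
    where
    open Supermartingale C γ scale (suc m) k k≤n
    eq : ∀ γ k → (⟦ 139392 ⟧ + ⟦ 8 ⟧ * γ) * k - ⟦ 4 ⟧ * (⟦ 34848 ⟧ + ⟦ 2 ⟧ * (γ * k)) ≡ ⟦ 139392 ⟧ * (k - 1ℚ)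
    eq = solve-∀ ring

  -- The constant 49152 is 3 · 128², and D satisfies 139392 + 8 γ ≤ D².
  abstract
    D : ℕ
    D = 9000000

    mean-square : ∀ m k → 1 ℕ.≤ k → k ℕ.≤ suc m →
      Ranks.rankAverage (suc (suc m)) k m (λ σ → (⟦ suc (St.y σ) ⟧ - ⟦ k ⟧) * (⟦ suc (St.y σ) ⟧ - ⟦ k ⟧)) ≤ ⟦ D ℕ.* D ℕ.* k ⟧
    mean-square m k 1≤k k≤n = ≤-trans
      -- The value of γ is K² + K + 8 with K = 8 + 64 · 49152, as `Scale` prescribes; 139392 + 8 γ
      -- is then 79165265158912.
      (mean-square′ ⟦ 49152 ⟧ ⟦ 9895658127440 ⟧ (≤-refl , ⟦⟧-mono (ℕₚ.≤ᵇ⇒≤ 4194304 9895658127440 _) , refl) m k 1≤k k≤n)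
      (subst (λ x → (⟦ 139392 ⟧ + ⟦ 8 ⟧ * ⟦ 9895658127440 ⟧) * ⟦ k ⟧ ≤ x) (sym (⟦⟧-* (D ℕ.* D) k))
        (*-monoʳ-≤-nonNeg ⟦ k ⟧ {{nonNegative (⟦⟧≥0 k)}} {⟦ 139392 ⟧ + ⟦ 8 ⟧ * ⟦ 9895658127440 ⟧} {⟦ D ℕ.* D ⟧}
          (⟦⟧-mono {79165265158912} {D ℕ.* D} (ℕₚ.≤ᵇ⇒≤ 79165265158912 (D ℕ.* D) _))))

-- Correctness of the program and its expected error

module ErrorBound where

  open import Defs
  open Estimator
  open RationalLemmas
  open NearestArrival
  open RandomOrder
  open GapArrivals using (⟦⟧-∸)
  open WordProgram
  open ProgramExecution
  open MeanSquareError
  open import Data.Fin.Base using (Fin; zero; suc; toℕ)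
  open import Data.Fin.Properties using (toℕ<n)
  import Data.Fin.Properties as Finₚ
  open import Data.Integer.Base using (+_)
  open import Data.List.Base as List using (List; []; _∷_; foldl; length; filter; insertAt)
  open import Data.List.Properties using (length-tabulate)
  open import Data.List.Relation.Unary.All using (All; []; _∷_)
  import Data.List.Relation.Unary.All.Properties as Allₚ
  open import Data.Maybe.Base as Maybe using (Maybe; just; nothing)
  open import Data.Nat.Base using (_≤ᵇ_; _^_; ∣_-_∣)
  open import Data.Nat.Logarithm using (⌊log₂_⌋)
  open import Data.Rational.Base as ℚ hiding (_≤ᵇ_; ∣_∣)
  open import Data.Rational.Properties
  open import Function.Base using (_∘_; id)
  open import Relation.Binary.Bundles using (DecTotalOrder)
  open import Relation.Binary.Definitions using (tri<; tri≈; tri>)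
  open import Relation.Nullary.Decidable using (dec-true; dec-false)
  import Data.Nat.Tactic.RingSolver as ℕ-Solver

  Always->>= : {X Y : Set} {R : X → Set} {Q : Y → Set} (m : Rand X) {g : X → Rand Y} →
    Always R m → (∀ a → R a → Always Q (g a)) → Always Q (m >>= g)
  Always->>= (return a) r h = h a r
  Always->>= (draw l f) r h = λ i → Always->>= (f i) (r i) h

  shuffled : {X : Set} (Q : X → Set) (xs : List X) → All Q xs → Always (λ ys → length ys ≡ length xs × All Q ys) (shuffle xs)
  shuffled Q []       []        = refl , []
  shuffled Q (x ∷ xs) (qx ∷ qs) = Always->>= (shuffle xs) (shuffled Q xs qs) λ ys (len , all) i →
    trans (length-insertAt ys i) (cong suc len) , all-insertAt ys i all
    where
    length-insertAt : ∀ ys i → length (insertAt ys i x) ≡ suc (length ys)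
    length-insertAt ys       zero    = refl
    length-insertAt (y ∷ ys) (suc i) = cong suc (length-insertAt ys i)
    all-insertAt : ∀ ys i → All Q ys → All Q (insertAt ys i x)
    all-insertAt ys       zero    qs       = qx ∷ qs
    all-insertAt (y ∷ ys) (suc i) (q ∷ qs) = q ∷ all-insertAt ys i qs

  module Moments (N k : ℕ) where
    open Algorithm N k
    open Ranks N k

    rankAverage≥0 : ∀ m (f : St ℕ → ℚ) → (∀ σ → 0ℚ ≤ f σ) → 0ℚ ≤ rankAverage m f
    rankAverage≥0 zero    f f≥0 = f≥0 (initial 0)
    rankAverage≥0 (suc m) f f≥0 = inv≥0 (suc (suc m)) ⊛ Σ<≥0 (suc (suc m)) λ g _ → rankAverage≥0 m _ λ σ → f≥0 _

    rankAverage-1 : ∀ m → rankAverage m (λ _ → 1ℚ) ≡ 1ℚ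
    rankAverage-1 zero    = refl
    rankAverage-1 (suc m) = trans (cong (inv (suc (suc m)) *_)
      (trans (Σ<-cong (suc (suc m)) λ _ _ → rankAverage-1 m) (Σ<-const (suc (suc m)) 1ℚ)))
      (inv-cancel (suc m) 1ℚ)

    -- This is E (f − E f)² ≥ 0.
    square-average : ∀ m (f : St ℕ → ℚ) → rankAverage m f * rankAverage m f ≤ rankAverage m (λ σ → f σ * f σ)
    square-average m f = by-cert (rankAverage m (λ σ → (f σ - E) * (f σ - E)))
      (sym (begin
        rankAverage m (λ σ → (f σ - E) * (f σ - E))
          ≡⟨ rankAverage-cong m (λ σ → expand (f σ) E) ⟩
        rankAverage m (λ σ → f σ * f σ + (⟦ 2 ⟧ * - E * f σ + E * E * 1ℚ))
          ≡⟨ rankAverage-+ m (λ σ → f σ * f σ) _ ⟩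
        rankAverage m (λ σ → f σ * f σ) + rankAverage m (λ σ → ⟦ 2 ⟧ * - E * f σ + E * E * 1ℚ)
          ≡⟨ cong (_+_ (rankAverage m (λ σ → f σ * f σ))) (rankAverage-+ m (λ σ → ⟦ 2 ⟧ * - E * f σ) (λ _ → E * E * 1ℚ)) ⟩
        rankAverage m (λ σ → f σ * f σ) + (rankAverage m (λ σ → ⟦ 2 ⟧ * - E * f σ) + rankAverage m (λ _ → E * E * 1ℚ))
          ≡⟨ cong₂ (λ x y → rankAverage m (λ σ → f σ * f σ) + (x + y)) (rankAverage-* m (⟦ 2 ⟧ * - E) f)
               (trans (rankAverage-* m (E * E) (λ _ → 1ℚ)) (cong (E * E *_) (rankAverage-1 m))) ⟩
        rankAverage m (λ σ → f σ * f σ) + (⟦ 2 ⟧ * - E * E + E * E * 1ℚ)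
          ≡⟨ collect (rankAverage m (λ σ → f σ * f σ)) E ⟩
        rankAverage m (λ σ → f σ * f σ) - E * E
          ∎))
      (rankAverage≥0 m _ λ σ → sq≥0 (f σ - E))
      where
      open ≡-Reasoning
      E : ℚ
      E = rankAverage m f
      expand : ∀ x e → (x - e) * (x - e) ≡ x * x + (⟦ 2 ⟧ * - e * x + e * e * 1ℚ)
      expand = solve-∀ ring
      collect : ∀ a e → a + (⟦ 2 ⟧ * - e * e + e * e * 1ℚ) ≡ a - e * e
      collect = solve-∀ ring

  square-∣-∣ : ∀ a b → ⟦ ∣ a - b ∣ ⟧ * ⟦ ∣ a - b ∣ ⟧ ≡ (⟦ a ⟧ - ⟦ b ⟧) * (⟦ a ⟧ - ⟦ b ⟧)
  square-∣-∣ a b with ℕₚ.≤-total a b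
  ... | inj₁ a≤b = trans (cong (λ x → x * x) (trans (cong ⟦_⟧ (ℕₚ.m≤n⇒∣m-n∣≡n∸m a≤b)) (⟦⟧-∸ a≤b))) (flip ⟦ a ⟧ ⟦ b ⟧)
    where
    flip : ∀ a b → (b - a) * (b - a) ≡ (a - b) * (a - b)
    flip = solve-∀ ring
  ... | inj₂ b≤a = cong (λ x → x * x) (trans (cong ⟦_⟧ (ℕₚ.m≤n⇒∣n-m∣≡n∸m b≤a)) (⟦⟧-∸ b≤a))

  length-filter : ∀ {A : Set} {P : A → Set} (P? : ∀ a → Dec (P a)) n (x : Fin n → A) c → c ℕ.≤ n →
    (∀ i → does (P? (x i)) ≡ (suc (toℕ i) ≤ᵇ c)) → length (filter P? (List.tabulate x)) ≡ c
  length-filter P? zero    x zero    c≤n h = refl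
  length-filter P? (suc n) x zero    c≤n h with does (P? (x zero)) | h zero
  ... | false | _ = length-filter P? n (x ∘ suc) zero z≤n (h ∘ suc)
  length-filter P? (suc n) x (suc c) (s≤s c≤n) h with does (P? (x zero)) | h zero
  ... | true | _ = cong suc (length-filter P? n (x ∘ suc) c c≤n (h ∘ suc))

  module Correctness (O : DecTotalOrder 0ℓ 0ℓ 0ℓ) (m k : ℕ) (1≤k : 1 ℕ.≤ k) (k≤n : k ℕ.≤ suc m)
    (e B : ℕ) (B≥ : 1024 ℕ.* (suc (suc m) ℕ.* (suc (suc m) ℕ.* suc (suc m))) ℕ.≤ B)
    (x : Fin (suc m) → DecTotalOrder.Carrier O) (decreasing : Quantile.StrictlyDecreasing O x) where

    open DecTotalOrder O using (Carrier; reflexive; antisym; module Eq) renaming (_≤?_ to _≤ᴼ?_; _≤_ to _≤ᴼ_)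
    open Quantile O
    open Execution O e B (suc m) k k≤n B≥
    open Machine O s B using (run)
    open Ranks N k
    open Moments N k
    open Algorithm N k

    n : ℕ
    n = suc m

    compat : ∀ u v → (x u ≼ x v) ≡ (u ≽ᶠ v)
    compat u v with ℕₚ.<-cmp (toℕ v) (toℕ u)
    ... | tri< v<u _ _ = trans (dec-true (x u ≤ᴼ? x v) (proj₁ (decreasing v<u))) (sym (≤ᵇ-true (ℕₚ.<⇒≤ v<u)))
    ... | tri≈ _ v≡u _ = trans (dec-true (x u ≤ᴼ? x v) (reflexive (Eq.reflexive (cong x (sym (Finₚ.toℕ-injective v≡u))))))
        (sym (≤ᵇ-true (ℕₚ.≤-reflexive v≡u)))
    ... | tri> _ _ u<v = trans (dec-false (x u ≤ᴼ? x v) λ le → proj₂ (decreasing u<v) (antisym (proj₁ (decreasing u<v)) le))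
        (sym (≤ᵇ-false u<v))

    rank-index : ∀ j → rank x (x j) ≡ suc (toℕ j)
    rank-index j = length-filter (λ i → x j ≤ᴼ? x i) n id (suc (toℕ j)) (toℕ<n j) λ i → trans (compat j i)
        (≤ᵇ-suc (toℕ i) (toℕ j))
      where
      ≤ᵇ-suc : ∀ a b → (a ≤ᵇ b) ≡ (suc a ≤ᵇ suc b)
      ≤ᵇ-suc zero    b = refl
      ≤ᵇ-suc (suc a) b = refl

    result : Rand Carrier
    result = estimate s B n program k x

    final : List Carrier → Maybe (St Carrier)
    final = foldl (push _≼_) nothing

    foldl-push : ∀ σ zs → foldl (push _≼_) (just σ) zs ≡ just (foldl (λ σ z → step _≼_ z σ) σ zs)
    foldl-push σ []       = refl
    foldl-push σ (z ∷ zs) = foldl-push (step _≼_ z σ) zs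

    run-final : ∀ zs → length zs ≡ n → ∃[ σ ] final zs ≡ just σ × run n program n k zs ≡ return (St.y σ)
    run-final (z ∷ zs) eq = foldl (λ σ z → step _≼_ z σ) (initial z) zs , foldl-push (initial z) zs ,
      subst (λ t → run t program n k (z ∷ zs) ≡ return (output z zs)) eq (run-ok z zs eq)

    -- The run on the stream is the image under x of a run on indices, so whatever it stores is of
    -- the form x j.
    final-index : ∀ zs → All (λ z → ∃[ j ] z ≡ x j) zs → ∀ σ → final zs ≡ just σ → ∃[ j ] St.y σ ≡ x j
    final-index zs all σ eq = from-map (Maybe.map (mapSt x) state) refl (trans (sym (foldl-map nothing zs all)) eq)
      where
      indices : ∀ zs → All (λ z → ∃[ j ] z ≡ x j) zs → List (Fin n)
      indices []       []             = []
      indices (z ∷ zs) ((j , _) ∷ js) = j ∷ indices zs js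
      pushᶠ : Maybe (St (Fin n)) → Fin n → Maybe (St (Fin n))
      pushᶠ = push _≽ᶠ_
      state : Maybe (St (Fin n))
      state = foldl pushᶠ nothing (indices zs all)
      foldl-map : ∀ σ zs (all : All (λ z → ∃[ j ] z ≡ x j) zs) →
        foldl (push _≼_) (Maybe.map (mapSt x) σ) zs ≡ Maybe.map (mapSt x) (foldl pushᶠ σ (indices zs all))
      foldl-map σ        []       []                = refl
      foldl-map nothing  (_ ∷ zs) ((j , refl) ∷ js) = foldl-map (just (initial j)) zs js
      foldl-map (just σ) (_ ∷ zs) ((j , refl) ∷ js) = trans
        (cong (λ σ → foldl (push _≼_) (just σ) zs) (step-map x _≽ᶠ_ _≼_ compat j σ))
        (foldl-map (just (step _≽ᶠ_ j σ)) zs js)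
      from-map : ∀ τ → Maybe.map (mapSt x) state ≡ τ → τ ≡ just σ → ∃[ j ] St.y σ ≡ x j
      from-map τ refl eq with state
      from-map τ refl refl | just σ′ = St.y σ′ , refl

    always-element : Always (λ y → ∃[ j ] y ≡ x j) result
    always-element = Always->>= (shuffle (List.tabulate x))
        (shuffled (λ z → ∃[ j ] z ≡ x j) (List.tabulate x) (Allₚ.tabulate⁺ λ j → j , refl))
      λ zs (len , all) → returns zs all (run-final zs (trans len (length-tabulate x)))
      where
      returns : ∀ zs → All (λ z → ∃[ j ] z ≡ x j) zs → ∃[ σ ] final zs ≡ just σ × run n program n k zs ≡ return (St.y σ) →
        Always (λ y → ∃[ j ] y ≡ x j) (run n program n k zs)
      returns zs all (σ , final≡ , run≡) = subst (Always (λ y → ∃[ j ] y ≡ x j)) (sym run≡) (final-index zs all σ final≡)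

    rankError : St ℕ → ℚ
    rankError σ = ⟦ ∣ suc (St.y σ) - k ∣ ⟧

    expected-error : expectation (error x k) result ≡ rankAverage m rankError
    expected-error = begin
      expectation (error x k) result
        ≡⟨ expectation->>= (error x k) (shuffle (List.tabulate x)) (run n program n k) ⟩
      expectation (λ zs → expectation (error x k) (run n program n k zs)) (shuffle (List.tabulate x))
        ≡⟨ expectation-shuffle n x _ ⟩
      average n x (λ zs → expectation (error x k) (run n program n k zs))
        ≡⟨ average-cong n x (λ zs eq → value zs (run-final zs eq)) ⟩
      average n x (λ zs → F (final zs))
        ≡⟨ average-run _≼_ m x compat F ⟩
      rankAverageᶠ m (λ σ → error x k (x (St.y σ)))
        ≡⟨ rankAverageᶠ-cong m (λ σ → cong (λ r → ⟦ ∣ r - k ∣ ⟧) (rank-index (St.y σ))) ⟩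
      rankAverageᶠ m (λ σ → rankError (mapSt toℕ σ))
        ≡⟨ rankAverage-toℕ m rankError ⟩
      rankAverage m rankError
        ∎
      where
      open ≡-Reasoning
      F : Maybe (St Carrier) → ℚ
      F nothing  = 0ℚ
      F (just σ) = error x k (St.y σ)
      value : ∀ zs → ∃[ σ ] final zs ≡ just σ × run n program n k zs ≡ return (St.y σ) →
        expectation (error x k) (run n program n k zs) ≡ F (final zs)
      value zs (σ , final≡ , run≡) = trans (cong (expectation (error x k)) run≡) (sym (cong F final≡))

    error-bound : expectation (error x k) result * expectation (error x k) result ≤ ⟦ D ℕ.* D ℕ.* k ⟧
    error-bound = subst (λ E → E * E ≤ ⟦ D ℕ.* D ℕ.* k ⟧) (sym expected-error) (≤-trans (square-average m rankError)
      (≤-trans (≤-reflexive (rankAverage-cong m λ σ → square-∣-∣ (suc (St.y σ)) k)) (mean-square m k 1≤k k≤n)))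

  -- 8192 is 2³ · 1024, as the number of gaps is at most twice the number of elements.
  magnitude-bound : ∀ n → 1024 ℕ.* (suc (suc n) ℕ.* (suc (suc n) ℕ.* suc (suc n))) ℕ.≤ 8192 ℕ.* suc n ^ 3
  magnitude-bound n = ℕₚ.≤-trans (ℕₚ.*-monoʳ-≤ 1024 (ℕₚ.*-mono-≤ double (ℕₚ.*-mono-≤ double double)))
      (ℕₚ.≤-reflexive (scale (suc n)))
    where
    double : suc (suc n) ℕ.≤ 2 ℕ.* suc n
    double = subst (suc (suc n) ℕ.≤_) (cong (suc n ℕ.+_) (sym (ℕₚ.+-identityʳ (suc n)))) (ℕₚ.+-monoˡ-≤ (suc n) {1} (s≤s z≤n))
    scale : ∀ a → 1024 ℕ.* (2 ℕ.* a ℕ.* (2 ℕ.* a ℕ.* (2 ℕ.* a))) ≡ 8192 ℕ.* a ^ 3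
    scale a = trans (cong (1024 ℕ.*_) (cube a)) (sym (ℕₚ.*-assoc 1024 8 (a ^ 3)))
      where
      cube : ∀ a → 2 ℕ.* a ℕ.* (2 ℕ.* a ℕ.* (2 ℕ.* a)) ≡ 8 ℕ.* (a ℕ.* (a ℕ.* (a ℕ.* 1)))
      cube = ℕ-Solver.solve-∀

  correct : (O : DecTotalOrder 0ℓ 0ℓ 0ℓ) (n k : ℕ) → 1 ℕ.≤ k → k ℕ.≤ n →
    (x : Fin n → DecTotalOrder.Carrier O) → Quantile.StrictlyDecreasing O x →
    ∃[ t ] (let result = Quantile.estimate O (20 ℕ.* (1 ℕ.+ ⌊log₂ k ⌋)) (8192 ℕ.* n ^ 3) t program k x
                expectedError = expectation (Quantile.error O x k) result
            in Always (λ y → ∃[ j ] y ≡ x j) result × expectedError * expectedError ≤ ⟦ D ℕ.* D ℕ.* k ⟧)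
  correct O zero    k 1≤k k≤n x decreasing = contradiction (ℕₚ.≤-trans 1≤k k≤n) λ ()
  correct O (suc m) k 1≤k k≤n x decreasing = suc m ,
    subst (λ s → let result = Quantile.estimate O s (8192 ℕ.* suc m ^ 3) (suc m) program k x
                     expectedError = expectation (Quantile.error O x k) result
                 in Always (λ y → ∃[ j ] y ≡ x j) result × expectedError * expectedError ≤ ⟦ D ℕ.* D ℕ.* k ⟧)
      (sym (ℕₚ.*-suc 20 ⌊log₂ k ⌋)) (always-element , error-bound)
    where open Correctness O m k 1≤k k≤n (20 ℕ.* ⌊log₂ k ⌋) (8192 ℕ.* suc m ^ 3) (magnitude-bound m) x decreasing

open import Defs
open import Level using (0ℓ)
open import Data.Fin.Base using (Fin)
open import Data.Integer.Base using (+_)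
open import Data.Nat.Base using (ℕ; _+_; _*_; _^_; _≤_)
open import Data.Nat.Logarithm using (⌊log₂_⌋)
open import Data.Product.Base using (_×_; ∃-syntax)
open import Data.Rational.Base as ℚ using (ℚ)
open import Relation.Binary.Bundles using (DecTotalOrder)
open import Relation.Binary.PropositionalEquality using (_≡_)
open MeanSquareError using (D)
open WordProgram using (program)
open ErrorBound using (correct)

theorem2 :
  ∃[ P ] ∃[ C ] ∃[ D ] ∃[ c ] ∃[ d ]
    ((O : DecTotalOrder 0ℓ 0ℓ 0ℓ) →
     let open DecTotalOrder O using (Carrier)
         open Quantile O in
     (n k : ℕ) → 1 ≤ k → k ≤ n →
     (x : Fin n → Carrier) → StrictlyDecreasing x →
     ∃[ t ]
       (let result = estimate (C * (1 + ⌊log₂ k ⌋)) (c * n ^ d) t P k x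
            expectedError = expectation (error x k) result
        in Always (λ y → ∃[ j ] y ≡ x j) result
           -- expectedError ≤ D √k, squared; both sides are nonnegative
           × expectedError ℚ.* expectedError ℚ.≤ + (D * D * k) ℚ./ 1))
theorem2 = program , 20 , D , 8192 , 3 , correct
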